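{- Every nice graph is algebraic $(1,5)$-choosable.
   Context: All graphs are finite and simple, with vertex set $V=\{1,\dots,n\}$; an edge is a $2$-element subset $\{i,j\}$ of $V$. For $i\in V$, $E(i)$ is the set of edges incident to $i$. An edge $\{i,j\}$ is isolated if both $i$ and $j$ have degree $1$; a graph is nice if it has no isolated edges. For a graph $G=(V,E)$ define the polynomial in variables $x_e$ ($e\in E$) $$P_G=\prod_{\{i,j\}\in E,\ i<j}\Big(\sum_{e\in E(i)}x_e-\sum_{e\in E(j)}x_e\Big)$$ (the empty product is $1$). For $K:E\to\mathbb{N}$ write $x^K=\prod_{e\in E}x_e^{K(e)}$, and let $\mathrm{mon}(P)$ be the set of monomials $x^K$ with nonzero coefficient in $P$. For a positive integer $b$, $G$ is algebraic $(1,b)$-choosable if there is $K:E\to\mathbb{N}$ with $\sum_{e\in E}K(e)=|E|$ and $K(e)\le b-1$ for all $e\in E$ such that $x^K\in\mathrm{mon}(P_G)$. (By the Combinatorial Nullstellensatz this implies total weight $(1,b)$-choosability.) -}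

module Defs where

open import Data.Fin using (Fin; _<_)
open import Data.Fin.Properties using (_≟_; _<?_)
open import Data.Integer as ℤ using (ℤ; 0ℤ; 1ℤ)
open import Data.List using (List; []; _++_; [_]; map; foldr; filter; length; lookup; allFin; cartesianProduct; cartesianProductWith)
open import Data.Nat.ListAction using (sum)
open import Data.Nat as ℕ using (ℕ; _≤_; _∸_; NonZero)
import Data.Nat.Properties as ℕ
open import Data.Product using (_×_; _,_; proj₁; proj₂; ∃-syntax)
open import Data.Vec using (Vec; zipWith; replicate; tabulate; _[_]≔_)
open import Data.Vec.Properties using (≡-dec)
open import Level using (0ℓ)
open import Relation.Binary using (Rel; Symmetric; Irreflexive; Decidable)
open import Relation.Binary.PropositionalEquality using (_≡_; _≢_)
open import Relation.Nullary using (¬_)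
open import Relation.Nullary.Decidable using (_×-dec_; _⊎-dec_)
open import Relation.Unary using (Pred; _∈_)

-- Polynomials over ℤ in m variables, written as formal sums of terms.
-- The same exponent vector may occur in several terms; `coeff` collects them,
-- so two term lists denote the same polynomial iff their `coeff`s agree.

Monomial : ℕ → Set
Monomial m = Vec ℕ m

Poly : ℕ → Set
Poly m = List (ℤ × Monomial m)

module _ {m : ℕ} where

  infixl 6 _+ₚ_ _-ₚ_
  infixl 7 _*ₚ_

  coeff : Poly m → Monomial m → ℤ
  coeff p M = foldr ℤ._+_ 0ℤ (map proj₁ (filter (λ t → ≡-dec ℕ._≟_ (proj₂ t) M) p))

  mon : Poly m → Pred (Monomial m) 0ℓ
  mon p M = coeff p M ≢ 0ℤ

  0ₚ 1ₚ : Poly m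
  0ₚ = []
  1ₚ = [ (1ℤ , replicate m 0) ]

  var : Fin m → Poly m
  var e = [ (1ℤ , replicate m 0 [ e ]≔ 1) ]

  _+ₚ_ _-ₚ_ _*ₚ_ : Poly m → Poly m → Poly m
  p +ₚ q = p ++ q
  p -ₚ q = p ++ map (λ (c , M) → ℤ.- c , M) q
  p *ₚ q = cartesianProductWith (λ (c , M) (d , N) → c ℤ.* d , zipWith ℕ._+_ M N) p q

  ∑ₚ ∏ₚ : {A : Set} → List A → (A → Poly m) → Poly m
  ∑ₚ as f = foldr _+ₚ_ 0ₚ (map f as)
  ∏ₚ as f = foldr _*ₚ_ 1ₚ (map f as)

record Graph (n : ℕ) : Set₁ where
  infix 4 _~_ _~?_
  field
    _~_    : Rel (Fin n) 0ℓ
    sym    : Symmetric _~_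
    irrefl : Irreflexive _≡_ _~_
    _~?_   : Decidable _~_

  -- The edge {i , j} is listed exactly once, as the pair (i , j) with i < j.
  edges : List (Fin n × Fin n)
  edges = filter (λ (i , j) → (i <? j) ×-dec (i ~? j)) (cartesianProduct (allFin n) (allFin n))

  ∣E∣ : ℕ
  ∣E∣ = length edges

  -- An edge is referred to by its position in `edges`, so that K : E → ℕ is a
  -- function on Edge and x_e is the variable with index e.
  Edge : Set
  Edge = Fin ∣E∣

  lo hi : Edge → Fin n
  lo e = proj₁ (lookup edges e)
  hi e = proj₂ (lookup edges e)

  E⟨_⟩ : Fin n → List Edge
  E⟨ i ⟩ = filter (λ e → (i ≟ lo e) ⊎-dec (i ≟ hi e)) (allFin ∣E∣)

  degree : Fin n → ℕ
  degree i = length E⟨ i ⟩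

  IsolatedEdge : Pred Edge 0ℓ
  IsolatedEdge e = degree (lo e) ≡ 1 × degree (hi e) ≡ 1

  Nice : Set
  Nice = ∀ e → ¬ IsolatedEdge e

  P : Poly ∣E∣
  P = ∏ₚ (allFin ∣E∣) λ e → ∑ₚ E⟨ lo e ⟩ var -ₚ ∑ₚ E⟨ hi e ⟩ var

  x^_ : (Edge → ℕ) → Monomial ∣E∣
  x^ K = tabulate K

  Algebraic⟨1,_⟩-choosable : (b : ℕ) .{{_ : NonZero b}} → Set
  Algebraic⟨1, b ⟩-choosable =
    ∃[ K ] sum (map K (allFin ∣E∣)) ≡ ∣E∣ × (∀ e → K e ≤ b ∸ 1) × (x^ K) ∈ mon P

module Submission where

-- An edge ab moves the vector (y_v) of vertex sums by e_a + e_b, and P_G is the product of the forms y_i − y_j.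
-- By multilinearity it suffices to find |E| directions, each a signed sum of edges, such that the permanent of the
-- matrix of values of the |E| forms on these directions is nonzero and every edge is used at most four times.
--
-- In a depth-first forest every edge joins an ancestor to a descendant. Choosing greedily from the leaves upwards gives
-- an independent set I such that every vertex of the complement J has a neighbour in I below it. The I–J forms are to be
-- covered by directions supported on I, on which the J–J forms vanish, so the matrix is block triangular. The J–J forms
-- (a , d), a above d, are covered by alternating walks a, d, a′ with a′ the next J-neighbour above a, or a, d, i with
-- i ∈ I, which is triangular in the depth of a.
--
-- On directions supported on I the form (i , j) is the coordinate y_i. These coordinates ("tokens") are paired up, and a
-- pair with origins o and o′ is covered by taking z = e_o ± e_o′ twice: up to sign, the coefficient of ∏ y_o y_o′ in
-- (∏ z)² is the sum of the squares of the coefficients of ∏ z, hence nonzero. One token of each tree may be left over and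
-- is covered by a single z. Pairs are formed bottom-up: the tokens meeting at a vertex are paired there, and an odd one is
-- passed on to an ancestor; the case distinctions keep the number of uses of every edge at most four. Only a root with
-- a single neighbour can fail to find a partner for its token, and then niceness provides one.

open import Defs
open import Data.Bool using (Bool; false; not; true)
open import Data.Bool.Properties using () renaming (_≟_ to _≟ᵇ_)
open import Data.Empty using (⊥; ⊥-elim)
open import Data.Fin using (Fin; _<_; suc; toℕ; zero)
import Data.Fin.Properties as Finₚ
open import Data.Integer as ℤ using (-1ℤ; -_; 0ℤ; 1ℤ; _*_; _+_; _-_; ℤ) renaming (+_ to pos)
import Data.Integer.Properties as ℤₚ
open import Data.Integer.Tactic.RingSolver using (solve-∀)
open import Data.List using (List; []; _++_; _∷_; allFin; cartesianProduct; concatMap; drop; filter; foldr; length; lookup; map; tabulate)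
open import Data.List.Membership.Propositional using (_∈_; _∉_; find; lose)
open import Data.List.Membership.Propositional.Properties using (∈-++⁺ʳ; ∈-++⁺ˡ; ∈-++⁻; ∈-allFin; ∈-cartesianProduct⁺; ∈-filter⁺; ∈-filter⁻; ∈-lookup; ∈-map⁺; ∈-map⁻; ∈-∃++)
import Data.List.Properties as Listₚ
open import Data.List.Relation.Binary.Permutation.Propositional using (_↭_; module PermutationReasoning; prep; refl; swap; trans; ↭-refl; ↭-reflexive; ↭-sym; ↭-trans)
open import Data.List.Relation.Binary.Permutation.Propositional.Properties using (++-assoc; ++-comm; ++⁺; ++⁺ʳ; ++⁺ˡ; All-resp-↭; map⁺; shift; shifts; ↭-empty-inv; ↭-length; ∈-resp-↭)
open import Data.List.Relation.Unary.All as All using (All; []; _∷_)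
import Data.List.Relation.Unary.All.Properties as Allₚ
open import Data.List.Relation.Unary.AllPairs as AllPairs using (AllPairs; []; _∷_)
import Data.List.Relation.Unary.AllPairs.Properties as AllPairsₚ
open import Data.List.Relation.Unary.Any using (Any; any?; here; index; there)
import Data.List.Relation.Unary.Any.Properties as Anyₚ
open import Data.List.Relation.Unary.Unique.Propositional using (Unique)
import Data.List.Relation.Unary.Unique.Propositional.Properties as Uniqueₚ
open import Data.Maybe using (Maybe; just; nothing)
open import Data.Nat as ℕ using (suc; s≤s; zero; z≤n; ℕ)
open import Data.Nat.ListAction using (sum)
open import Data.Nat.ListAction.Properties using (sum-++)
import Data.Nat.Properties as ℕₚ
open import Data.Nat.Tactic.RingSolver using () renaming (solve-∀ to solveℕ-∀)
open import Data.Product as Product using (_,_; _×_; map₂; proj₁; proj₂; Σ; Σ-syntax; ∃-syntax)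
open import Data.Sum as Sum using ([_,_]′; _⊎_; inj₁; inj₂)
open import Data.Unit using (tt; ⊤)
open import Data.Vec as Vec using ([]; _[_]%=_; _[_]≔_; _∷_; replicate; zipWith) renaming (lookup to vlookup)
import Data.Vec.Properties as Vecₚ
open import Function using (_∘_; case_of_; flip; id)
open import Relation.Binary using (tri<; tri>; tri≈)
open import Relation.Binary.PropositionalEquality using (_≡_; _≢_; cong; cong₂; module ≡-Reasoning; refl; subst; subst₂; sym) renaming (trans to ≡-trans)
open import Relation.Nullary using (Dec; contradiction; does; no; yes; ¬?; ¬_)
open import Relation.Nullary.Decidable using (_×-dec_; _⊎-dec_)

-- The permanent enters because the coefficient of x^K in a product of linear forms, times the
-- factorials of the K(e), is the permanent of the coefficient matrix with column e repeated K(e)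
-- times. A permanent has no general reason to be nonzero; here positivity supplies one twice, as a
-- sum of squares for the I-J forms and as a matrix of zeros and ones for the J-J forms of one
-- depth. The bound four is two times two: a walk inside a square is used twice, so an edge can
-- carry two such walks, or one of them and up to two single uses by J-J directions. Two obstacles
-- shape the induction. A token that travels upwards needs free capacity on an edge that other walks
-- load as well, so bounds on the uses so far are part of the invariant. And two walks that meet at
-- a vertex may have the same origin and leave the same sign there, so that their combination would
-- be zero; what is known about origins and signs has to travel with each token.

private variable
  Elem Elem′ Row Col : Set
  Rel₂ : Elem → Elem → Set
  m n : ℕ

-- Lists, permutations and duplicate-free lists

AllPairs-↭ : (∀ {x y} → Rel₂ x y → Rel₂ y x) → ∀ {xs ys} → xs ↭ ys → AllPairs Rel₂ xs → AllPairs Rel₂ ys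
AllPairs-↭ s refl          ps                    = ps
AllPairs-↭ s (prep x q)    (p ∷ ps)              = All-resp-↭ q p ∷ AllPairs-↭ s q ps
AllPairs-↭ s (swap x y q)  ((pxy ∷ p) ∷ p′ ∷ ps) = (s pxy ∷ All-resp-↭ q p′) ∷ All-resp-↭ q p ∷ AllPairs-↭ s q ps
AllPairs-↭ s (trans q₁ q₂) ps                    = AllPairs-↭ s q₂ (AllPairs-↭ s q₁ ps)

AllPairs-++ˡ : ∀ xs {ys} → AllPairs Rel₂ (xs ++ ys) → AllPairs Rel₂ xs
AllPairs-++ˡ []       _        = []
AllPairs-++ˡ (x ∷ xs) (p ∷ ps) = Allₚ.++⁻ˡ xs p ∷ AllPairs-++ˡ xs ps

AllPairs-++ʳ : ∀ xs {ys} → AllPairs Rel₂ (xs ++ ys) → AllPairs Rel₂ ys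
AllPairs-++ʳ []       ps       = ps
AllPairs-++ʳ (x ∷ xs) (p ∷ ps) = AllPairs-++ʳ xs ps

AllPairs-cross : ∀ xs {ys} → AllPairs Rel₂ (xs ++ ys) → ∀ {x y} → x ∈ xs → y ∈ ys → Rel₂ x y
AllPairs-cross (x ∷ xs) (p ∷ ps) (here refl) y∈ = All.lookup p (∈-++⁺ʳ xs y∈)
AllPairs-cross (x ∷ xs) (p ∷ ps) (there x∈)  y∈ = AllPairs-cross xs ps x∈ y∈

AllPairs-∈ : (∀ {x y} → Rel₂ x y → Rel₂ y x) → ∀ {xs} → AllPairs Rel₂ xs → ∀ {x y} → x ∈ xs → y ∈ xs → x ≢ y → Rel₂ x y
AllPairs-∈ s (p ∷ ps) (here refl) (here refl) x≢y with () ← x≢y refl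
AllPairs-∈ s (p ∷ ps) (here refl) (there y∈)  x≢y = All.lookup p y∈
AllPairs-∈ s (p ∷ ps) (there x∈)  (here refl) x≢y = s (All.lookup p x∈)
AllPairs-∈ s (p ∷ ps) (there x∈)  (there y∈)  x≢y = AllPairs-∈ s ps x∈ y∈ x≢y

unique-↭ : {xs ys : List Elem} → Unique xs → Unique ys → (∀ {x} → x ∈ xs → x ∈ ys) → (∀ {x} → x ∈ ys → x ∈ xs) → xs ↭ ys
unique-↭ {xs = []} {[]}     _ _ _ _ = ↭-refl
unique-↭ {xs = []} {y ∷ ys} _ _ _ g with () ← g (here refl)
unique-↭ {Elem = Elem} {xs = x ∷ xs} (x∉ ∷ u) u′ f g with ∈-∃++ (f (here refl))
... | l , r , refl = ↭-trans (prep x (unique-↭ u ur f′ g′)) (↭-sym (shift x l r))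
  where
  uxr : Unique (x ∷ l ++ r)
  uxr = AllPairs-↭ (_∘ sym) (shift x l r) u′
  ur : Unique (l ++ r)
  ur = AllPairs.tail uxr
  f′ : ∀ {y} → y ∈ xs → y ∈ l ++ r
  f′ y∈ with ∈-resp-↭ (shift x l r) (f (there y∈))
  ... | here refl with () ← All.lookup x∉ y∈ refl
  ... | there q = q
  g′ : ∀ {y} → y ∈ l ++ r → y ∈ xs
  g′ y∈ with g (∈-resp-↭ (↭-sym (shift x l r)) (there y∈))
  ... | here refl with () ← All.lookup (AllPairs.head uxr) y∈ refl
  ... | there q = q

attach : {P : Elem → Set} (xs : List Elem) → (∀ {x} → x ∈ xs → P x) → List (Σ Elem P)
attach []       _ = []
attach (x ∷ xs) p = (x , p (here refl)) ∷ attach xs (p ∘ there)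

attach-map : {P : Elem → Set} (xs : List Elem) (p : ∀ {x} → x ∈ xs → P x) → map proj₁ (attach xs p) ≡ xs
attach-map []       p = refl
attach-map (x ∷ xs) p = cong (x ∷_) (attach-map xs (p ∘ there))

-- Finite sums of integers

∑ : List Elem → (Elem → ℤ) → ℤ
∑ []       g = 0ℤ
∑ (x ∷ xs) g = g x + ∑ xs g

∑-cong : {g h : Elem → ℤ} (xs : List Elem) → (∀ x → g x ≡ h x) → ∑ xs g ≡ ∑ xs h
∑-cong []       g≗h = refl
∑-cong (x ∷ xs) g≗h = cong₂ _+_ (g≗h x) (∑-cong xs g≗h)

∑-cong-∈ : {g h : Elem → ℤ} (xs : List Elem) → (∀ {x} → x ∈ xs → g x ≡ h x) → ∑ xs g ≡ ∑ xs h
∑-cong-∈ []       g≗h = refl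
∑-cong-∈ (x ∷ xs) g≗h = cong₂ _+_ (g≗h (here refl)) (∑-cong-∈ xs (g≗h ∘ there))

∑-zero : {g : Elem → ℤ} (xs : List Elem) → (∀ {x} → x ∈ xs → g x ≡ 0ℤ) → ∑ xs g ≡ 0ℤ
∑-zero []       g≗0 = refl
∑-zero (x ∷ xs) g≗0 = cong₂ _+_ (g≗0 (here refl)) (∑-zero xs (g≗0 ∘ there))

∑-++ : {g : Elem → ℤ} (xs ys : List Elem) → ∑ (xs ++ ys) g ≡ ∑ xs g + ∑ ys g
∑-++ {g = g} [] ys = sym (ℤₚ.+-identityˡ (∑ ys g))
∑-++ {g = g} (x ∷ xs) ys = ≡-trans (cong (g x +_) (∑-++ xs ys)) (sym (ℤₚ.+-assoc (g x) (∑ xs g) (∑ ys g)))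

∑-map : {g : Elem′ → ℤ} (f : Elem → Elem′) (xs : List Elem) → ∑ (map f xs) g ≡ ∑ xs (g ∘ f)
∑-map f []       = refl
∑-map {g = g} f (x ∷ xs) = cong (g (f x) +_) (∑-map f xs)

∑-+ : (g h : Elem → ℤ) (xs : List Elem) → ∑ xs (λ x → g x + h x) ≡ ∑ xs g + ∑ xs h
∑-+ g h []       = refl
∑-+ g h (x ∷ xs) = ≡-trans (cong ((g x + h x) +_) (∑-+ g h xs)) (lemma (g x) (h x) (∑ xs g) (∑ xs h))
  where
  lemma : ∀ a b c d → (a + b) + (c + d) ≡ (a + c) + (b + d)
  lemma = solve-∀

∑-* : (c : ℤ) (g : Elem → ℤ) (xs : List Elem) → ∑ xs (λ x → c * g x) ≡ c * ∑ xs g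
∑-* c g []       = sym (ℤₚ.*-zeroʳ c)
∑-* c g (x ∷ xs) = ≡-trans (cong (c * g x +_) (∑-* c g xs)) (sym (ℤₚ.*-distribˡ-+ c (g x) (∑ xs g)))

∑-*ʳ : (c : ℤ) (g : Elem → ℤ) (xs : List Elem) → ∑ xs (λ x → g x * c) ≡ ∑ xs g * c
∑-*ʳ c g xs = ≡-trans (∑-cong xs (λ x → ℤₚ.*-comm (g x) c)) (≡-trans (∑-* c g xs) (ℤₚ.*-comm c (∑ xs g)))

∑-swap : (g : Elem → Elem′ → ℤ) (xs : List Elem) (ys : List Elem′) →
         ∑ xs (λ x → ∑ ys (g x)) ≡ ∑ ys (λ y → ∑ xs (λ x → g x y))
∑-swap g []       ys = sym (∑-zero ys (λ _ → refl))
∑-swap g (x ∷ xs) ys = ≡-trans (cong (∑ ys (g x) +_) (∑-swap g xs ys)) (sym (∑-+ (g x) (λ y → ∑ xs (λ x → g x y)) ys))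

∑-↭ : (g : Elem → ℤ) {xs ys : List Elem} → xs ↭ ys → ∑ xs g ≡ ∑ ys g
∑-↭ g refl          = refl
∑-↭ g (prep x p)    = cong (g x +_) (∑-↭ g p)
∑-↭ g {ys = _ ∷ _ ∷ ys} (swap x y p) = ≡-trans (cong (λ s → g x + (g y + s)) (∑-↭ g p)) (lemma (g x) (g y) (∑ ys g))
  where
  lemma : ∀ a b c → a + (b + c) ≡ b + (a + c)
  lemma = solve-∀
∑-↭ g (trans p q)   = ≡-trans (∑-↭ g p) (∑-↭ g q)

∑≢0 : (g : Elem → ℤ) (xs : List Elem) → ∑ xs g ≢ 0ℤ → ∃[ x ] (x ∈ xs × g x ≢ 0ℤ)
∑≢0 g []       ≢0 = contradiction refl ≢0
∑≢0 g (x ∷ xs) ≢0 with g x ℤₚ.≟ 0ℤ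
... | no  gx≢0 = x , here refl , gx≢0
... | yes gx≡0 = let y , y∈ , gy = ∑≢0 g xs (λ s → ≢0 (≡-trans (cong₂ _+_ gx≡0 s) refl)) in y , there y∈ , gy

-- Permanents

picks : List Elem → List (Elem × List Elem)
picks []       = []
picks (x ∷ xs) = (x , xs) ∷ map (map₂ (x ∷_)) (picks xs)

∑-picks-∷ : (g : Elem × List Elem → ℤ) (x : Elem) (xs : List Elem) →
            ∑ (picks (x ∷ xs)) g ≡ g (x , xs) + ∑ (picks xs) (g ∘ map₂ (x ∷_))
∑-picks-∷ g x xs = cong (g (x , xs) +_) (∑-map (map₂ (x ∷_)) (picks xs))

-- Permuting the list changes the remainders only up to order, so the summand is required not to see
-- that order.
∑-picks-↭ : (g : Elem × List Elem → ℤ) → (∀ {x r r′} → r ↭ r′ → g (x , r) ≡ g (x , r′)) →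
            ∀ {xs ys} → xs ↭ ys → ∑ (picks xs) g ≡ ∑ (picks ys) g
∑-picks-↭ g resp refl = refl
∑-picks-↭ g resp {x ∷ xs} {.x ∷ ys} (prep .x p) =
  ≡-trans (∑-picks-∷ g x xs)
  (≡-trans (cong₂ _+_ (resp p) (∑-picks-↭ (g ∘ map₂ (x ∷_)) (resp ∘ prep x) p))
           (sym (∑-picks-∷ g x ys)))
∑-picks-↭ g resp {x ∷ y ∷ xs} {.y ∷ .x ∷ ys} (swap .x .y p) = begin
  ∑ (picks (x ∷ y ∷ xs)) g
    ≡⟨ two x y xs ⟩
  g (x , y ∷ xs) + (g (y , x ∷ xs) + S x y xs)
    ≡⟨ lemma (g (x , y ∷ xs)) (g (y , x ∷ xs)) (S x y xs) ⟩
  g (y , x ∷ xs) + (g (x , y ∷ xs) + S x y xs)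
    ≡⟨ cong₂ _+_ (resp (prep x p)) (cong₂ _+_ (resp (prep y p))
         (≡-trans (∑-cong (picks xs) (λ _ → resp (swap x y ↭-refl)))
                  (∑-picks-↭ (g ∘ map₂ (y ∷_) ∘ map₂ (x ∷_)) (resp ∘ prep y ∘ prep x) p))) ⟩
  g (y , x ∷ ys) + (g (x , y ∷ ys) + S y x ys)
    ≡⟨ two y x ys ⟨
  ∑ (picks (y ∷ x ∷ ys)) g ∎
  where
  open ≡-Reasoning
  S : ∀ x y xs → ℤ
  S x y xs = ∑ (picks xs) (g ∘ map₂ (x ∷_) ∘ map₂ (y ∷_))
  two : ∀ x y xs → ∑ (picks (x ∷ y ∷ xs)) g ≡ g (x , y ∷ xs) + (g (y , x ∷ xs) + S x y xs)
  two x y xs = ≡-trans (∑-picks-∷ g x (y ∷ xs))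
                       (cong (g (x , y ∷ xs) +_) (∑-picks-∷ (g ∘ map₂ (x ∷_)) y xs))
  lemma : ∀ a b c → a + (b + c) ≡ b + (a + c)
  lemma = solve-∀
∑-picks-↭ g resp (trans p q) = ≡-trans (∑-picks-↭ g resp p) (∑-picks-↭ g resp q)

-- Expansion along the first column. Lists of different lengths give 0, so a nonzero permanent
-- certifies that the matrix is square (`per-length`).
per : (Row → Col → ℤ) → List Row → List Col → ℤ
per M []      []       = 1ℤ
per M (_ ∷ _) []       = 0ℤ
per M fs      (w ∷ ws) = ∑ (picks fs) λ (f , r) → M f w * per M r ws

per-∷ : (M : Row → Col → ℤ) (fs : List Row) (w : Col) (ws : List Col) →
        per M fs (w ∷ ws) ≡ ∑ (picks fs) (λ (f , r) → M f w * per M r ws)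
per-∷ M []      w ws = refl
per-∷ M (_ ∷ _) w ws = refl

per-↭ : (M : Row → Col → ℤ) (ws : List Col) {fs fs′ : List Row} → fs ↭ fs′ → per M fs ws ≡ per M fs′ ws
per-↭ M [] refl          = refl
per-↭ M [] (prep x p)    = refl
per-↭ M [] (swap x y p)  = refl
per-↭ M [] (trans p q)   = ≡-trans (per-↭ M [] p) (per-↭ M [] q)
per-↭ M (w ∷ ws) {fs} {fs′} p =
  ≡-trans (per-∷ M fs w ws)
  (≡-trans (∑-picks-↭ _ (λ {x} q → cong (M x w *_) (per-↭ M ws q)) p) (sym (per-∷ M fs′ w ws)))

∈-picks : (fs : List Elem) {x : Elem} {r : List Elem} → (x , r) ∈ picks fs → (x ∷ r) ↭ fs
∈-picks (y ∷ fs) (here refl) = ↭-refl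
∈-picks (y ∷ fs) (there q) with picks fs | ∈-picks fs
... | ps | ih = go ps ih q
  where
  go : ∀ ps → (∀ {x r} → (x , r) ∈ ps → (x ∷ r) ↭ fs) →
       ∀ {x r} → (x , r) ∈ map (map₂ (y ∷_)) ps → (x ∷ r) ↭ (y ∷ fs)
  go (_ ∷ ps) ih {x} (here refl) = trans (swap x y ↭-refl) (prep y (ih (here refl)))
  go (_ ∷ ps) ih (there q) = go ps (ih ∘ there) q

per-cong : {M M′ : Row → Col → ℤ} (fs : List Row) (ws : List Col) →
           (∀ {f w} → f ∈ fs → w ∈ ws → M f w ≡ M′ f w) → per M fs ws ≡ per M′ fs ws
per-cong []      []       eq = refl
per-cong (_ ∷ _) []       eq = refl
per-cong {M = M} {M′} fs (w ∷ ws) eq =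
  ≡-trans (per-∷ M fs w ws)
  (≡-trans (∑-cong-∈ (picks fs) (λ {(f , r)} q →
      let p = ∈-picks fs q in
      cong₂ _*_ (eq (∈-resp-↭ p (here refl)) (here refl))
                (per-cong r ws (λ f∈ w∈ → eq (∈-resp-↭ p (there f∈)) (there w∈)))))
    (sym (per-∷ M′ fs w ws)))

picks-map : (h : Elem → Elem′) (xs : List Elem) → picks (map h xs) ≡ map (λ (x , r) → h x , map h r) (picks xs)
picks-map h []       = refl
picks-map h (x ∷ xs) = cong₂ _∷_ refl (≡-trans (cong (map (map₂ (h x ∷_))) (picks-map h xs))
  (≡-trans (sym (Listₚ.map-∘ (picks xs))) (Listₚ.map-∘ (picks xs))))

per-mapˡ : (M : Elem′ → Col → ℤ) (h : Elem → Elem′) (fs : List Elem) (ws : List Col) →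
           per M (map h fs) ws ≡ per (M ∘ h) fs ws
per-mapˡ M h []       []       = refl
per-mapˡ M h (f ∷ fs) []       = refl
per-mapˡ M h fs (w ∷ ws) =
  ≡-trans (per-∷ M (map h fs) w ws)
  (≡-trans (cong (λ l → ∑ l _) (picks-map h fs))
  (≡-trans (∑-map _ (picks fs))
  (≡-trans (∑-cong (picks fs) (λ (f , r) → cong (M (h f) w *_) (per-mapˡ M h r ws)))
           (sym (per-∷ (M ∘ h) fs w ws)))))

per-mapʳ : (M : Row → Elem′ → ℤ) (h : Elem → Elem′) (fs : List Row) (ws : List Elem) →
           per M fs (map h ws) ≡ per (λ f → M f ∘ h) fs ws
per-mapʳ M h []       []       = refl
per-mapʳ M h (f ∷ fs) []       = refl
per-mapʳ M h fs (w ∷ ws) =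
  ≡-trans (per-∷ M fs (h w) (map h ws))
  (≡-trans (∑-cong (picks fs) (λ (f , r) → cong (M f (h w) *_) (per-mapʳ M h r ws)))
           (sym (per-∷ _ fs w ws)))

-- Expansion along a row. Expanding the first column separates the term in which f takes w; in the
-- other terms row f is expanded in the smaller matrix by induction, and the two sums are exchanged.
per-expandˡ : (M : Row → Col → ℤ) (f : Row) (fs : List Row) (ws : List Col) →
              per M (f ∷ fs) ws ≡ ∑ (picks ws) (λ (w , r) → M f w * per M fs r)
per-expandˡ M f fs []       = refl
per-expandˡ M f fs (w ∷ ws) = begin
  ∑ (picks (f ∷ fs)) (λ (g , r) → M g w * per M r ws)
    ≡⟨ ∑-picks-∷ (λ (g , r) → M g w * per M r ws) f fs ⟩
  M f w * per M fs ws + ∑ (picks fs) (λ (g , r) → M g w * per M (f ∷ r) ws)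
    ≡⟨ cong (M f w * per M fs ws +_) (∑-cong (picks fs) (λ (g , r) → ≡-trans (cong (M g w *_) (per-expandˡ M f r ws)) (sym (∑-* (M g w) (λ (w′ , r′) → M f w′ * per M r r′) (picks ws))))) ⟩
  M f w * per M fs ws + ∑ (picks fs) (λ (g , r) → ∑ (picks ws) (λ (w′ , r′) → M g w * (M f w′ * per M r r′)))
    ≡⟨ cong (M f w * per M fs ws +_) (∑-swap (λ (g , r) (w′ , r′) → M g w * (M f w′ * per M r r′)) (picks fs) (picks ws)) ⟩
  M f w * per M fs ws + ∑ (picks ws) (λ (w′ , r′) → ∑ (picks fs) (λ (g , r) → M g w * (M f w′ * per M r r′)))
    ≡⟨ cong (M f w * per M fs ws +_) (∑-cong (picks ws) (λ (w′ , r′) →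
         ≡-trans (∑-cong (picks fs) (λ (g , r) → lemma (M g w) (M f w′) (per M r r′)))
         (≡-trans (∑-* (M f w′) (λ (g , r) → M g w * per M r r′) (picks fs)) (cong (M f w′ *_) (sym (per-∷ M fs w r′)))))) ⟩
  M f w * per M fs ws + ∑ (picks ws) (λ (w′ , r′) → M f w′ * per M fs (w ∷ r′))
    ≡⟨ sym (∑-picks-∷ (λ (w′ , r′) → M f w′ * per M fs r′) w ws) ⟩
  ∑ (picks (w ∷ ws)) (λ (w′ , r′) → M f w′ * per M fs r′) ∎
  where
  open ≡-Reasoning
  lemma : ∀ a b c → a * (b * c) ≡ b * (a * c)
  lemma = solve-∀

per-transpose : (M : Row → Col → ℤ) (fs : List Row) (ws : List Col) → per M fs ws ≡ per (flip M) ws fs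
per-transpose M []       []       = refl
per-transpose M []       (w ∷ ws) = refl
per-transpose M (f ∷ fs) ws =
  ≡-trans (per-expandˡ M f fs ws)
  (≡-trans (∑-cong (picks ws) (λ (w , r) → cong (M f w *_) (per-transpose M fs r)))
           (sym (per-∷ (flip M) ws f fs)))

per-↭ʳ : (M : Row → Col → ℤ) (fs : List Row) {ws ws′ : List Col} → ws ↭ ws′ → per M fs ws ≡ per M fs ws′
per-↭ʳ M fs {ws} {ws′} p =
  ≡-trans (per-transpose M fs ws) (≡-trans (per-↭ (flip M) fs p) (sym (per-transpose M fs ws′)))

∑-picks-++ : (g : Elem × List Elem → ℤ) (xs ys : List Elem) → (∀ {y r} → y ∈ ys → g (y , r) ≡ 0ℤ) →
             ∑ (picks (xs ++ ys)) g ≡ ∑ (picks xs) (λ (x , r) → g (x , r ++ ys))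
∑-picks-++ g [] ys z = ∑-zero (picks ys) (λ {(y , r)} q → z (∈-resp-↭ (∈-picks ys q) (here refl)))
∑-picks-++ g (x ∷ xs) ys z =
  ≡-trans (∑-picks-∷ g x (xs ++ ys))
  (≡-trans (cong (g (x , xs ++ ys) +_) (∑-picks-++ (g ∘ map₂ (x ∷_)) xs ys z))
           (sym (∑-picks-∷ (λ (x , r) → g (x , r ++ ys)) x xs)))

-- A column of `ws₁` vanishes on `fs₂`, so it can only be matched with a row of `fs₁`. By the equal
-- lengths this uses up `fs₁` and leaves exactly `fs₂` for `ws₂`.
per-block : (M : Row → Col → ℤ) (fs₁ fs₂ : List Row) (ws₁ ws₂ : List Col) → length fs₁ ≡ length ws₁ →
            (∀ {f w} → f ∈ fs₂ → w ∈ ws₁ → M f w ≡ 0ℤ) →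
            per M (fs₁ ++ fs₂) (ws₁ ++ ws₂) ≡ per M fs₁ ws₁ * per M fs₂ ws₂
per-block M [] fs₂ [] ws₂ len z = sym (ℤₚ.*-identityˡ _)
per-block M fs₁@(_ ∷ _) fs₂ (w ∷ ws₁) ws₂ len z = begin
  per M (fs₁ ++ fs₂) (w ∷ ws₁ ++ ws₂)
    ≡⟨ ∑-picks-++ (λ (f , r) → M f w * per M r (ws₁ ++ ws₂)) fs₁ fs₂ (λ {_} {r} f∈ → cong (_* per M r (ws₁ ++ ws₂)) (z f∈ (here refl))) ⟩
  ∑ (picks fs₁) (λ (f , r) → M f w * per M (r ++ fs₂) (ws₁ ++ ws₂))
    ≡⟨ ∑-cong-∈ (picks fs₁) (λ {(f , r)} q → ≡-trans
         (cong (M f w *_) (per-block M r fs₂ ws₁ ws₂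
           (ℕₚ.suc-injective (≡-trans (↭-length (∈-picks fs₁ q)) len)) (λ f∈ w∈ → z f∈ (there w∈))))
         (sym (ℤₚ.*-assoc (M f w) (per M r ws₁) (per M fs₂ ws₂)))) ⟩
  ∑ (picks fs₁) (λ (f , r) → (M f w * per M r ws₁) * per M fs₂ ws₂)
    ≡⟨ ∑-*ʳ (per M fs₂ ws₂) (λ (f , r) → M f w * per M r ws₁) (picks fs₁) ⟩
  per M fs₁ (w ∷ ws₁) * per M fs₂ ws₂ ∎
  where open ≡-Reasoning

-- Columns that are combinations of basis vectors

spread : (Row → Elem′ → ℤ) → Row → List (ℤ × Elem′) → ℤ
spread M f w = ∑ w λ (s , b) → s * M f b

single : Elem′ → List (ℤ × Elem′)
single b = (1ℤ , b) ∷ []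

spread-single : (M : Row → Elem′ → ℤ) (f : Row) (b : Elem′) → spread M f (single b) ≡ M f b
spread-single M f b = lemma (M f b)
  where
  lemma : ∀ a → 1ℤ * a + 0ℤ ≡ a
  lemma = solve-∀

per-spread : (M : Row → Elem′ → ℤ) (fs : List Row) (w : List (ℤ × Elem′)) (ws : List (List (ℤ × Elem′))) →
             per (spread M) fs (w ∷ ws) ≡ ∑ w (λ (s , b) → s * per (spread M) fs (single b ∷ ws))
per-spread M fs w ws = begin
  per (spread M) fs (w ∷ ws)
    ≡⟨ per-∷ (spread M) fs w ws ⟩
  ∑ (picks fs) (λ (f , r) → ∑ w (λ (s , b) → s * M f b) * per (spread M) r ws)
    ≡⟨ ∑-cong (picks fs) (λ (f , r) → sym (∑-*ʳ (per (spread M) r ws) (λ (s , b) → s * M f b) w)) ⟩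
  ∑ (picks fs) (λ (f , r) → ∑ w (λ (s , b) → (s * M f b) * per (spread M) r ws))
    ≡⟨ ∑-swap (λ (f , r) (s , b) → (s * M f b) * per (spread M) r ws) (picks fs) w ⟩
  ∑ w (λ (s , b) → ∑ (picks fs) (λ (f , r) → (s * M f b) * per (spread M) r ws))
    ≡⟨ ∑-cong w (λ (s , b) → ≡-trans
         (∑-cong (picks fs) (λ (f , r) → ≡-trans (ℤₚ.*-assoc s (M f b) (per (spread M) r ws))
            (cong (λ v → s * (v * per (spread M) r ws)) (sym (spread-single M f b)))))
         (≡-trans (∑-* s (λ (f , r) → spread M f (single b) * per (spread M) r ws) (picks fs)) (cong (s *_) (sym (per-∷ (spread M) fs (single b) ws))))) ⟩
  ∑ w (λ (s , b) → s * per (spread M) fs (single b ∷ ws)) ∎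
  where open ≡-Reasoning

tot : (Elem → ℕ) → List Elem → ℕ
tot φ xs = sum (map φ xs)

tot-++ : (φ : Elem → ℕ) (xs ys : List Elem) → tot φ (xs ++ ys) ≡ tot φ xs ℕ.+ tot φ ys
tot-++ φ xs ys = ≡-trans (cong sum (Listₚ.map-++ φ xs ys)) (sum-++ (map φ xs) (map φ ys))

support : List (List (ℤ × Elem′)) → List Elem′
support = concatMap (map proj₂)

∈⇒≤tot : (φ : Elem → ℕ) {x : Elem} {xs : List Elem} → x ∈ xs → φ x ℕ.≤ tot φ xs
∈⇒≤tot φ (here refl) = ℕₚ.m≤m+n _ _
∈⇒≤tot φ (there x∈)  = ℕₚ.≤-trans (∈⇒≤tot φ x∈) (ℕₚ.m≤n+m _ _)

-- By multilinearity, a nonzero permanent in directions that are combinations of basis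
-- vectors yields a nonzero permanent in basis vectors chosen from their supports.
select : (M : Row → Elem′ → ℤ) (fs : List Row) (ws : List (List (ℤ × Elem′))) (bs : List Elem′) →
         per (spread M) fs (ws ++ map single bs) ≢ 0ℤ →
         ∃[ cs ] (per M fs cs ≢ 0ℤ × ((φ : Elem′ → ℕ) → tot φ cs ℕ.≤ tot φ (support ws) ℕ.+ tot φ bs))
select M fs [] bs ≢0 =
  bs , (λ z → ≢0 (≡-trans (per-mapʳ (spread M) single fs bs)
                  (≡-trans (per-cong fs bs (λ _ _ → spread-single M _ _)) z))) , λ φ → ℕₚ.≤-refl
select M fs (w ∷ ws) bs ≢0
  with ∑≢0 (λ (s , b) → s * per (spread M) fs (single b ∷ ws ++ map single bs)) w (λ z → ≢0 (≡-trans (per-spread M fs w (ws ++ map single bs)) z))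
... | (s , b) , sb∈w , ≢0′
  -- The chosen basis vector joins `bs`, and its weight is at most that of the support it was taken
  -- from. The bound is kept for every weight φ because one selection has to respect the limits of
  -- all edges at once.
  with select M fs ws (b ∷ bs) (λ z → ≢0′ (≡-trans (cong (s *_)
         (≡-trans (per-↭ʳ (spread M) fs (↭-sym (shift (single b) ws (map single bs)))) z)) (ℤₚ.*-zeroʳ s)))
... | cs , nz , bd = cs , nz , λ φ → ℕₚ.≤-trans (bd φ) (begin
    tot φ (support ws) ℕ.+ (φ b ℕ.+ tot φ bs)
      ≤⟨ ℕₚ.+-monoʳ-≤ (tot φ (support ws)) (ℕₚ.+-monoˡ-≤ (tot φ bs) (∈⇒≤tot φ (∈-map⁺ proj₂ sb∈w))) ⟩
    tot φ (support ws) ℕ.+ (tot φ (map proj₂ w) ℕ.+ tot φ bs)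
      ≡⟨ lemma (tot φ (support ws)) (tot φ (map proj₂ w)) (tot φ bs) ⟩
    (tot φ (map proj₂ w) ℕ.+ tot φ (support ws)) ℕ.+ tot φ bs
      ≡⟨ cong (ℕ._+ tot φ bs) (sym (tot-++ φ (map proj₂ w) (support ws))) ⟩
    tot φ (support (w ∷ ws)) ℕ.+ tot φ bs ∎)
  where
  open ℕₚ.≤-Reasoning
  lemma : ∀ a b c → a ℕ.+ (b ℕ.+ c) ≡ (b ℕ.+ a) ℕ.+ c
  lemma a b c = ≡-trans (sym (ℕₚ.+-assoc a b c)) (cong (ℕ._+ c) (ℕₚ.+-comm a b))

-- Coefficients of products of linear forms

χ : {P : Set} → Dec P → ℤ
χ (yes _) = 1ℤ
χ (no _)  = 0ℤ

χ-yes : {P : Set} (d : Dec P) → P → χ d ≡ 1ℤ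
χ-yes (yes _) p = refl
χ-yes (no ¬p) p = contradiction p ¬p

χ-no : {P : Set} (d : Dec P) → ¬ P → χ d ≡ 0ℤ
χ-no (yes p) ¬p = contradiction p ¬p
χ-no (no _)  ¬p = refl

χ-⇔ : {P Q : Set} (d : Dec P) (e : Dec Q) → (P → Q) → (Q → P) → χ d ≡ χ e
χ-⇔ (yes p) e to from = sym (χ-yes e (to p))
χ-⇔ (no ¬p) e to from = sym (χ-no e (¬p ∘ from))

infix 4 _≟ᵐ_
_≟ᵐ_ : (M N : Monomial m) → Dec (M ≡ N)
_≟ᵐ_ = Vecₚ.≡-dec ℕₚ._≟_

coeff-∑ : (p : Poly m) (M : Monomial m) → coeff p M ≡ ∑ p (λ (c , N) → c * χ (N ≟ᵐ M))
coeff-∑ []            M = refl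
coeff-∑ ((c , N) ∷ p) M with N ≟ᵐ M
... | yes _ = cong₂ _+_ (sym (ℤₚ.*-identityʳ c)) (coeff-∑ p M)
... | no  _ = ≡-trans (coeff-∑ p M) (≡-trans (sym (ℤₚ.+-identityˡ _)) (cong (_+ _) (sym (ℤₚ.*-zeroʳ c))))

inc : Fin m → Monomial m → Monomial m
inc g N = N [ g ]%= suc

unit-⊕ : (g : Fin m) (N : Monomial m) → zipWith ℕ._+_ (replicate m 0 [ g ]≔ 1) N ≡ inc g N
unit-⊕ {suc m} zero    (x ∷ N) = cong (suc x ∷_) (zeros N)
  where
  zeros : ∀ {m} (N : Monomial m) → zipWith ℕ._+_ (replicate m 0) N ≡ N
  zeros []      = refl
  zeros (x ∷ N) = cong (x ∷_) (zeros N)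
unit-⊕ {suc m} (suc g) (x ∷ N) = cong (x ∷_) (unit-⊕ g N)

lookup-inc : (g : Fin m) (N : Monomial m) → vlookup (inc g N) g ≡ suc (vlookup N g)
lookup-inc zero    (x ∷ N) = refl
lookup-inc (suc g) (x ∷ N) = lookup-inc g N

lookup-inc-≢ : (f g : Fin m) (N : Monomial m) → f ≢ g → vlookup (inc f N) g ≡ vlookup N g
lookup-inc-≢ zero    zero    N       f≢g = contradiction refl f≢g
lookup-inc-≢ zero    (suc g) (x ∷ N) f≢g = refl
lookup-inc-≢ (suc f) zero    (x ∷ N) f≢g = refl
lookup-inc-≢ (suc f) (suc g) (x ∷ N) f≢g = lookup-inc-≢ f g N (f≢g ∘ cong suc)

inc-set : (g : Fin m) (M : Monomial m) {k : ℕ} → vlookup M g ≡ suc k → inc g (M [ g ]≔ k) ≡ M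
inc-set zero    (x ∷ M) refl = refl
inc-set (suc g) (x ∷ M) eq   = cong (x ∷_) (inc-set g M eq)

set-inc : (g : Fin m) (M : Monomial m) {k : ℕ} → vlookup (inc g M) g ≡ suc k → inc g M [ g ]≔ k ≡ M
set-inc zero    (x ∷ M) refl = refl
set-inc (suc g) (x ∷ M) eq   = cong (x ∷_) (set-inc g M eq)

inc-injective : (g : Fin m) {M N : Monomial m} → inc g M ≡ inc g N → M ≡ N
inc-injective g {M} {N} eq = ≡-trans (sym (set-inc g M (lookup-inc g M)))
  (≡-trans (cong₂ (λ L k → L [ g ]≔ k) eq (ℕₚ.suc-injective (≡-trans (sym (lookup-inc g M)) (≡-trans (cong (λ L → vlookup L g) eq) (lookup-inc g N)))))
           (set-inc g N (lookup-inc g N)))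

inc-comm : (f g : Fin m) (N : Monomial m) → inc f (inc g N) ≡ inc g (inc f N)
inc-comm zero    zero    (x ∷ N) = refl
inc-comm zero    (suc g) (x ∷ N) = refl
inc-comm (suc f) zero    (x ∷ N) = refl
inc-comm (suc f) (suc g) (x ∷ N) = cong (x ∷_) (inc-comm f g N)

-- Coefficient function of x_g · φ.
shf : Fin m → (Monomial m → ℤ) → Monomial m → ℤ
shf g φ M with vlookup M g
... | zero  = 0ℤ
... | suc k = φ (M [ g ]≔ k)

shf-zero : (g : Fin m) (φ : Monomial m → ℤ) (M : Monomial m) → vlookup M g ≡ 0 → shf g φ M ≡ 0ℤ
shf-zero g φ M eq with vlookup M g
... | zero = refl

shf-suc : (g : Fin m) (φ : Monomial m → ℤ) (M : Monomial m) {k : ℕ} → vlookup M g ≡ suc k → shf g φ M ≡ φ (M [ g ]≔ k)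
shf-suc g φ M eq with vlookup M g
shf-suc g φ M refl | suc k = refl

shf-inc : (g : Fin m) (φ : Monomial m → ℤ) (M : Monomial m) → shf g φ (inc g M) ≡ φ M
shf-inc g φ M = ≡-trans (shf-suc g φ (inc g M) (lookup-inc g M)) (cong φ (set-inc g M (lookup-inc g M)))

-- Case distinction on whether x_g divides the monomial, in the shape in which `shf-zero` and
-- `shf-inc` apply.
data View (g : Fin m) : Monomial m → Set where
  absent  : ∀ {M} → vlookup M g ≡ 0 → View g M
  present : ∀ N → View g (inc g N)

view : (g : Fin m) (M : Monomial m) → View g M
view g M with vlookup M g in eq
... | zero  = absent eq
... | suc k = subst (View g) (inc-set g M eq) (present (M [ g ]≔ k))

shf-cong : (g : Fin m) {φ ψ : Monomial m → ℤ} → (∀ N → φ N ≡ ψ N) → ∀ M → shf g φ M ≡ shf g ψ M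
shf-cong g eq M with vlookup M g
... | zero  = refl
... | suc k = eq (M [ g ]≔ k)

shf-∑ : (g : Fin m) (xs : List Elem) (a : Elem → ℤ) (φ : Elem → Monomial m → ℤ) (M : Monomial m) →
        shf g (λ N → ∑ xs (λ x → a x * φ x N)) M ≡ ∑ xs (λ x → a x * shf g (φ x) M)
shf-∑ g xs a φ M with vlookup M g
... | zero  = sym (∑-zero xs (λ {x} _ → ℤₚ.*-zeroʳ (a x)))
... | suc k = refl

-- Since `pos (suc (vlookup L f)) * φ (inc f L)` is the coefficient of L in the derivative of φ by
-- x_f, this is the Leibniz rule ∂_f (x_g φ) = [g = f] φ + x_g ∂_f φ.
deriv-shf : (f g : Fin m) (φ : Monomial m → ℤ) (L : Monomial m) →
            pos (suc (vlookup L f)) * shf g φ (inc f L) ≡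
            χ (g Finₚ.≟ f) * φ L + shf g (λ N → pos (suc (vlookup N f)) * φ (inc f N)) L
deriv-shf f g φ L with g Finₚ.≟ f
deriv-shf f .f φ L | yes refl with view f L
... | absent eq  = begin
  pos (suc (vlookup L f)) * shf f φ (inc f L)   ≡⟨ cong₂ (λ k v → pos (suc k) * v) eq (shf-inc f φ L) ⟩
  1ℤ * φ L                                 ≡⟨ ℤₚ.+-identityʳ (1ℤ * φ L) ⟨
  1ℤ * φ L + 0ℤ                            ≡⟨ cong (1ℤ * φ L +_) (shf-zero f _ L eq) ⟨
  1ℤ * φ L + shf f (λ N → pos (suc (vlookup N f)) * φ (inc f N)) L ∎
  where open ≡-Reasoning
... | present N = begin
  pos (suc (vlookup (inc f N) f)) * shf f φ (inc f (inc f N))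
    ≡⟨ cong₂ (λ k v → pos (suc k) * v) (lookup-inc f N) (shf-inc f φ (inc f N)) ⟩
  pos (suc (suc (vlookup N f))) * φ (inc f N)
    ≡⟨ lemma (pos (suc (vlookup N f))) (φ (inc f N)) ⟩
  1ℤ * φ (inc f N) + pos (suc (vlookup N f)) * φ (inc f N)
    ≡⟨ cong (1ℤ * φ (inc f N) +_) (shf-inc f (λ N → pos (suc (vlookup N f)) * φ (inc f N)) N) ⟨
  1ℤ * φ (inc f N) + shf f (λ N → pos (suc (vlookup N f)) * φ (inc f N)) (inc f N) ∎
  where
  open ≡-Reasoning
  lemma : ∀ a b → (1ℤ + a) * b ≡ 1ℤ * b + a * b
  lemma = solve-∀
deriv-shf f g φ L | no g≢f with view g L
... | absent eq = begin
  pos (suc (vlookup L f)) * shf g φ (inc f L)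
    ≡⟨ cong (pos (suc (vlookup L f)) *_) (shf-zero g φ (inc f L) (≡-trans (lookup-inc-≢ f g L (g≢f ∘ sym)) eq)) ⟩
  pos (suc (vlookup L f)) * 0ℤ    ≡⟨ ℤₚ.*-zeroʳ (pos (suc (vlookup L f))) ⟩
  0ℤ                         ≡⟨ cong (λ v → 0ℤ * φ L + v) (shf-zero g _ L eq) ⟨
  0ℤ * φ L + shf g (λ N → pos (suc (vlookup N f)) * φ (inc f N)) L ∎
  where open ≡-Reasoning
... | present N = begin
  pos (suc (vlookup (inc g N) f)) * shf g φ (inc f (inc g N))
    ≡⟨ cong₂ (λ k M → pos (suc k) * shf g φ M) (lookup-inc-≢ g f N g≢f) (inc-comm f g N) ⟩
  pos (suc (vlookup N f)) * shf g φ (inc g (inc f N))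
    ≡⟨ cong (pos (suc (vlookup N f)) *_) (shf-inc g φ (inc f N)) ⟩
  pos (suc (vlookup N f)) * φ (inc f N)
    ≡⟨ shf-inc g (λ N → pos (suc (vlookup N f)) * φ (inc f N)) N ⟨
  shf g (λ N → pos (suc (vlookup N f)) * φ (inc f N)) (inc g N)
    ≡⟨ ℤₚ.+-identityˡ (shf g (λ N → pos (suc (vlookup N f)) * φ (inc f N)) (inc g N)) ⟨
  0ℤ * φ (inc g N) + shf g (λ N → pos (suc (vlookup N f)) * φ (inc f N)) (inc g N) ∎
  where open ≡-Reasoning

Linear : ℕ → Set
Linear m = List (ℤ × Fin m)

lin : Linear m → Poly m
lin = map λ (c , g) → c , replicate _ 0 [ g ]≔ 1

value : Linear m → Fin m → ℤ
value ts f = ∑ ts λ (c , g) → c * χ (g Finₚ.≟ f)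

coeff-lin-* : (ts : Linear m) (q : Poly m) (M : Monomial m) →
              coeff (lin ts *ₚ q) M ≡ ∑ ts (λ (c , g) → c * shf g (coeff q) M)
coeff-lin-* ts q M = ≡-trans (coeff-∑ (lin ts *ₚ q) M) (go ts)
  where
  term : ∀ g → ∑ q (λ (d , N) → d * χ (inc g N ≟ᵐ M)) ≡ shf g (coeff q) M
  term g with view g M
  ... | absent eq = ≡-trans (∑-zero q (λ {(d , N)} _ → ≡-trans (cong (d *_) (χ-no (inc g N ≟ᵐ M)
          (λ e → case ≡-trans (sym (lookup-inc g N)) (≡-trans (cong (λ L → vlookup L g) e) eq) of λ ())))
          (ℤₚ.*-zeroʳ d))) (sym (shf-zero g (coeff q) M eq))
  ... | present L = ≡-trans (∑-cong q (λ (d , N) → cong (d *_)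
          (χ-⇔ (inc g N ≟ᵐ inc g L) (N ≟ᵐ L) (inc-injective g) (cong (inc g)))))
          (≡-trans (sym (coeff-∑ q L)) (sym (shf-inc g (coeff q) L)))
  go : ∀ ts → ∑ (lin ts *ₚ q) (λ (c , N) → c * χ (N ≟ᵐ M)) ≡ ∑ ts (λ (c , g) → c * shf g (coeff q) M)
  go [] = refl
  go ((c , g) ∷ ts) = ≡-trans (∑-++ (map (λ (d , N) → c * d , zipWith ℕ._+_ (replicate _ 0 [ g ]≔ 1) N) q) (lin ts *ₚ q))
    (cong₂ _+_ (≡-trans (∑-map (λ (d , N) → c * d , zipWith ℕ._+_ (replicate _ 0 [ g ]≔ 1) N) q)
      (≡-trans (∑-cong q (λ (d , N) → ≡-trans (cong (λ L → c * d * χ (L ≟ᵐ M)) (unit-⊕ g N)) (ℤₚ.*-assoc c d (χ (inc g N ≟ᵐ M)))))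
      (≡-trans (∑-* c (λ (d , N) → d * χ (inc g N ≟ᵐ M)) q) (cong (c *_) (term g))))) (go ts))

Φ : List (Linear m) → Monomial m → ℤ
Φ es = coeff (∏ₚ es lin)

-- The product rule for the derivative by x_f of a product of linear forms, read off at the monomial
-- L. It has the shape of the expansion of a permanent along column f.
Φ-deriv : (es : List (Linear m)) (f : Fin m) (L : Monomial m) →
          pos (suc (vlookup L f)) * Φ es (inc f L) ≡ ∑ (picks es) (λ (e , r) → value e f * Φ r L)
Φ-deriv {m} [] f L = ≡-trans (cong (pos (suc (vlookup L f)) *_) (≡-trans (coeff-∑ 1ₚ (inc f L))
  (cong (λ v → 1ℤ * v + 0ℤ) (χ-no (replicate m 0 ≟ᵐ inc f L)
    (λ e → case ≡-trans (sym (Vecₚ.lookup-replicate f 0)) (≡-trans (cong (λ N → vlookup N f) e) (lookup-inc f L)) of λ ())))))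
  (ℤₚ.*-zeroʳ (pos (suc (vlookup L f))))
Φ-deriv (e ∷ es) f L = begin
  a * Φ (e ∷ es) (inc f L)
    ≡⟨ cong (a *_) (coeff-lin-* e (∏ₚ es lin) (inc f L)) ⟩
  a * ∑ e (λ (c , g) → c * shf g (Φ es) (inc f L))
    ≡⟨ ∑-* a (λ (c , g) → c * shf g (Φ es) (inc f L)) e ⟨
  ∑ e (λ (c , g) → a * (c * shf g (Φ es) (inc f L)))
    ≡⟨ ∑-cong e (λ (c , g) → ≡-trans (lemma a c (shf g (Φ es) (inc f L))) (≡-trans (cong (c *_) (deriv-shf f g (Φ es) L))
         (lemma₂ c (χ (g Finₚ.≟ f)) (Φ es L) (shf g D L)))) ⟩
  ∑ e (λ (c , g) → c * χ (g Finₚ.≟ f) * Φ es L + c * shf g D L)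
    ≡⟨ ∑-+ (λ (c , g) → c * χ (g Finₚ.≟ f) * Φ es L) (λ (c , g) → c * shf g D L) e ⟩
  ∑ e (λ (c , g) → c * χ (g Finₚ.≟ f) * Φ es L) + ∑ e (λ (c , g) → c * shf g D L)
    ≡⟨ cong₂ _+_ (∑-*ʳ (Φ es L) (λ (c , g) → c * χ (g Finₚ.≟ f)) e) rest ⟩
  value e f * Φ es L + ∑ (picks es) (λ (h , r) → value h f * Φ (e ∷ r) L)
    ≡⟨ ∑-picks-∷ (λ (h , r) → value h f * Φ r L) e es ⟨
  ∑ (picks (e ∷ es)) (λ (h , r) → value h f * Φ r L) ∎
  where
  open ≡-Reasoning
  a = pos (suc (vlookup L f))
  D = λ N → pos (suc (vlookup N f)) * Φ es (inc f N)
  lemma : ∀ a b c → a * (b * c) ≡ b * (a * c)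
  lemma = solve-∀
  lemma₂ : ∀ a b c d → a * (b * c + d) ≡ a * b * c + a * d
  lemma₂ = solve-∀
  rest : ∑ e (λ (c , g) → c * shf g D L) ≡ ∑ (picks es) (λ (h , r) → value h f * Φ (e ∷ r) L)
  rest = begin
    ∑ e (λ (c , g) → c * shf g D L)
      ≡⟨ ∑-cong e (λ (c , g) → ≡-trans (cong (c *_) (≡-trans (shf-cong g (Φ-deriv es f) L)
           (shf-∑ g (picks es) (λ (h , r) → value h f) (λ (h , r) → Φ r) L)))
           (sym (∑-* c (λ (h , r) → value h f * shf g (Φ r) L) (picks es)))) ⟩
    ∑ e (λ (c , g) → ∑ (picks es) (λ (h , r) → c * (value h f * shf g (Φ r) L)))
      ≡⟨ ∑-swap (λ (c , g) (h , r) → c * (value h f * shf g (Φ r) L)) e (picks es) ⟩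
    ∑ (picks es) (λ (h , r) → ∑ e (λ (c , g) → c * (value h f * shf g (Φ r) L)))
      ≡⟨ ∑-cong (picks es) (λ (h , r) → ≡-trans (∑-cong e (λ (c , g) → lemma c (value h f) (shf g (Φ r) L)))
           (≡-trans (∑-* (value h f) (λ (c , g) → c * shf g (Φ r) L) e)
                    (cong (value h f *_) (sym (coeff-lin-* e (∏ₚ r lin) L))))) ⟩
    ∑ (picks es) (λ (h , r) → value h f * Φ (e ∷ r) L) ∎

cnt : List (Fin m) → Monomial m
cnt = foldr inc (replicate _ 0)

-- suc c is the product of the factorials of the multiplicities in fs.
per-Φ : (fs : List (Fin m)) → ∃[ c ] (∀ es → per value es fs ≡ pos (suc c) * Φ es (cnt fs))
per-Φ {m} [] = 0 , λ
  { []       → sym (≡-trans (cong (1ℤ *_) (≡-trans (coeff-∑ 1ₚ (replicate m 0))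
                 (cong (λ v → 1ℤ * v + 0ℤ) (χ-yes (replicate m 0 ≟ᵐ replicate m 0) refl)))) refl)
  ; (e ∷ es) → sym (≡-trans (cong (1ℤ *_) (≡-trans (coeff-lin-* e (∏ₚ es lin) (replicate m 0))
                 (∑-zero e (λ {(c , g)} _ → ≡-trans (cong (c *_) (shf-zero g (Φ es) (replicate m 0) (Vecₚ.lookup-replicate g 0)))
                   (ℤₚ.*-zeroʳ c))))) refl) }
per-Φ (f ∷ fs) with per-Φ fs
... | c , eq = vlookup N f ℕ.+ c ℕ.* suc (vlookup N f) , λ es → begin
  per value es (f ∷ fs)
    ≡⟨ per-∷ value es f fs ⟩
  ∑ (picks es) (λ (e , r) → value e f * per value r fs)
    ≡⟨ ∑-cong (picks es) (λ (e , r) → ≡-trans (cong (value e f *_) (eq r)) (lemma (value e f) (pos (suc c)) (Φ r N))) ⟩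
  ∑ (picks es) (λ (e , r) → pos (suc c) * (value e f * Φ r N))
    ≡⟨ ∑-* (pos (suc c)) (λ (e , r) → value e f * Φ r N) (picks es) ⟩
  pos (suc c) * ∑ (picks es) (λ (e , r) → value e f * Φ r N)
    ≡⟨ cong (pos (suc c) *_) (Φ-deriv es f N) ⟨
  pos (suc c) * (pos (suc (vlookup N f)) * Φ es (inc f N))
    ≡⟨ ℤₚ.*-assoc (pos (suc c)) (pos (suc (vlookup N f))) (Φ es (inc f N)) ⟨
  pos (suc c) * pos (suc (vlookup N f)) * Φ es (inc f N)
    ≡⟨ cong (_* Φ es (inc f N)) (sym (ℤₚ.pos-* (suc c) (suc (vlookup N f)))) ⟩
  pos (suc (vlookup N f ℕ.+ c ℕ.* suc (vlookup N f))) * Φ es (inc f N) ∎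
  where
  open ≡-Reasoning
  N = cnt fs
  lemma : ∀ a b c → a * (b * c) ≡ b * (a * c)
  lemma = solve-∀

infixl 6 _⊕_
_⊕_ : Monomial n → Monomial n → Monomial n
_⊕_ = zipWith ℕ._+_

⊕-comm : (M N : Monomial n) → M ⊕ N ≡ N ⊕ M
⊕-comm = Vecₚ.zipWith-comm ℕₚ.+-comm

⊕-cancelʳ : (K : Monomial n) {M N : Monomial n} → M ⊕ K ≡ N ⊕ K → M ≡ N
⊕-cancelʳ []      {[]}    {[]}    eq = refl
⊕-cancelʳ (k ∷ K) {x ∷ M} {y ∷ N} eq =
  cong₂ _∷_ (ℕₚ.+-cancelʳ-≡ k x y (cong Vec.head eq)) (⊕-cancelʳ K (cong Vec.tail eq))

inc-⊕ : (g : Fin n) (M N : Monomial n) → inc g M ⊕ N ≡ inc g (M ⊕ N)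
inc-⊕ zero    (x ∷ M) (y ∷ N) = refl
inc-⊕ (suc g) (x ∷ M) (y ∷ N) = cong (x ℕ.+ y ∷_) (inc-⊕ g M N)

⊕-inc : (g : Fin n) (M N : Monomial n) → M ⊕ inc g N ≡ inc g (M ⊕ N)
⊕-inc g M N = ≡-trans (⊕-comm M (inc g N)) (≡-trans (inc-⊕ g N M) (cong (inc g) (⊕-comm N M)))

⊕-identityʳ : (M : Monomial n) → M ⊕ replicate n 0 ≡ M
⊕-identityʳ = Vecₚ.zipWith-identityʳ ℕₚ.+-identityʳ

-- Coefficients as sums of squares

-- Gathers the terms with monomial M into one coefficient. The sum over the other terms is shorter,
-- which drives the induction in `norm²-definite`.
split : (p : Poly n) (M : Monomial n) (θ : Monomial n → ℤ) →
        ∑ p (λ (c , N) → c * θ N) ≡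
        ∑ p (λ (c , N) → c * χ (N ≟ᵐ M)) * θ M + ∑ (filter (λ (c , N) → ¬? (N ≟ᵐ M)) p) (λ (c , N) → c * θ N)
split []            M θ = refl
split ((c , N) ∷ p) M θ with N ≟ᵐ M
... | yes refl = ≡-trans (cong (c * θ N +_) (split p N θ)) (lemma c (θ N) (∑ p (λ (c , L) → c * χ (L ≟ᵐ N))) _)
  where
  lemma : ∀ a b c d → a * b + (c * b + d) ≡ (a * 1ℤ + c) * b + d
  lemma = solve-∀
... | no _ = ≡-trans (cong (c * θ N +_) (split p M θ)) (lemma c (θ N) (∑ p (λ (c , L) → c * χ (L ≟ᵐ M)) * θ M) (∑ p (λ (c , L) → c * χ (L ≟ᵐ M))) (θ M) _ refl)
  where
  lemma : ∀ a b c e f d → c ≡ e * f → a * b + (c + d) ≡ (a * 0ℤ + e) * f + (a * b + d)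
  lemma a b .(e * f) e f d refl = lemma′ a b e f d
    where
    lemma′ : ∀ a b e f d → a * b + (e * f + d) ≡ (a * 0ℤ + e) * f + (a * b + d)
    lemma′ = solve-∀

-- The sum of the squares of the collected coefficients: the inner sum is the coefficient of M, and
-- adding up c over the terms with monomial M produces it a second time.
norm² : Poly n → ℤ
norm² p = ∑ p λ (c , M) → c * ∑ p λ (d , N) → d * χ (N ≟ᵐ M)

square≥0 : ∀ a → 0ℤ ℤ.≤ a * a
square≥0 (pos k)      = subst (0ℤ ℤ.≤_) (ℤₚ.pos-* k k) (ℤ.+≤+ ℕ.z≤n)
square≥0 (ℤ.-[1+ k ]) = ℤ.+≤+ ℕ.z≤n

sum≡0 : ∀ a b → 0ℤ ℤ.≤ a → 0ℤ ℤ.≤ b → a + b ≡ 0ℤ → a ≡ 0ℤ × b ≡ 0ℤ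
sum≡0 (pos zero) (pos zero) _ _ _ = refl , refl

square≡0 : ∀ a → a * a ≡ 0ℤ → a ≡ 0ℤ
square≡0 a eq = [ (λ z → z) , (λ z → z) ]′ (ℤₚ.i*j≡0⇒i≡0∨j≡0 a eq)

-- Splitting off one monomial contributes the square C * C and leaves all other coefficients as they
-- were. Definiteness is phrased by pairing with an arbitrary θ, so that it applies directly to
-- evaluation at a point. `k` bounds the length because the filtered list is not structurally
-- smaller.
norm²-definite : (p : Poly n) (k : ℕ) → length p ℕ.≤ k →
                 0ℤ ℤ.≤ norm² p × (norm² p ≡ 0ℤ → (θ : Monomial n → ℤ) → ∑ p (λ (c , N) → c * θ N) ≡ 0ℤ)
norm²-definite []               k       _        = ℤ.+≤+ ℕ.z≤n , λ _ _ → refl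
norm²-definite p@((c , M) ∷ p′) (suc k) (s≤s len) with norm²-definite (filter (λ (c , N) → ¬? (N ≟ᵐ M)) p′) k (ℕₚ.≤-trans (Listₚ.length-filter (λ (c , N) → ¬? (N ≟ᵐ M)) p′) len)
... | pos′ , definite = subst (0ℤ ℤ.≤_) (sym decomposition) (ℤₚ.+-mono-≤ (square≥0 C) pos′)
                      , λ q≡0 θ → let (C²≡0 , rest≡0) = sum≡0 (C * C) (norm² r) (square≥0 C) pos′ (≡-trans (sym decomposition) q≡0) in
                        ≡-trans (split p M θ) (≡-trans (cong₂ _+_ (cong (_* θ M) (square≡0 C C²≡0)) (≡-trans (drop-head θ) (definite rest≡0 θ))) refl)
  where
  C = ∑ p (λ (d , N) → d * χ (N ≟ᵐ M))
  r = filter (λ (c , N) → ¬? (N ≟ᵐ M)) p′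
  head : filter (λ (c , N) → ¬? (N ≟ᵐ M)) p ≡ r
  head = Listₚ.filter-reject (λ (c , N) → ¬? (N ≟ᵐ M)) {x = c , M} (λ M≢M → M≢M refl)
  drop-head : ∀ θ → ∑ (filter (λ (c , N) → ¬? (N ≟ᵐ M)) p) (λ (c , N) → c * θ N) ≡ ∑ r (λ (c , N) → c * θ N)
  drop-head θ = cong (λ l → ∑ l (λ (c , N) → c * θ N)) head
  coefficient : ∀ N → N ≢ M → ∑ p (λ (d , L) → d * χ (L ≟ᵐ N)) ≡ ∑ r (λ (d , L) → d * χ (L ≟ᵐ N))
  coefficient N N≢M = ≡-trans (split p M (λ L → χ (L ≟ᵐ N)))
    (≡-trans (cong₂ _+_ (≡-trans (cong (C *_) (χ-no (M ≟ᵐ N) (N≢M ∘ sym))) (ℤₚ.*-zeroʳ C)) (drop-head (λ L → χ (L ≟ᵐ N))))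
             (ℤₚ.+-identityˡ (∑ r (λ (d , L) → d * χ (L ≟ᵐ N)))))
  decomposition : norm² p ≡ C * C + norm² r
  decomposition = ≡-trans (split p M (λ N → ∑ p (λ (d , L) → d * χ (L ≟ᵐ N))))
    (cong (C * C +_) (≡-trans (drop-head (λ N → ∑ p (λ (d , L) → d * χ (L ≟ᵐ N))))
      (∑-cong-∈ r (λ {(c , N)} q → cong (c *_) (coefficient N
        (All.lookup (Allₚ.all-filter (λ (c , N) → ¬? (N ≟ᵐ M)) p′) q))))))

eval : (Fin n → ℤ) → Monomial n → ℤ
eval v []      = 1ℤ
eval v (k ∷ M) = v zero ℤ.^ k * eval (v ∘ suc) M

eval-inc : (v : Fin n → ℤ) (g : Fin n) (M : Monomial n) → eval v (inc g M) ≡ v g * eval v M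
eval-inc v zero    (k ∷ M) = ℤₚ.*-assoc (v zero) (v zero ℤ.^ k) (eval (v ∘ suc) M)
eval-inc v (suc g) (k ∷ M) = ≡-trans (cong (v zero ℤ.^ k *_) (eval-inc (v ∘ suc) g M)) (lemma (v zero ℤ.^ k) (v (suc g)) (eval (v ∘ suc) M))
  where
  lemma : ∀ a b c → a * (b * c) ≡ b * (a * c)
  lemma = solve-∀

-- Distinct positive coordinates: y_o + y_o′ is never zero here, and y_o - y_o′ is nonzero for o ≠
-- o′.
point : Fin n → ℤ
point i = pos (suc (toℕ i))

-- A form ± y_a ± y_b certified to be nonzero. The case a = b is allowed when the two signs agree.
record Binomial (n : ℕ) : Set where
  constructor binomial
  field
    {α β} : ℤ
    a b   : Fin n
    α²    : α * α ≡ 1ℤ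
    β²    : β * β ≡ 1ℤ
    ≢0    : α * point a + β * point b ≢ 0ℤ

  linear : Linear n
  linear = (α , a) ∷ (β , b) ∷ []

module Squares where
  open Binomial

  -- The terms of ∏ (α y_a + β y_b); the second monomial collects the complementary choices.
  terms : List (Binomial n) → List (ℤ × Monomial n × Monomial n)
  terms []       = (1ℤ , replicate _ 0 , replicate _ 0) ∷ []
  terms (z ∷ zs) = map (λ (c , M , N) → α z * c , inc (a z) M , inc (b z) N) (terms zs)
                ++ map (λ (c , M , N) → β z * c , inc (b z) M , inc (a z) N) (terms zs)

  ends : List (Binomial n) → List (Fin n)
  ends = concatMap λ z → a z ∷ b z ∷ []

  sign : List (Binomial n) → ℤ
  sign []       = 1ℤ
  sign (z ∷ zs) = (α z * β z) * sign zs

  ∑-terms : (z : Binomial n) (zs : List (Binomial n)) (θ : ℤ × Monomial n × Monomial n → ℤ) →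
            ∑ (terms (z ∷ zs)) θ ≡ ∑ (terms zs) (λ (c , M , N) → θ (α z * c , inc (a z) M , inc (b z) N))
                                 + ∑ (terms zs) (λ (c , M , N) → θ (β z * c , inc (b z) M , inc (a z) N))
  ∑-terms z zs θ = ≡-trans (∑-++ (map _ (terms zs)) (map _ (terms zs)))
    (cong₂ _+_ (∑-map _ (terms zs)) (∑-map _ (terms zs)))

  terms-complement : (zs : List (Binomial n)) → All (λ (c , M , N) → M ⊕ N ≡ cnt (ends zs)) (terms zs)
  terms-complement []       = ⊕-identityʳ _ ∷ []
  terms-complement (z ∷ zs) = Allₚ.++⁺
    (Allₚ.map⁺ (All.map (λ {(c , M , N)} eq → ≡-trans (inc-⊕ (a z) M _) (cong (inc (a z)) (≡-trans (⊕-inc (b z) M N) (cong (inc (b z)) eq)))) ih))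
    (Allₚ.map⁺ (All.map (λ {(c , M , N)} eq → ≡-trans (inc-⊕ (b z) M _) (≡-trans (cong (inc (b z)) (≡-trans (⊕-inc (a z) M N) (cong (inc (a z)) eq))) (inc-comm (b z) (a z) _))) ih))
    where ih = terms-complement zs

  -- Exchanging the choice made in a factor turns α into β = (α β) α and β into α = (α β) β, because
  -- the squares are 1. So exchanging all choices multiplies every coefficient by `sign zs`.
  terms-swap : (zs : List (Binomial n)) → map (λ (c , M , N) → sign zs * c , N , M) (terms zs) ↭ terms zs
  terms-swap []       = ↭-refl
  terms-swap {n} (z ∷ zs) = ↭-trans (↭-reflexive (≡-trans (Listₚ.map-++ sw (map f₁ (terms zs)) (map f₂ (terms zs)))
      (cong₂ _++_ (transfer f₁ f₂ (λ c → lemma₁ (α z) (β z) (sign zs) c (α² z)))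
                  (transfer f₂ f₁ (λ c → lemma₂ (α z) (β z) (sign zs) c (β² z))))))
    (↭-trans (++-comm (map f₂ (map sw′ (terms zs))) (map f₁ (map sw′ (terms zs))))
             (++⁺ (map⁺ f₁ (terms-swap zs)) (map⁺ f₂ (terms-swap zs))))
    where
    Term = ℤ × Monomial n × Monomial n
    sw sw′ f₁ f₂ : Term → Term
    sw  (c , M , N) = sign (z ∷ zs) * c , N , M
    sw′ (c , M , N) = sign zs * c , N , M
    f₁  (c , M , N) = α z * c , inc (a z) M , inc (b z) N
    f₂  (c , M , N) = β z * c , inc (b z) M , inc (a z) N
    transfer : (f g : Term → Term) → (∀ {M N} c → sw (f (c , M , N)) ≡ g (sw′ (c , M , N))) →
               map sw (map f (terms zs)) ≡ map g (map sw′ (terms zs))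
    transfer f g eq = ≡-trans (sym (Listₚ.map-∘ (terms zs))) (≡-trans (Listₚ.map-cong (λ (c , M , N) → eq c) (terms zs)) (Listₚ.map-∘ (terms zs)))
    lemma₁ : ∀ {M N : Monomial n} a b s c → a * a ≡ 1ℤ → (((a * b) * s) * (a * c) , M , N) ≡ (b * (s * c) , M , N)
    lemma₁ {M} {N} a b s c eq = cong (λ v → v , M , N) (≡-trans (l a b s c) (≡-trans (cong (_* (b * (s * c))) eq) (ℤₚ.*-identityˡ (b * (s * c)))))
      where
      l : ∀ a b s c → ((a * b) * s) * (a * c) ≡ (a * a) * (b * (s * c))
      l = solve-∀
    lemma₂ : ∀ {M N : Monomial n} a b s c → b * b ≡ 1ℤ → (((a * b) * s) * (b * c) , M , N) ≡ (a * (s * c) , M , N)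
    lemma₂ {M} {N} a b s c eq = cong (λ v → v , M , N) (≡-trans (l a b s c) (≡-trans (cong (_* (a * (s * c))) eq) (ℤₚ.*-identityˡ (a * (s * c)))))
      where
      l : ∀ a b s c → ((a * b) * s) * (b * c) ≡ (b * b) * (a * (s * c))
      l = solve-∀

  poly : List (Binomial n) → Poly n
  poly zs = map (λ (c , M , N) → c , M) (terms zs)

  -- The value at `point` is the product of the values of the factors, none of which is zero.
  eval-terms≢0 : (zs : List (Binomial n)) → ∑ (poly zs) (λ (c , M) → c * eval point M) ≢ 0ℤ
  eval-terms≢0 {n} zs eq = go zs (≡-trans (sym (∑-map (λ (c , M , N) → c , M) (terms zs))) eq)
    where
    one : ∀ {n} (v : Fin n → ℤ) → eval v (replicate n 0) ≡ 1ℤ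
    one {zero}  v = refl
    one {suc n} v = ≡-trans (ℤₚ.*-identityˡ (eval (v ∘ suc) (replicate n 0))) (one (v ∘ suc))
    S : List (Binomial n) → ℤ
    S zs = ∑ (terms zs) (λ (c , M , N) → c * eval point M)
    factor : ∀ z zs → S (z ∷ zs) ≡ (α z * point (a z) + β z * point (b z)) * S zs
    factor z zs = ≡-trans (∑-terms z zs _) (≡-trans
      (cong₂ _+_ (part (α z) (a z) (λ M → eval-inc point (a z) M)) (part (β z) (b z) (λ M → eval-inc point (b z) M)))
      (sym (ℤₚ.*-distribʳ-+ (S zs) (α z * point (a z)) (β z * point (b z)))))
      where
      lemma : ∀ a c p e → a * c * (p * e) ≡ a * p * (c * e)
      lemma = solve-∀
      part : ∀ s g → (∀ M → eval point (inc g M) ≡ point g * eval point M) →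
             ∑ (terms zs) (λ (c , M , N) → s * c * eval point (inc g M)) ≡ s * point g * S zs
      part s g e = ≡-trans (∑-cong (terms zs) (λ (c , M , N) → ≡-trans (cong (s * c *_) (e M)) (lemma s c (point g) (eval point M))))
                           (∑-* (s * point g) (λ (c , M , N) → c * eval point M) (terms zs))
    go : ∀ zs → S zs ≢ 0ℤ
    go []       eq = case ≡-trans (sym (cong (λ v → 1ℤ * v + 0ℤ) (one {n} point))) eq of λ ()
    go (z ∷ zs) eq = [ ≢0 z , go zs ]′ (ℤₚ.i*j≡0⇒i≡0∨j≡0 (α z * point (a z) + β z * point (b z)) (≡-trans (sym (factor z zs)) eq))

  norm²≢0 : (zs : List (Binomial n)) → norm² (poly zs) ≢ 0ℤ
  norm²≢0 zs eq = eval-terms≢0 zs (proj₂ (norm²-definite (poly zs) _ ℕₚ.≤-refl) eq (eval point))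

  module _ {n : ℕ} where

    -- The product of `zs` and q with the variables acting by `inc`, which matches the recursion of
    -- `terms`.
    apply : List (Binomial n) → Poly n → Poly n
    apply []       q = q
    apply (z ∷ zs) q = map (λ (c , M) → α z * c , inc (a z) M) (apply zs q)
                    ++ map (λ (c , M) → β z * c , inc (b z) M) (apply zs q)

    ∑-apply : (zs : List (Binomial n)) (q : Poly n) (θ : Monomial n → ℤ) →
              ∑ (apply zs q) (λ (c , M) → c * θ M) ≡ ∑ (terms zs) (λ (c , M , N) → c * ∑ q (λ (d , L) → d * θ (M ⊕ L)))
    ∑-apply [] q θ = ≡-trans (∑-cong q (λ (d , L) → cong (λ M → d * θ M) (sym (Vecₚ.zipWith-identityˡ ℕₚ.+-identityˡ L))))
      (lemma (∑ q (λ (d , L) → d * θ (replicate n 0 ⊕ L))))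
      where
      lemma : ∀ a → a ≡ 1ℤ * a + 0ℤ
      lemma = solve-∀
    ∑-apply (z ∷ zs) q θ = ≡-trans (∑-++ (map _ (apply zs q)) (map _ (apply zs q)))
      (≡-trans (cong₂ _+_ (part (α z) (a z)) (part (β z) (b z)))
               (sym (∑-terms z zs (λ (c , M , N) → c * ∑ q (λ (d , L) → d * θ (M ⊕ L))))))
      where
      part : ∀ s g → ∑ (map (λ (c , M) → s * c , inc g M) (apply zs q)) (λ (c , M) → c * θ M) ≡
                     ∑ (terms zs) (λ (c , M , N) → s * c * ∑ q (λ (d , L) → d * θ (inc g M ⊕ L)))
      part s g = ≡-trans (∑-map (λ (c , M) → s * c , inc g M) (apply zs q))
        (≡-trans (∑-cong (apply zs q) (λ (c , M) → ℤₚ.*-assoc s c (θ (inc g M))))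
        (≡-trans (∑-* s (λ (c , M) → c * θ (inc g M)) (apply zs q))
        (≡-trans (cong (s *_) (∑-apply zs q (θ ∘ inc g)))
        (≡-trans (sym (∑-* s (λ (c , M , N) → c * ∑ q (λ (d , L) → d * θ (inc g (M ⊕ L)))) (terms zs)))
        (∑-cong (terms zs) (λ (c , M , N) → ≡-trans (sym (ℤₚ.*-assoc s c (∑ q (λ (d , L) → d * θ (inc g (M ⊕ L))))))
          (cong (s * c *_) (∑-cong q (λ (d , L) → cong (λ K → d * θ K) (sym (inc-⊕ g M L)))))))))))

    ∑-∏ : (zs : List (Binomial n)) (es : List (Linear n)) (θ : Monomial n → ℤ) →
          ∑ (∏ₚ (map linear zs ++ es) lin) (λ (c , M) → c * θ M) ≡ ∑ (apply zs (∏ₚ es lin)) (λ (c , M) → c * θ M)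
    ∑-∏ []       es θ = refl
    ∑-∏ (z ∷ zs) es θ = ≡-trans (∑-++ (map (f (α z) (a z)) q) (map (f (β z) (b z)) q ++ []))
      (≡-trans (cong (λ l → ∑ (map (f (α z) (a z)) q) ϑ + ∑ l ϑ) (Listₚ.++-identityʳ (map (f (β z) (b z)) q)))
      (≡-trans (cong₂ _+_ (part (α z) (a z)) (part (β z) (b z)))
               (sym (∑-++ (map (f′ (α z) (a z)) (apply zs (∏ₚ es lin))) (map (f′ (β z) (b z)) (apply zs (∏ₚ es lin)))))))
      where
      q = ∏ₚ (map linear zs ++ es) lin
      ϑ : ℤ × Monomial n → ℤ
      ϑ (c , M) = c * θ M
      f f′ : ℤ → Fin n → ℤ × Monomial n → ℤ × Monomial n
      f  s g (d , N) = s * d , zipWith ℕ._+_ (replicate n 0 [ g ]≔ 1) N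
      f′ s g (d , N) = s * d , inc g N
      pull : ∀ s g (p : Poly n) → ∑ p (λ (d , N) → s * d * θ (inc g N)) ≡ s * ∑ p (λ (d , N) → d * θ (inc g N))
      pull s g p = ≡-trans (∑-cong p (λ (d , N) → ℤₚ.*-assoc s d (θ (inc g N)))) (∑-* s (λ (d , N) → d * θ (inc g N)) p)
      part : ∀ s g → ∑ (map (f s g) q) ϑ ≡ ∑ (map (f′ s g) (apply zs (∏ₚ es lin))) ϑ
      part s g = ≡-trans (∑-map (f s g) q)
        (≡-trans (∑-cong q (λ (d , N) → cong (λ L → s * d * θ L) (unit-⊕ g N)))
        (≡-trans (pull s g q) (≡-trans (cong (s *_) (∑-∏ zs es (θ ∘ inc g)))
        (≡-trans (sym (pull s g (apply zs (∏ₚ es lin)))) (sym (∑-map (f′ s g) (apply zs (∏ₚ es lin))))))))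

    -- ⟪ θ ⟫ pairs the terms of ∏ zs with themselves.
    ⟪_⟫ : {zs : List (Binomial n)} → (Monomial n → Monomial n → ℤ) → ℤ
    ⟪_⟫ {zs} θ = ∑ (terms zs) λ (c , M , _) → c * ∑ (terms zs) λ (d , N , _) → d * θ M N

    doubled : (zs : List (Binomial n)) (θ : Monomial n → ℤ) →
              ∑ (∏ₚ (map linear (zs ++ zs)) lin) (λ (c , M) → c * θ M) ≡ ⟪_⟫ {zs} (λ M N → θ (M ⊕ N))
    doubled zs θ = ≡-trans (cong (λ l → ∑ (∏ₚ l lin) (λ (c , M) → c * θ M)) (Listₚ.map-++ linear zs zs))
      (≡-trans (∑-∏ zs (map linear zs) θ) (≡-trans (∑-apply zs (∏ₚ (map linear zs) lin) θ)
      (∑-cong (terms zs) (λ (c , M , _) → cong (c *_)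
        (≡-trans (cong (λ l → ∑ (∏ₚ l lin) (λ (d , L) → d * θ (M ⊕ L))) (sym (Listₚ.++-identityʳ (map linear zs))))
        (≡-trans (∑-∏ zs [] (λ L → θ (M ⊕ L))) (≡-trans (∑-apply zs 1ₚ (λ L → θ (M ⊕ L)))
        (∑-cong (terms zs) (λ (d , N , _) → cong (d *_) (lemma (θ (M ⊕ (N ⊕ replicate n 0))) (cong (λ K → θ (M ⊕ K)) (⊕-identityʳ N))))))))))))
      where
      lemma′ : ∀ a → 1ℤ * a + 0ℤ ≡ a
      lemma′ = solve-∀
      lemma : ∀ v {w} → v ≡ w → 1ℤ * v + 0ℤ ≡ w
      lemma v refl = lemma′ v

    -- Replacing the second factor by its complement turns M ⊕ N ≡ D into an equality of monomials.
    complement : (zs : List (Binomial n)) (θ θ′ : Monomial n → Monomial n → ℤ) →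
                 (∀ {M N N′} → N ⊕ N′ ≡ cnt (ends zs) → θ M N ≡ θ′ M N′) →
                 ⟪_⟫ {zs} θ ≡ sign zs * ⟪_⟫ {zs} θ′
    complement zs θ θ′ eq = ≡-trans (∑-cong (terms zs) (λ (c , M , _) → ≡-trans (cong (c *_) (inner M)) (lemma c (sign zs) _)))
                                    (∑-* (sign zs) (λ (c , M , _) → c * ∑ (terms zs) (λ (d , N , _) → d * θ′ M N)) (terms zs))
      where
      lemma : ∀ a b c → a * (b * c) ≡ b * (a * c)
      lemma = solve-∀
      inner : ∀ M → ∑ (terms zs) (λ (d , N , _) → d * θ M N) ≡ sign zs * ∑ (terms zs) (λ (d , N , _) → d * θ′ M N)
      inner M = ≡-trans (∑-cong-∈ (terms zs) (λ {(d , N , N′)} q → cong (d *_) (eq (All.lookup (terms-complement zs) q))))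
        (≡-trans (sym (∑-↭ (λ (d , N , N′) → d * θ′ M N′) (terms-swap zs)))
        (≡-trans (∑-map (λ (c , M , N) → sign zs * c , N , M) (terms zs))
        (≡-trans (∑-cong (terms zs) (λ (d , N , N′) → ℤₚ.*-assoc (sign zs) d (θ′ M N)))
                 (∑-* (sign zs) (λ (d , N , _) → d * θ′ M N) (terms zs)))))

    sign² : (zs : List (Binomial n)) → sign zs * sign zs ≡ 1ℤ
    sign² []       = refl
    sign² (z ∷ zs) = ≡-trans (lemma (α z) (β z) (sign zs)) (≡-trans (cong₂ _*_ (cong₂ _*_ (α² z) (β² z)) (sign² zs)) refl)
      where
      lemma : ∀ a b s → ((a * b) * s) * ((a * b) * s) ≡ ((a * a) * (b * b)) * (s * s)
      lemma = solve-∀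

    unit-* : ∀ u v → u * u ≡ 1ℤ → u * v ≡ 0ℤ → v ≡ 0ℤ
    unit-* u v u² eq = ≡-trans (sym (ℤₚ.*-identityˡ v)) (≡-trans (cong (_* v) (sym u²))
      (≡-trans (ℤₚ.*-assoc u u v) (≡-trans (cong (u *_) eq) (ℤₚ.*-zeroʳ u))))

    norm²-⟪⟫ : (zs : List (Binomial n)) → norm² (poly zs) ≡ ⟪_⟫ {zs} (λ M N → χ (N ≟ᵐ M))
    norm²-⟪⟫ zs = ≡-trans (∑-map (λ (c , M , N) → c , M) (terms zs))
      (∑-cong (terms zs) (λ (c , M , _) → cong (c *_) (∑-map (λ (c , M , N) → c , M) (terms zs))))

    ⟪⟫-sym : (zs : List (Binomial n)) (θ : Monomial n → Monomial n → ℤ) → ⟪_⟫ {zs} θ ≡ ⟪_⟫ {zs} (flip θ)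
    ⟪⟫-sym zs θ = ≡-trans (∑-cong (terms zs) (λ (c , M , _) → sym (∑-* c (λ (d , N , _) → d * θ M N) (terms zs))))
      (≡-trans (∑-swap (λ (c , M , _) (d , N , _) → c * (d * θ M N)) (terms zs) (terms zs))
      (∑-cong (terms zs) (λ (d , N , _) → ≡-trans (∑-cong (terms zs) (λ (c , M , _) → lemma c d (θ M N)))
        (∑-* d (λ (c , M , _) → c * θ M N) (terms zs)))))
      where
      lemma : ∀ a b c → a * (b * c) ≡ b * (a * c)
      lemma = solve-∀

    ⟪⟫-cong : (zs : List (Binomial n)) {θ θ′ : Monomial n → Monomial n → ℤ} → (∀ M N → θ M N ≡ θ′ M N) → ⟪_⟫ {zs} θ ≡ ⟪_⟫ {zs} θ′
    ⟪⟫-cong zs eq = ∑-cong (terms zs) (λ (c , M , _) → cong (c *_) (∑-cong (terms zs) (λ (d , N , _) → cong (d *_) (eq M N))))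

    -- N is cancelled on both sides after the product of the ends has been written as N ⊕ N′.
    cancel : ∀ (zs : List (Binomial n)) f g {M N N′} → N ⊕ N′ ≡ cnt (ends zs) →
             χ (inc f (M ⊕ N) ≟ᵐ inc g (cnt (ends zs))) ≡ χ (inc f M ≟ᵐ inc g N′)
    cancel zs f g {M} {N} {N′} eq = χ-⇔ _ _
      (λ e → ⊕-cancelʳ N (≡-trans (inc-⊕ f M N) (≡-trans e (≡-trans (cong (inc g) (≡-trans (sym eq) (⊕-comm N N′))) (sym (inc-⊕ g N′ N))))))
      (λ e → ≡-trans (sym (inc-⊕ f M N)) (≡-trans (cong (_⊕ N) e) (≡-trans (inc-⊕ g N′ N) (cong (inc g) (≡-trans (⊕-comm N′ N) eq)))))

    -- With F = ∏ zs and D the product of its ends, the coefficient of D in F² is ∑ c_M c_(D-M), and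
    -- the exchange of all choices replaces c_(D-M) by `sign zs` times c_M.
    Φ-squares : (zs : List (Binomial n)) → Φ (map linear (zs ++ zs)) (cnt (ends zs)) ≢ 0ℤ
    Φ-squares zs eq = norm²≢0 zs (≡-trans (norm²-⟪⟫ zs)
      (unit-* (sign zs) (⟪_⟫ {zs} (λ M N → χ (N ≟ᵐ M))) (sign² zs) (≡-trans (sym value≡) eq)))
      where
      value≡ : Φ (map linear (zs ++ zs)) (cnt (ends zs)) ≡ sign zs * ⟪_⟫ {zs} (λ M N → χ (N ≟ᵐ M))
      value≡ = ≡-trans (coeff-∑ (∏ₚ (map linear (zs ++ zs)) lin) (cnt (ends zs)))
        (≡-trans (doubled zs (λ M → χ (M ≟ᵐ cnt (ends zs))))
        (complement zs (λ M N → χ (M ⊕ N ≟ᵐ cnt (ends zs))) (λ M N → χ (N ≟ᵐ M)) (λ {M} {N} {N′} e →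
          χ-⇔ _ _ (λ e′ → ⊕-cancelʳ N (≡-trans (⊕-comm N′ N) (≡-trans e (sym e′))))
                  (λ { refl → ≡-trans (⊕-comm M N) e }))))

    -- With v = γ y_o + η y_o′, both the coefficient below and ∥v ∏ zs∥² are units times ∥∏ zs∥² + γη Z.
    Φ-squares-single : (v : Binomial n) (zs : List (Binomial n)) →
                       Φ (map linear (v ∷ zs ++ zs)) (cnt (a v ∷ ends zs)) ≢ 0ℤ
    Φ-squares-single v zs eq = norm²≢0 (v ∷ zs) (≡-trans (norm²-⟪⟫ (v ∷ zs)) (≡-trans norm≡ (≡-trans (cong (λ t → t + t) core≡0) refl)))
      where
      γ = α v ; η = β v ; o = a v ; o′ = b v
      D = cnt (ends zs)
      Q Z : ℤ
      Q = ⟪_⟫ {zs} (λ M N → χ (N ≟ᵐ M))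
      Z = ⟪_⟫ {zs} (λ M N → χ (inc o′ M ≟ᵐ inc o N))
      q = ∏ₚ (map linear (zs ++ zs)) lin
      χ-inc : ∀ g M N → χ (inc g M ≟ᵐ inc g N) ≡ χ (N ≟ᵐ M)
      χ-inc g M N = χ-⇔ _ _ (sym ∘ inc-injective g) (cong (inc g) ∘ sym)
      value≡ : Φ (map linear (v ∷ zs ++ zs)) (inc o D) ≡ γ * (sign zs * Q) + η * (sign zs * Z)
      value≡ = ≡-trans (coeff-∑ (∏ₚ (map linear (v ∷ zs ++ zs)) lin) (inc o D))
        (≡-trans (∑-∏ (v ∷ []) (map linear (zs ++ zs)) (λ M → χ (M ≟ᵐ inc o D)))
        (≡-trans (∑-++ (map _ q) (map _ q))
        (cong₂ _+_ (part γ o Q (λ M N → χ-inc o M N)) (part η o′ Z (λ M N → refl)))))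
        where
        part : ∀ s g R → {θ : Monomial n → Monomial n → ℤ} → ⦃ R ≡ ⟪_⟫ {zs} θ ⦄ → (∀ M N → χ (inc g M ≟ᵐ inc o N) ≡ θ M N) →
               ∑ (map (λ (c , M) → s * c , inc g M) q) (λ (c , M) → c * χ (M ≟ᵐ inc o D)) ≡ s * (sign zs * R)
        part s g R {θ} ⦃ refl ⦄ e = ≡-trans (∑-map (λ (c , M) → s * c , inc g M) q)
          (≡-trans (∑-cong q (λ (c , M) → ℤₚ.*-assoc s c (χ (inc g M ≟ᵐ inc o D))))
          (≡-trans (∑-* s (λ (c , M) → c * χ (inc g M ≟ᵐ inc o D)) q)
          (cong (s *_) (≡-trans (doubled zs (λ M → χ (inc g M ≟ᵐ inc o D)))
            (complement zs (λ M N → χ (inc g (M ⊕ N) ≟ᵐ inc o D)) θ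
              (λ {M} {N} {N′} e′ → ≡-trans (cancel zs g o {M} {N} {N′} e′) (e M N′)))))))
      core≡0 : Q + γ * η * Z ≡ 0ℤ
      core≡0 = unit-* (γ * sign zs) (Q + γ * η * Z)
        (≡-trans (lemma₁ γ (sign zs)) (≡-trans (cong₂ _*_ (α² v) (sign² zs)) refl))
        (≡-trans (lemma₂ γ η (sign zs) Q Z) (≡-trans (cong (λ t → γ * (sign zs * Q) + t * (η * (sign zs * Z))) (α² v))
          (≡-trans (cong (γ * (sign zs * Q) +_) (ℤₚ.*-identityˡ (η * (sign zs * Z)))) (≡-trans (sym value≡) eq))))
        where
        lemma₁ : ∀ g s → (g * s) * (g * s) ≡ (g * g) * (s * s)
        lemma₁ = solve-∀
        lemma₂ : ∀ g h s Q Z → (g * s) * (Q + g * h * Z) ≡ g * (s * Q) + (g * g) * (h * (s * Z))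
        lemma₂ = solve-∀
      -- The scalar product of y_g F and y_h F for F = ∏ zs. It is Q when g = h and Z for the two
      -- ends of v, hence ∥v F∥² = (γ² + η²) Q + 2 γ η Z.
      Y : Fin n → Fin n → ℤ
      Y g h = ⟪_⟫ {zs} (λ M N → χ (inc g N ≟ᵐ inc h M))
      outer : ∀ s g → ∑ (terms zs) (λ (c , M , N) → s * c * ∑ (terms (v ∷ zs)) (λ (d , L , _) → d * χ (L ≟ᵐ inc g M)))
              ≡ s * γ * Y o g + s * η * Y o′ g
      outer s g = ≡-trans (∑-cong (terms zs) (λ (c , M , _) → ≡-trans (cong (s * c *_)
          (≡-trans (∑-terms v zs (λ (d , L , _) → d * χ (L ≟ᵐ inc g M))) (cong₂ _+_ (pull γ o M) (pull η o′ M))))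
          (lemma s c γ η (inner o M) (inner o′ M))))
        (≡-trans (∑-+ (λ (c , M , _) → s * γ * (c * inner o M)) (λ (c , M , _) → s * η * (c * inner o′ M)) (terms zs))
        (cong₂ _+_ (∑-* (s * γ) (λ (c , M , _) → c * inner o M) (terms zs)) (∑-* (s * η) (λ (c , M , _) → c * inner o′ M) (terms zs))))
        where
        inner : Fin n → Monomial n → ℤ
        inner h M = ∑ (terms zs) (λ (d , N , _) → d * χ (inc h N ≟ᵐ inc g M))
        pull : ∀ t h M → ∑ (terms zs) (λ (d , N , _) → t * d * χ (inc h N ≟ᵐ inc g M)) ≡ t * inner h M
        pull t h M = ≡-trans (∑-cong (terms zs) (λ (d , N , _) → ℤₚ.*-assoc t d (χ (inc h N ≟ᵐ inc g M))))
                             (∑-* t (λ (d , N , _) → d * χ (inc h N ≟ᵐ inc g M)) (terms zs))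
        lemma : ∀ s c g h x y → s * c * (g * x + h * y) ≡ s * g * (c * x) + s * h * (c * y)
        lemma = solve-∀
      Y-diagonal : ∀ g → Y g g ≡ Q
      Y-diagonal g = ⟪⟫-cong zs (λ M N → χ-inc g N M ⟨≡⟩ χ-⇔ (M ≟ᵐ N) (N ≟ᵐ M) sym sym)
        where
        infixr 5 _⟨≡⟩_
        _⟨≡⟩_ = ≡-trans
      Yo′o : Y o′ o ≡ Z
      Yo′o = ⟪⟫-sym zs (λ M N → χ (inc o′ N ≟ᵐ inc o M))
      Yoo′ : Y o o′ ≡ Z
      Yoo′ = ⟪⟫-cong zs (λ M N → χ-⇔ (inc o N ≟ᵐ inc o′ M) (inc o′ M ≟ᵐ inc o N) sym sym)
      norm≡ : ⟪_⟫ {v ∷ zs} (λ M N → χ (N ≟ᵐ M)) ≡ (Q + γ * η * Z) + (Q + γ * η * Z)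
      norm≡ = ≡-trans (∑-terms v zs (λ (c , M , _) → c * ∑ (terms (v ∷ zs)) (λ (d , N , _) → d * χ (N ≟ᵐ M))))
        (≡-trans (cong₂ _+_ (outer γ o) (outer η o′))
        (≡-trans (cong₂ _+_ (cong₂ (λ s t → γ * γ * s + γ * η * t) (Y-diagonal o) Yo′o)
                            (cong₂ (λ s t → η * γ * s + η * η * t) Yoo′ (Y-diagonal o′)))
        (≡-trans (cong₂ (λ s t → (s * Q + γ * η * Z) + (η * γ * Z + t * Q)) (α² v) (β² v)) (lemma γ η Q Z))))
        where
        lemma : ∀ g h Q Z → (1ℤ * Q + g * h * Z) + (h * g * Z + 1ℤ * Q) ≡ (Q + g * h * Z) + (Q + g * h * Z)
        lemma = solve-∀

    per-Φ≢0 : (fs : List (Fin n)) (es : List (Linear n)) → Φ es (cnt fs) ≢ 0ℤ → per value es fs ≢ 0ℤ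
    per-Φ≢0 fs es Φ≢0 eq with per-Φ fs
    ... | c , per≡ = [ (λ ()) , Φ≢0 ]′ (ℤₚ.i*j≡0⇒i≡0∨j≡0 (pos (suc c)) (≡-trans (sym (per≡ es)) eq))

open Squares using (ends; Φ-squares; Φ-squares-single; per-Φ≢0)

-- Multiplicities and sums over all variables

per-length : (M : Row → Col → ℤ) (fs : List Row) (ws : List Col) → per M fs ws ≢ 0ℤ → length fs ≡ length ws
per-length M []      []       _ = refl
per-length M (_ ∷ _) []       ≢0 = contradiction refl ≢0
per-length M fs      (w ∷ ws) ≢0 with ∑≢0 _ (picks fs) (λ z → ≢0 (≡-trans (per-∷ M fs w ws) z))
... | (f , r) , q , ≢0′ = ≡-trans (sym (↭-length (∈-picks fs q)))
  (cong suc (per-length M r ws (λ z → ≢0′ (≡-trans (cong (M f w *_) z) (ℤₚ.*-zeroʳ (M f w))))))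

ι : {P : Set} → Dec P → ℕ
ι (yes _) = 1
ι (no _)  = 0

ι-yes : {P : Set} (d : Dec P) → P → ι d ≡ 1
ι-yes (yes _) p = refl
ι-yes (no ¬p) p = contradiction p ¬p

ι-no : {P : Set} (d : Dec P) → ¬ P → ι d ≡ 0
ι-no (yes p) ¬p = contradiction p ¬p
ι-no (no _)  ¬p = refl

δ : ∀ {n} → Fin n → Fin n → ℤ
δ a v = χ (a Finₚ.≟ v)

lookup-cnt : ∀ {m} (cs : List (Fin m)) (e : Fin m) →
             vlookup (cnt cs) e ≡ tot (λ c → ι (c Finₚ.≟ e)) cs
lookup-cnt []       e = Vecₚ.lookup-replicate e 0
lookup-cnt (c ∷ cs) e with c Finₚ.≟ e
... | yes refl = ≡-trans (lookup-inc c (cnt cs)) (cong suc (lookup-cnt cs c))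
... | no  c≢e  = ≡-trans (lookup-inc-≢ c e (cnt cs) c≢e) (lookup-cnt cs e)

sum-cnt : ∀ {m} (cs : List (Fin m)) → sum (map (vlookup (cnt cs)) (allFin m)) ≡ length cs
sum-cnt {m} cs = ≡-trans (cong sum (Listₚ.map-tabulate (λ i → i) (vlookup (cnt cs)))) (go cs)
  where
  total : ∀ {m} → (Fin m → ℕ) → ℕ
  total g = sum (tabulate g)
  total-inc : ∀ {m} (c : Fin m) (N : Monomial m) → total (vlookup (inc c N)) ≡ suc (total (vlookup N))
  total-inc zero    (x ∷ N) = refl
  total-inc (suc c) (x ∷ N) = ≡-trans (cong (x ℕ.+_) (total-inc c N)) (ℕₚ.+-suc x _)
  total-zero : ∀ m → total (vlookup (replicate m 0)) ≡ 0
  total-zero zero    = refl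
  total-zero (suc m) = total-zero m
  go : ∀ cs → total (vlookup (cnt cs)) ≡ length cs
  go []       = total-zero m
  go (c ∷ cs) = ≡-trans (total-inc c (cnt cs)) (cong suc (go cs))

∑-filter : {Elem : Set} {P : Elem → Set} (P? : ∀ x → Dec (P x)) (h : Elem → ℤ) (xs : List Elem) →
           ∑ (filter P? xs) h ≡ ∑ xs (λ x → χ (P? x) * h x)
∑-filter P? h []       = refl
∑-filter P? h (x ∷ xs) with P? x
... | yes _ = cong₂ _+_ (sym (ℤₚ.*-identityˡ (h x))) (∑-filter P? h xs)
... | no  _ = ≡-trans (∑-filter P? h xs) (sym (ℤₚ.+-identityˡ _))

∑-allFin-δ : ∀ {m} (k : Fin m → ℤ) (f : Fin m) → ∑ (allFin m) (λ g → k g * χ (g Finₚ.≟ f)) ≡ k f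
∑-allFin-δ {suc m} k f = ≡-trans (cong (λ l → k zero * χ (zero Finₚ.≟ f) + ∑ l (λ g → k g * χ (g Finₚ.≟ f))) (sym (Listₚ.map-tabulate (λ i → i) suc)))
  (≡-trans (cong (k zero * χ (zero Finₚ.≟ f) +_) (∑-map suc (allFin m))) (go f))
  where
  go : ∀ f → k zero * χ (zero Finₚ.≟ f) + ∑ (allFin m) (λ g → k (suc g) * χ (suc g Finₚ.≟ f)) ≡ k f
  go zero    = ≡-trans (cong₂ _+_ (ℤₚ.*-identityʳ (k zero)) (∑-zero (allFin m) (λ {g} _ → ℤₚ.*-zeroʳ (k (suc g))))) (ℤₚ.+-identityʳ (k zero))
  go (suc f) = ≡-trans (cong₂ _+_ (ℤₚ.*-zeroʳ (k zero))
    (≡-trans (∑-cong (allFin m) (λ g → cong (k (suc g) *_) (χ-⇔ (suc g Finₚ.≟ suc f) (g Finₚ.≟ f) Finₚ.suc-injective (cong suc)))) (∑-allFin-δ (k ∘ suc) f)))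
    (ℤₚ.+-identityˡ (k (suc f)))

∑-filter-δ : ∀ {m} {P : Fin m → Set} (P? : ∀ e → Dec (P e)) (f : Fin m) → ∑ (filter P? (allFin m)) (λ g → χ (g Finₚ.≟ f)) ≡ χ (P? f)
∑-filter-δ {m} P? f = ≡-trans (∑-filter P? (λ g → χ (g Finₚ.≟ f)) (allFin m)) (∑-allFin-δ (λ g → χ (P? g)) f)

-- From directions on the vertex sums to choosability

module Reduction {n : ℕ} (G : Graph n) where
  open Graph G renaming (sym to ~-sym; irrefl to ~-irrefl)

  V : Set
  V = Fin n

  Step : Set
  Step = V × V

  Direction : Set
  Direction = List (ℤ × Step)

  Adjacent : ℤ × Step → Set
  Adjacent (_ , a , b) = a ~ b

  vec : Direction → V → ℤ
  vec d v = ∑ d λ (s , a , b) → s * (δ a v + δ b v)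

  form : V × V → (V → ℤ) → ℤ
  form (a , b) φ = φ a - φ b

  Same : V → V → Step → Set
  Same a b (x , y) = (x ≡ a × y ≡ b) ⊎ (x ≡ b × y ≡ a)

  same? : ∀ a b s → Dec (Same a b s)
  same? a b (x , y) = ((x Finₚ.≟ a) ×-dec (y Finₚ.≟ b)) ⊎-dec ((x Finₚ.≟ b) ×-dec (y Finₚ.≟ a))

  same : V → V → Step → ℕ
  same a b s = ι (same? a b s)

  -- Steps count in both orientations and whatever their coefficients. This bounds the exponent of
  -- the edge ab after any selection of basis vectors.
  uses : V → V → Direction → ℕ
  uses a b d = tot (same a b) (map proj₂ d)

  edge-∈ : ∀ {a b} → a < b → a ~ b → (a , b) ∈ edges
  edge-∈ {a} {b} a<b a~b = ∈-filter⁺ (λ (i , j) → (i Finₚ.<? j) ×-dec (i ~? j))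
    (∈-cartesianProduct⁺ (∈-allFin a) (∈-allFin b)) (a<b , a~b)

  edges-adjacent : ∀ {a b} → (a , b) ∈ edges → a < b × a ~ b
  edges-adjacent q = proj₂ (∈-filter⁻ (λ (i , j) → (i Finₚ.<? j) ×-dec (i ~? j)) {xs = cartesianProduct (allFin n) (allFin n)} q)

  lo~hi : ∀ e → lo e < hi e × lo e ~ hi e
  lo~hi e = edges-adjacent (∈-lookup e)

  Joins : Edge → V → V → Set
  Joins e a b = (a ≡ lo e × b ≡ hi e) ⊎ (b ≡ lo e × a ≡ hi e)

  edge-of : ∀ {a b} → a ~ b → ∃[ e ] Joins e a b
  edge-of {a} {b} a~b with Finₚ.<-cmp a b
  ... | tri< a<b _ _ = let q = edge-∈ a<b a~b in index q , inj₁ (cong proj₁ (Anyₚ.lookup-index q) , cong proj₂ (Anyₚ.lookup-index q))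
  ... | tri≈ _ a≡b _ = contradiction a~b (~-irrefl a≡b)
  ... | tri> _ _ b<a = let q = edge-∈ b<a (~-sym a~b) in index q , inj₂ (cong proj₁ (Anyₚ.lookup-index q) , cong proj₂ (Anyₚ.lookup-index q))

  ℓ : Edge → Linear ∣E∣
  ℓ e = map (λ f → 1ℤ , f) E⟨ lo e ⟩ ++ map (λ f → -1ℤ , f) E⟨ hi e ⟩

  P-factor : ∀ e → ∑ₚ E⟨ lo e ⟩ var -ₚ ∑ₚ E⟨ hi e ⟩ var ≡ lin (ℓ e)
  P-factor e = ≡-trans (cong₂ (λ p q → p ++ map (λ (c , M) → - c , M) q) (vars E⟨ lo e ⟩) (vars E⟨ hi e ⟩))
    (≡-trans (cong₂ _++_ (Listₚ.map-∘ E⟨ lo e ⟩) (≡-trans (sym (Listₚ.map-∘ E⟨ hi e ⟩)) (Listₚ.map-∘ E⟨ hi e ⟩)))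
             (sym (Listₚ.map-++ _ (map (λ f → 1ℤ , f) E⟨ lo e ⟩) (map (λ f → -1ℤ , f) E⟨ hi e ⟩))))
    where
    vars : ∀ es → ∑ₚ es var ≡ map (λ f → 1ℤ , replicate ∣E∣ 0 [ f ]≔ 1) es
    vars []       = refl
    vars (f ∷ es) = cong (_ ∷_) (vars es)

  P-lin : P ≡ ∏ₚ (map ℓ (allFin ∣E∣)) lin
  P-lin = cong (foldr _*ₚ_ 1ₚ) (≡-trans (Listₚ.map-cong P-factor (allFin ∣E∣)) (Listₚ.map-∘ (allFin ∣E∣)))

  incidence : ∀ i f → ∑ E⟨ i ⟩ (λ g → χ (g Finₚ.≟ f)) ≡ δ (lo f) i + δ (hi f) i
  incidence i f = ≡-trans (∑-filter-δ P? f) (cases (i Finₚ.≟ lo f) (i Finₚ.≟ hi f) (lo f Finₚ.≟ i) (hi f Finₚ.≟ i))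
    where
    P? = λ e → (i Finₚ.≟ lo e) ⊎-dec (i Finₚ.≟ hi e)
    cases : (p : Dec (i ≡ lo f)) (q : Dec (i ≡ hi f)) (p′ : Dec (lo f ≡ i)) (q′ : Dec (hi f ≡ i)) → χ (p ⊎-dec q) ≡ χ p′ + χ q′
    cases (yes p) (yes q) _ _ = contradiction (proj₂ (lo~hi f)) (~-irrefl (≡-trans (sym p) q))
    cases (yes p) (no ¬q) p′ q′ = sym (cong₂ _+_ (χ-yes p′ (sym p)) (χ-no q′ (¬q ∘ sym)))
    cases (no ¬p) (yes q) p′ q′ = sym (cong₂ _+_ (χ-no p′ (¬p ∘ sym)) (χ-yes q′ (sym q)))
    cases (no ¬p) (no ¬q) p′ q′ = sym (cong₂ _+_ (χ-no p′ (¬p ∘ sym)) (χ-no q′ (¬q ∘ sym)))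

  value-ℓ : ∀ e f → value (ℓ e) f ≡ form (lo e , hi e) (λ v → δ (lo f) v + δ (hi f) v)
  value-ℓ e f = ≡-trans (∑-++ {Elem = ℤ × Edge} {g = λ (c , g) → c * χ (g Finₚ.≟ f)} (map (λ f → 1ℤ , f) E⟨ lo e ⟩) (map (λ f → -1ℤ , f) E⟨ hi e ⟩))
    (cong₂ _+_ (≡-trans (part 1ℤ (lo e)) (ℤₚ.*-identityˡ (δ (lo f) (lo e) + δ (hi f) (lo e)))) (≡-trans (part -1ℤ (hi e)) (ℤₚ.-1*i≡-i (δ (lo f) (hi e) + δ (hi f) (hi e)))))
    where
    part : ∀ s i → ∑ (map (λ f → s , f) E⟨ i ⟩) (λ (c , g) → c * χ (g Finₚ.≟ f)) ≡ s * (δ (lo f) i + δ (hi f) i)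
    part s i = ≡-trans (∑-map (λ f → s , f) E⟨ i ⟩) (≡-trans (∑-* s (λ g → χ (g Finₚ.≟ f)) E⟨ i ⟩) (cong (s *_) (incidence i f)))

  onEdges : (d : Direction) → All Adjacent d → List (ℤ × Edge)
  onEdges []              []          = []
  onEdges ((s , a , b) ∷ d) (a~b ∷ adj) = (s , proj₁ (edge-of a~b)) ∷ onEdges d adj

  spread-onEdges : ∀ e d adj → spread (λ e f → value (ℓ e) f) e (onEdges d adj) ≡ form (lo e , hi e) (vec d)
  spread-onEdges e []                []          = refl
  spread-onEdges e ((s , a , b) ∷ d) (a~b ∷ adj) with edge-of a~b
  ... | f , joins = ≡-trans (cong₂ _+_ (cong (s *_) (≡-trans (value-ℓ e f) (at-ends joins))) (spread-onEdges e d adj))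
                            (lemma s (δ a (lo e) + δ b (lo e)) (δ a (hi e) + δ b (hi e)) (vec d (lo e)) (vec d (hi e)))
    where
    at-ends : Joins f a b → form (lo e , hi e) (λ v → δ (lo f) v + δ (hi f) v) ≡ form (lo e , hi e) (λ v → δ a v + δ b v)
    at-ends (inj₁ (refl , refl)) = refl
    at-ends (inj₂ (refl , refl)) = cong₂ _-_ (ℤₚ.+-comm (δ (lo f) (lo e)) (δ (hi f) (lo e))) (ℤₚ.+-comm (δ (lo f) (hi e)) (δ (hi f) (hi e)))
    lemma : ∀ s x y u v → s * (x - y) + (u - v) ≡ (s * x + u) - (s * y + v)
    lemma = solve-∀

  uses-onEdges : ∀ e d adj → tot (λ c → ι (c Finₚ.≟ e)) (map proj₂ (onEdges d adj)) ℕ.≤ uses (lo e) (hi e) d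
  uses-onEdges e []                []          = ℕ.z≤n
  uses-onEdges e ((s , a , b) ∷ d) (a~b ∷ adj) with edge-of a~b
  ... | f , joins = ℕₚ.+-mono-≤ (bound (f Finₚ.≟ e) joins) (uses-onEdges e d adj)
    where
    bound : (q : Dec (f ≡ e)) → Joins f a b → ι q ℕ.≤ same (lo e) (hi e) (a , b)
    bound (no _) _ = ℕ.z≤n
    bound (yes refl) joins = ℕₚ.≤-reflexive (sym (ι-yes (same? (lo e) (hi e) (a , b))
      (case joins of λ { (inj₁ (p , q)) → inj₁ (p , q) ; (inj₂ (p , q)) → inj₂ (q , p) })))

  onEdgesAll : (ds : List Direction) → All (All Adjacent) ds → List (List (ℤ × Edge))
  onEdgesAll []       []           = []
  onEdgesAll (d ∷ ds) (adj ∷ adjs) = onEdges d adj ∷ onEdgesAll ds adjs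

  per-onEdges : ∀ fs ds adjs → per (spread (λ e f → value (ℓ e) f)) fs (onEdgesAll ds adjs) ≡
                               per (λ e d → form (lo e , hi e) (vec d)) fs ds
  per-onEdges []       []       []           = refl
  per-onEdges (f ∷ fs) []       []           = refl
  per-onEdges fs       (d ∷ ds) (adj ∷ adjs) = ≡-trans (per-∷ _ fs (onEdges d adj) (onEdgesAll ds adjs))
    (≡-trans (∑-cong (picks fs) (λ (f , r) → cong₂ _*_ (spread-onEdges f d adj) (per-onEdges r ds adjs)))
             (sym (per-∷ _ fs d ds)))

  uses-all : V → V → List Direction → ℕ
  uses-all a b = tot (uses a b)

  uses-onEdgesAll : ∀ e ds adjs → tot (λ c → ι (c Finₚ.≟ e)) (support (onEdgesAll ds adjs)) ℕ.≤ uses-all (lo e) (hi e) ds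
  uses-onEdgesAll e []       []           = ℕ.z≤n
  uses-onEdgesAll e (d ∷ ds) (adj ∷ adjs) = ℕₚ.≤-trans
    (ℕₚ.≤-reflexive (tot-++ _ (map proj₂ (onEdges d adj)) (support (onEdgesAll ds adjs))))
    (ℕₚ.+-mono-≤ (uses-onEdges e d adj) (uses-onEdgesAll e ds adjs))

  -- `select` replaces the directions by single edges and keeps the permanent nonzero; K counts the
  -- chosen edges. There are |E| of them because a nonzero permanent is square, and K(e) is at most
  -- the number of uses of e.
  choosable : (ds : List Direction) → All (All Adjacent) ds →
              per (λ ab d → form ab (vec d)) edges ds ≢ 0ℤ →
              (∀ e → uses-all (lo e) (hi e) ds ℕ.≤ 4) → Algebraic⟨1, 5 ⟩-choosable
  choosable ds adjs per≢0 bound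
    with select (λ e f → value (ℓ e) f) (allFin ∣E∣) (onEdgesAll ds adjs) []
           (λ z → per≢0 (≡-trans (cong (λ es → per (λ ab d → form ab (vec d)) es ds) edges≡)
             (≡-trans (per-mapˡ _ (lookup edges) (allFin ∣E∣) ds)
             (≡-trans (sym (per-onEdges (allFin ∣E∣) ds adjs))
             (≡-trans (cong (per (spread (λ e f → value (ℓ e) f)) (allFin ∣E∣)) (sym (Listₚ.++-identityʳ (onEdgesAll ds adjs)))) z)))))
    where
    edges≡ : edges ≡ map (lookup edges) (allFin ∣E∣)
    edges≡ = sym (≡-trans (Listₚ.map-tabulate (λ i → i) (lookup edges)) (Listₚ.tabulate-lookup edges))
  ... | cs , per≢0′ , bd =
    vlookup (cnt cs)
    , ≡-trans (sum-cnt cs) (≡-trans (sym (per-length _ (allFin ∣E∣) cs per≢0′)) (Listₚ.length-tabulate (λ i → i)))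
    , (λ e → ℕₚ.≤-trans (ℕₚ.≤-reflexive (lookup-cnt cs e)) (ℕₚ.≤-trans (bd _)
        (ℕₚ.≤-trans (ℕₚ.≤-reflexive (ℕₚ.+-identityʳ _)) (ℕₚ.≤-trans (uses-onEdgesAll e ds adjs) (bound e)))))
    , λ z → per≢0′ (≡-trans (sym (per-mapˡ value ℓ (allFin ∣E∣) cs))
        (≡-trans (proj₂ (per-Φ cs) (map ℓ (allFin ∣E∣)))
        (≡-trans (cong (pos (suc (proj₁ (per-Φ cs))) *_)
          (≡-trans (cong₂ (λ p M → coeff p M) (sym P-lin) (sym (Vecₚ.tabulate∘lookup (cnt cs)))) z))
          (ℤₚ.*-zeroʳ (pos (suc (proj₁ (per-Φ cs))))))))

-- Permanents with nonnegative entries, and rescaled rows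

filter-↭ : {P : Elem → Set} (P? : ∀ x → Dec (P x)) (xs : List Elem) → filter P? xs ++ filter (¬? ∘ P?) xs ↭ xs
filter-↭ P? []       = ↭-refl
filter-↭ P? (x ∷ xs) with P? x
... | yes _ = prep x (filter-↭ P? xs)
... | no  _ = ↭-trans (shift x (filter P? xs) (filter (¬? ∘ P?) xs)) (prep x (filter-↭ P? xs))

∑-nonneg : (g : Elem → ℤ) (xs : List Elem) → (∀ {x} → x ∈ xs → 0ℤ ℤ.≤ g x) → 0ℤ ℤ.≤ ∑ xs g
∑-nonneg g []       p = ℤₚ.≤-refl
∑-nonneg g (x ∷ xs) p = ℤₚ.+-mono-≤ (p (here refl)) (∑-nonneg g xs (p ∘ there))

*-nonneg : ∀ a b → 0ℤ ℤ.≤ a → 0ℤ ℤ.≤ b → 0ℤ ℤ.≤ a * b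
*-nonneg (pos k) (pos l) _ _ = subst (0ℤ ℤ.≤_) (ℤₚ.pos-* k l) (ℤ.+≤+ ℕ.z≤n)

per-nonneg : (M : Row → Col → ℤ) → (∀ f w → 0ℤ ℤ.≤ M f w) → ∀ fs ws → 0ℤ ℤ.≤ per M fs ws
per-nonneg M M≥0 []      []       = ℤ.+≤+ ℕ.z≤n
per-nonneg M M≥0 (_ ∷ _) []       = ℤₚ.≤-refl
per-nonneg M M≥0 fs      (w ∷ ws) = subst (0ℤ ℤ.≤_) (sym (per-∷ M fs w ws))
  (∑-nonneg _ (picks fs) (λ {(f , r)} _ → *-nonneg (M f w) (per M r ws) (M≥0 f w) (per-nonneg M M≥0 r ws)))

-- The identity matching contributes 1 and no other matching is negative, so equal rows do no harm,
-- as they would in a determinant.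
per-diagonal : (M : Elem → Elem → ℤ) → (∀ f w → 0ℤ ℤ.≤ M f w) → (∀ x → M x x ≡ 1ℤ) → ∀ xs → 1ℤ ℤ.≤ per M xs xs
per-diagonal M M≥0 diag []       = ℤₚ.≤-refl
per-diagonal M M≥0 diag (x ∷ xs) = ℤₚ.+-mono-≤
  (subst (1ℤ ℤ.≤_) (≡-trans (sym (ℤₚ.*-identityˡ (per M xs xs))) (cong (_* per M xs xs) (sym (diag x)))) (per-diagonal M M≥0 diag xs))
  (∑-nonneg _ (map (map₂ (x ∷_)) (picks xs)) (λ {(f , r)} _ → *-nonneg (M f x) (per M r xs) (M≥0 f x) (per-nonneg M M≥0 r xs)))

nonzero-* : ∀ a b → a ≢ 0ℤ → b ≢ 0ℤ → a * b ≢ 0ℤ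
nonzero-* a b a≢0 b≢0 eq = [ a≢0 , b≢0 ]′ (ℤₚ.i*j≡0⇒i≡0∨j≡0 a eq)

-- Every row contributes its own factor. Applied with s = ± 1 to bring the forms into the
-- orientation of the edge list.
per-scale : (M : Row → Col → ℤ) (h : Row → Row) (s : Row → ℤ) → (∀ f w → M (h f) w ≡ s f * M f w) → (∀ f → s f ≢ 0ℤ) →
            ∀ fs ws → per M fs ws ≢ 0ℤ → per M (map h fs) ws ≢ 0ℤ
per-scale {Row = Row} M h s eq s≢0 fs ws ≢0 z = nonzero-* (∏ fs) (per M fs ws) (∏≢0 fs) ≢0 (≡-trans (sym (go fs ws)) (≡-trans (sym (per-mapˡ M h fs ws)) z))
  where
  ∏ : List Row → ℤ
  ∏ []       = 1ℤ
  ∏ (f ∷ fs) = s f * ∏ fs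
  ∏≢0 : ∀ fs → ∏ fs ≢ 0ℤ
  ∏≢0 []       ()
  ∏≢0 (f ∷ fs) = nonzero-* (s f) (∏ fs) (s≢0 f) (∏≢0 fs)
  lemma : ∀ s m p c → (s * m) * (p * c) ≡ (s * p) * (m * c)
  lemma = solve-∀
  go : ∀ fs ws → per (M ∘ h) fs ws ≡ ∏ fs * per M fs ws
  go []       []       = refl
  go []       (w ∷ ws) = refl
  go (f ∷ fs) ws = ≡-trans (per-expandˡ (M ∘ h) f fs ws)
    (≡-trans (∑-cong (picks ws) (λ (w , r) → ≡-trans (cong₂ _*_ (eq f w) (go fs r)) (lemma (s f) (M f w) (∏ fs) (per M fs r))))
    (≡-trans (∑-* (s f * ∏ fs) (λ (w , r) → M f w * per M fs r) (picks ws))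
             (cong (s f * ∏ fs *_) (sym (per-expandˡ M f fs ws)))))

-- Depth-first forests, in first-child/next-sibling form

data Forest (A : Set) : Set where
  ∅    : Forest A
  node : A → Forest A → Forest A → Forest A

verts : ∀ {A} → Forest A → List A
verts ∅            = []
verts (node v c s) = v ∷ verts c ++ verts s

module Search {n : ℕ} (G : Graph n) where
  open Graph G renaming (sym to ~-sym; irrefl to ~-irrefl)

  private V = Fin n

  infix 4 _∈?_
  _∈?_ : (v : V) (xs : List V) → Dec (v ∈ xs)
  v ∈? xs = any? (v Finₚ.≟_) xs

  -- Below a nonempty path a new vertex has to be adjacent to its nearest vertex, the head; at the
  -- empty path any vertex may start a new tree.
  Attached : List V → V → Set
  Attached []      v = ⊤
  Attached (z ∷ _) v = z ~ v

  attached? : ∀ p v → Dec (Attached p v)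
  attached? []      v = yes tt
  attached? (z ∷ _) v = z ~? v

  -- The middle clause is the depth-first property: an edge at v leads to an ancestor or into the
  -- subtree of v.
  Normal : List V → Forest V → Set
  Normal p ∅            = ⊤
  Normal p (node v c s) = Attached p v × (∀ {w} → v ~ w → w ∈ p ⊎ w ∈ verts c) × Normal (v ∷ p) c × Normal p s

  -- R is what the search leaves unvisited. Later siblings are found inside R, so `closed` is what
  -- excludes edges between different branches.
  record Explored (p S : List V) : Set where
    field
      f      : Forest V
      R      : List V
      perm   : S ↭ verts f ++ R
      closed : ∀ {a b} → a ∈ verts f → b ∈ R → ¬ a ~ b
      done   : ∀ {b} → b ∈ R → ¬ Attached p b
      normal : Normal p f

  -- Every neighbour of an unvisited vertex is unvisited or on the current path.
  Frontier : List V → List V → Set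
  Frontier p S = ∀ {a w} → a ∈ S → a ~ w → w ∈ p ⊎ w ∈ S

  -- The subtree of v is explored first, with v on the path; then the search resumes at the old path
  -- with whatever that subtree has left over. `k` bounds the number of unvisited vertices.
  explore : (k : ℕ) (p S : List V) → length S ℕ.≤ k → Frontier p S → Explored p S
  explore k p S len fr with any? (attached? p) S
  explore k p S len fr | no none = record { f = ∅ ; R = S ; perm = ↭-refl ; closed = λ () ; done = λ b∈ at → none (lose b∈ at) ; normal = tt }
  explore zero p [] len fr | yes ()
  explore (suc k) p S len fr | yes some with find some
  ... | v , v∈S , at with ∈-∃++ v∈S
  ... | xs , ys , refl = record
    { f = node v C.f D.f ; R = D.R
    ; perm = ↭-trans perm₀ (prep v (↭-trans C.perm (↭-trans (++⁺ˡ (verts C.f) D.perm) (↭-sym (++-assoc (verts C.f) (verts D.f) D.R)))))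
    ; closed = closed′ ; done = D.done
    ; normal = at , nbrs , C.normal , D.normal }
    where
    S₁ = xs ++ ys
    perm₀ : xs ++ v ∷ ys ↭ v ∷ S₁
    perm₀ = shift v xs ys
    len₁ : length S₁ ℕ.≤ k
    len₁ = ℕₚ.≤-pred (ℕₚ.≤-trans (ℕₚ.≤-reflexive (sym (↭-length perm₀))) len)
    fr₁ : Frontier (v ∷ p) S₁
    fr₁ a∈ a~w with fr (∈-resp-↭ (↭-sym perm₀) (there a∈)) a~w
    ... | inj₁ q = inj₁ (there q)
    ... | inj₂ q with ∈-resp-↭ perm₀ q
    ... | here eq = inj₁ (here eq)
    ... | there q = inj₂ q
    module C = Explored (explore k (v ∷ p) S₁ len₁ fr₁)
    R⊆ : ∀ {a} → a ∈ C.R → a ∈ xs ++ v ∷ ys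
    R⊆ a∈ = ∈-resp-↭ (↭-sym perm₀) (there (∈-resp-↭ (↭-sym C.perm) (∈-++⁺ʳ (verts C.f) a∈)))
    S-cases : ∀ {w} → w ∈ xs ++ v ∷ ys → w ≡ v ⊎ w ∈ verts C.f ⊎ w ∈ C.R
    S-cases q with ∈-resp-↭ perm₀ q
    ... | here eq = inj₁ eq
    ... | there q = inj₂ (∈-++⁻ (verts C.f) (∈-resp-↭ C.perm q))
    fr₂ : Frontier p C.R
    fr₂ a∈ a~w with fr (R⊆ a∈) a~w
    ... | inj₁ q = inj₁ q
    ... | inj₂ q with S-cases q
    ... | inj₁ refl     = contradiction (~-sym a~w) (C.done a∈)
    ... | inj₂ (inj₁ q) = contradiction (~-sym a~w) (C.closed q a∈)
    ... | inj₂ (inj₂ q) = inj₂ q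
    len₂ : length C.R ℕ.≤ k
    len₂ = ℕₚ.≤-trans (ℕₚ.≤-trans (ℕₚ.m≤n+m _ (length (verts C.f))) (ℕₚ.≤-reflexive (≡-trans (sym (Listₚ.length-++ (verts C.f))) (sym (↭-length C.perm))))) len₁
    module D = Explored (explore k p C.R len₂ fr₂)
    D⊆ : ∀ {b} → b ∈ D.R → b ∈ C.R
    D⊆ b∈ = ∈-resp-↭ (↭-sym D.perm) (∈-++⁺ʳ (verts D.f) b∈)
    closed′ : ∀ {a b} → a ∈ v ∷ verts C.f ++ verts D.f → b ∈ D.R → ¬ a ~ b
    closed′ (here refl) b∈ = C.done (D⊆ b∈)
    closed′ (there a∈)  b∈ with ∈-++⁻ (verts C.f) a∈
    ... | inj₁ q = C.closed q (D⊆ b∈)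
    ... | inj₂ q = D.closed q b∈
    nbrs : ∀ {w} → v ~ w → w ∈ p ⊎ w ∈ verts C.f
    nbrs v~w with fr v∈S v~w
    ... | inj₁ q = inj₁ q
    ... | inj₂ q with S-cases q
    ... | inj₁ refl     = contradiction v~w (~-irrefl refl)
    ... | inj₂ (inj₁ q) = inj₂ q
    ... | inj₂ (inj₂ q) = contradiction v~w (C.done q)

  module _ (inI : V → Bool) (dep : V → ℕ) where

    -- As every edge joins an ancestor to a descendant, the first condition on `inI` already makes I
    -- independent. The second one puts a neighbour in I below every vertex of J.
    Good : List V → Forest V → Set
    Good p ∅            = ⊤
    Good p (node v c s) = Attached p v
      × (∀ {w} → v ~ w → w ∈ p ⊎ w ∈ verts c)
      × (inI v ≡ true → ∀ {w} → w ∈ verts c → v ~ w → inI w ≡ false)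
      × (inI v ≡ false → ∃[ w ] (w ∈ verts c × v ~ w × inI w ≡ true))
      × dep v ≡ length p
      × Good (v ∷ p) c × Good p s

  Good-cong : ∀ {h h′ d d′} p f → (∀ {v} → v ∈ verts f → h v ≡ h′ v) → (∀ {v} → v ∈ verts f → d v ≡ d′ v) → Good h d p f → Good h′ d′ p f
  Good-cong p ∅ _ _ _ = tt
  Good-cong p (node v c s) eh ed (at , nb , kt , kf , dv , gc , gs) =
    at , nb
    , (λ ht w∈ v~w → ≡-trans (sym (eh (in-c w∈))) (kt (≡-trans (eh (here refl)) ht) w∈ v~w))
    , (λ hf → let w , w∈ , v~w , hw = kf (≡-trans (eh (here refl)) hf) in w , w∈ , v~w , ≡-trans (sym (eh (in-c w∈))) hw)
    , ≡-trans (sym (ed (here refl))) dv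
    , Good-cong (v ∷ p) c (eh ∘ in-c) (ed ∘ in-c) gc
    , Good-cong p s (eh ∘ there ∘ ∈-++⁺ʳ (verts c)) (ed ∘ there ∘ ∈-++⁺ʳ (verts c)) gs
    where
    in-c : ∀ {w} → w ∈ verts c → w ∈ v ∷ verts c ++ verts s
    in-c = there ∘ ∈-++⁺ˡ

  -- The greedy rule: v enters I unless a neighbour in its subtree already has. The labels of
  -- children and siblings arrive as separate functions and are glued along membership.
  label : ∀ p f → Unique (verts f) → Normal p f → ∃[ h ] ∃[ d ] Good h d p f
  label p ∅ _ _ = (λ _ → false) , (λ _ → 0) , tt
  label p (node v c s) (v∉ ∷ uniq) (at , nb , nc , ns)
    with label (v ∷ p) c (AllPairs-++ˡ (verts c) uniq) nc | label p s (AllPairs-++ʳ (verts c) uniq) ns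
  ... | hc , dc , gc | hs , ds , gs = h , d
      , at , nb , kt , kf , d-v
      , Good-cong (v ∷ p) c (λ w∈ → sym (h-c w∈)) (λ w∈ → sym (d-c w∈)) gc
      , Good-cong p s (λ w∈ → sym (h-s w∈)) (λ w∈ → sym (d-s w∈)) gs
    where
    blocked? = any? (λ w → (v ~? w) ×-dec (hc w ≟ᵇ true)) (verts c)
    glue : {B : Set} → B → (V → B) → (V → B) → V → B
    glue b x y w with w Finₚ.≟ v
    ... | yes _ = b
    ... | no _ with w ∈? verts c
    ... | yes _ = x w
    ... | no _  = y w
    glue-v : {B : Set} (b : B) (x y : V → B) → glue b x y v ≡ b
    glue-v b x y with v Finₚ.≟ v
    ... | yes _ = refl
    ... | no ≢v = contradiction refl ≢v
    glue-c : {B : Set} (b : B) (x y : V → B) → ∀ {w} → w ∈ verts c → glue b x y w ≡ x w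
    glue-c b x y {w} w∈ with w Finₚ.≟ v
    ... | yes refl = contradiction refl (All.lookup v∉ (∈-++⁺ˡ w∈))
    ... | no _ with w ∈? verts c
    ... | yes _ = refl
    ... | no ∉c = contradiction w∈ ∉c
    glue-s : {B : Set} (b : B) (x y : V → B) → ∀ {w} → w ∈ verts s → glue b x y w ≡ y w
    glue-s b x y {w} w∈ with w Finₚ.≟ v
    ... | yes refl = contradiction refl (All.lookup v∉ (∈-++⁺ʳ (verts c) w∈))
    ... | no _ with w ∈? verts c
    ... | no _   = refl
    ... | yes ∈c = contradiction refl (AllPairs-cross (verts c) uniq ∈c w∈)
    h = glue (not (does blocked?)) hc hs
    d = glue (length p) dc ds
    h-v : h v ≡ not (does blocked?)
    h-v = glue-v _ hc hs
    d-v : d v ≡ length p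
    d-v = glue-v _ dc ds
    h-c : ∀ {w} → w ∈ verts c → h w ≡ hc w
    h-c = glue-c _ hc hs
    d-c : ∀ {w} → w ∈ verts c → d w ≡ dc w
    d-c = glue-c _ dc ds
    h-s : ∀ {w} → w ∈ verts s → h w ≡ hs w
    h-s = glue-s _ hc hs
    d-s : ∀ {w} → w ∈ verts s → d w ≡ ds w
    d-s = glue-s _ dc ds
    kt : h v ≡ true → ∀ {w} → w ∈ verts c → v ~ w → h w ≡ false
    kt hv {w} w∈ v~w with hc w in eq
    ... | true  = contradiction (lose w∈ (v~w , eq)) (refuted blocked? (≡-trans (sym h-v) hv))
      where
      refuted : ∀ {P : Set} (q : Dec P) → not (does q) ≡ true → ¬ P
      refuted (no ¬p) _ = ¬p
    ... | false = ≡-trans (h-c w∈) eq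
    kf : h v ≡ false → ∃[ w ] (w ∈ verts c × v ~ w × h w ≡ true)
    kf hv = let w , w∈ , v~w , hw = find (confirmed blocked? (≡-trans (sym h-v) hv)) in w , w∈ , v~w , ≡-trans (h-c w∈) hw
      where
      confirmed : ∀ {P : Set} (q : Dec P) → not (does q) ≡ false → P
      confirmed (yes p) _ = p

  searchForest : ∃[ f ] (verts f ↭ allFin n × (∃[ h ] ∃[ d ] Good h d [] f))
  searchForest with explore (length (allFin n)) [] (allFin n) ℕₚ.≤-refl (λ _ _ → inj₂ (∈-allFin _))
  ... | record { f = f ; R = [] ; perm = perm ; normal = normal } = f , perm′ , label [] f (AllPairs-↭ (_∘ sym) (↭-sym perm′) (Uniqueₚ.allFin⁺ n)) normal
    where
    perm′ : verts f ↭ allFin n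
    perm′ = ↭-sym (subst (allFin n ↭_) (Listₚ.++-identityʳ (verts f)) perm)
  -- At the empty path every vertex counts as attached, so nothing can be left over.
  ... | record { R = _ ∷ _ ; done = done } = contradiction tt (done (here refl))

-- Parity and counting

data Even : ℕ → Set where
  zero : Even 0
  suc₂ : ∀ {k} → Even k → Even (suc (suc k))

parity : ∀ k → Even k ⊎ Even (suc k)
parity zero          = inj₁ zero
parity (suc zero)    = inj₂ (suc₂ zero)
parity (suc (suc k)) = [ inj₁ ∘ suc₂ , inj₂ ∘ suc₂ ]′ (parity k)

suc₂⁻¹ : ∀ {k} → Even (suc (suc k)) → Even k
suc₂⁻¹ (suc₂ e) = e

count : {n : ℕ} → Fin n → List (Fin n) → ℕ
count w = tot λ x → ι (x Finₚ.≟ w)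

count-∉ : {n : ℕ} {w : Fin n} (xs : List (Fin n)) → w ∉ xs → count w xs ≡ 0
count-∉ []       w∉ = refl
count-∉ {w = w} (x ∷ xs) w∉ = cong₂ ℕ._+_ (ι-no (x Finₚ.≟ w) (λ eq → w∉ (here (sym eq)))) (count-∉ xs (w∉ ∘ there))

count-unique : {n : ℕ} (w : Fin n) {xs : List (Fin n)} → Unique xs → count w xs ℕ.≤ 1
count-unique w [] = z≤n
count-unique w {x ∷ xs} (x∉ ∷ u) with x Finₚ.≟ w
... | yes refl = ℕₚ.≤-reflexive (cong suc (count-∉ xs (λ w∈ → All.lookup x∉ w∈ refl)))
... | no _     = count-unique w u

unique-map : {A B : Set} (g : A → B) {xs : List A} → (∀ {x y} → x ∈ xs → y ∈ xs → g x ≡ g y → x ≡ y) → Unique xs → Unique (map g xs)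
unique-map g inj []       = []
unique-map g inj (x∉ ∷ u) = Allₚ.map⁺ (All.tabulate (λ y∈ eq → All.lookup x∉ y∈ (inj (here refl) (there y∈) eq)))
  ∷ unique-map g (λ x∈ y∈ → inj (there x∈) (there y∈)) u

unique-lookup : {A : Set} {xs : List A} → Unique xs → ∀ i k → lookup xs i ≡ lookup xs k → i ≡ k
unique-lookup (_ ∷ _)  zero    zero    _  = refl
unique-lookup (x∉ ∷ _) zero    (suc k) eq = contradiction eq (All.lookup x∉ (∈-lookup k))
unique-lookup (x∉ ∷ _) (suc i) zero    eq = contradiction (sym eq) (All.lookup x∉ (∈-lookup i))
unique-lookup (_ ∷ u)  (suc i) (suc k) eq = cong suc (unique-lookup u i k eq)

unique-singleton : {A : Set} {x : A} {xs : List A} → Unique xs → x ∈ xs → (∀ {y} → y ∈ xs → y ≡ x) → length xs ≡ 1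
unique-singleton u x∈ all = ↭-length (unique-↭ u ([] ∷ []) (λ y∈ → here (all y∈)) (λ { (here refl) → x∈ }))

-- The edge list and isolated edges

module Edges {n : ℕ} (G : Graph n) where
  open Graph G renaming (sym to ~-sym; irrefl to ~-irrefl)
  open Reduction G

  edges-unique : Unique edges
  edges-unique = Uniqueₚ.filter⁺ (λ (i , j) → (i Finₚ.<? j) ×-dec (i ~? j)) (Uniqueₚ.cartesianProduct⁺ (Uniqueₚ.allFin⁺ n) (Uniqueₚ.allFin⁺ n))

  isolated : ∀ f → (∀ {w} → lo f ~ w → w ≡ hi f) → (∀ {w} → hi f ~ w → w ≡ lo f) → IsolatedEdge f
  isolated f at-lo at-hi = degree≡1 (lo f) (inj₁ refl) only-lo , degree≡1 (hi f) (inj₂ refl) only-hi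
    where
    Incident : V → Edge → Set
    Incident i e = i ≡ lo e ⊎ i ≡ hi e
    degree≡1 : ∀ i → Incident i f → (∀ g → Incident i g → g ≡ f) → degree i ≡ 1
    degree≡1 i at only = unique-singleton (Uniqueₚ.filter⁺ P? (Uniqueₚ.allFin⁺ ∣E∣)) (∈-filter⁺ P? (∈-allFin f) at) (λ {g} q → only g (proj₂ (∈-filter⁻ P? {xs = allFin ∣E∣} q)))
      where P? = λ e → (i Finₚ.≟ lo e) ⊎-dec (i Finₚ.≟ hi e)
    equal : ∀ g → lo g ≡ lo f → hi g ≡ hi f → g ≡ f
    equal g lo≡ hi≡ = unique-lookup edges-unique g f (cong₂ _,_ lo≡ hi≡)
    reversed : ∀ g → lo g ≡ hi f → ¬ hi g ≡ lo f
    reversed g lo≡ hi≡ = Finₚ.<-asym (proj₁ (lo~hi f)) (subst₂ _<_ lo≡ hi≡ (proj₁ (lo~hi g)))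
    only-lo : ∀ g → Incident (lo f) g → g ≡ f
    only-lo g (inj₁ eq) = equal g (sym eq) (at-lo (subst (_~ hi g) (sym eq) (proj₂ (lo~hi g))))
    only-lo g (inj₂ eq) = contradiction (sym eq) (reversed g (at-lo (subst (_~ lo g) (sym eq) (~-sym (proj₂ (lo~hi g))))))
    only-hi : ∀ g → Incident (hi f) g → g ≡ f
    only-hi g (inj₁ eq) = contradiction (at-hi (subst (_~ hi g) (sym eq) (proj₂ (lo~hi g)))) (reversed g (sym eq))
    only-hi g (inj₂ eq) = equal g (at-hi (subst (_~ lo g) (sym eq) (~-sym (proj₂ (lo~hi g))))) (sym eq)

  -- Niceness in terms of adjacency alone, free of degrees and edge positions.
  no-isolated : Nice → ∀ {a b} → a ~ b → (∀ {w} → a ~ w → w ≡ b) → (∀ {w} → b ~ w → w ≡ a) → ⊥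
  no-isolated nice a~b at-a at-b with edge-of a~b
  ... | f , inj₁ (refl , refl) = nice f (isolated f at-a at-b)
  ... | f , inj₂ (refl , refl) = nice f (isolated f at-b at-a)

-- Directions for the I-J forms and the J-J forms

module Construction {n : ℕ} (G : Graph n) (inI : Fin n → Bool) (dep : Fin n → ℕ) where
  open Graph G using (_~_; _~?_; edges; lo; hi; Nice; Algebraic⟨1,_⟩-choosable) renaming (sym to ~-sym; irrefl to ~-irrefl)
  open Reduction G
  open Edges G
  open Search G

  J⇒≢I : ∀ {i j} → inI i ≡ true → inI j ≡ false → i ≢ j
  J⇒≢I p q refl = case ≡-trans (sym p) q of λ ()

  -- As β is ± 1, `≢0` excludes only the case o₁ = o₂ with β = -1, in which the direction would have
  -- no effect.
  record Span (o₁ o₂ : V) : Set where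
    field
      {β} : ℤ
      dir : Direction
      adj : All Adjacent dir
      β²  : β * β ≡ 1ℤ
      ≢0  : 1ℤ * point o₁ + β * point o₂ ≢ 0ℤ
      vec≡ : ∀ v → vec dir v ≡ δ o₁ v + β * δ o₂ v
      I₁  : inI o₁ ≡ true
      I₂  : inI o₂ ≡ true

    binom : Binomial n
    binom = binomial {α = 1ℤ} {β = β} o₁ o₂ refl β² ≢0

    vec-value : ∀ v → vec dir v ≡ value (Binomial.linear binom) v
    vec-value v = ≡-trans (vec≡ v) (lemma (δ o₁ v) (β * δ o₂ v))
      where
      lemma : ∀ a b → a + b ≡ 1ℤ * a + (b + 0ℤ)
      lemma = solve-∀

    vec-support : ∀ v → v ≢ o₁ → v ≢ o₂ → vec dir v ≡ 0ℤ
    vec-support v ≢₁ ≢₂ = ≡-trans (vec≡ v) (≡-trans (cong₂ (λ s t → s + β * t) (χ-no (o₁ Finₚ.≟ v) (≢₁ ∘ sym)) (χ-no (o₂ Finₚ.≟ v) (≢₂ ∘ sym)))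
      (≡-trans (ℤₚ.+-identityˡ (β * 0ℤ)) (ℤₚ.*-zeroʳ β)))

    vec-J : ∀ {v} → inI v ≡ false → vec dir v ≡ 0ℤ
    vec-J {v} Jv = vec-support v (λ { refl → J⇒≢I I₁ Jv refl }) (λ { refl → J⇒≢I I₂ Jv refl })

  -- The direction of a square is used twice and covers two tokens.
  record Square : Set where
    constructor square
    field
      o₁ j₁ o₂ j₂ : V
      span : Span o₁ o₂
    open Span span public

    tokens : List (V × V)
    tokens = (o₁ , j₁) ∷ (o₂ , j₂) ∷ []

  -- Only the token at o₁ is covered; o₂ merely receives the other end of the walk.
  record Single : Set where
    constructor single′
    field
      o₁ j₁ o₂ : V
      span : Span o₁ o₂
    open Span span public

  open Square using (tokens)

  -- One tree of the forest. Its directions are supported on `region` and its tokens originate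
  -- there, so disjoint regions give independent blocks; `Φ-squares-single` allows one extra
  -- direction in each block.
  record Component : Set where
    field
      squares  : List Square
      extra    : Maybe Single
      region   : List V
      squares⊆ : All (λ s → Square.o₁ s ∈ region × Square.o₂ s ∈ region) squares
      extra⊆   : ∀ {s} → extra ≡ just s → Single.o₁ s ∈ region × Single.o₂ s ∈ region

    squareDirs : List Direction
    squareDirs = map Square.dir squares

    allTokens : List (V × V)
    allTokens with extra
    ... | nothing = concatMap tokens squares
    ... | just s  = (Single.o₁ s , Single.j₁ s) ∷ concatMap tokens squares

    allDirs : List Direction
    allDirs with extra
    ... | nothing = squareDirs ++ squareDirs
    ... | just s  = Single.dir s ∷ squareDirs ++ squareDirs

  open Component

  formᵈ : V × V → Direction → ℤ
  formᵈ ab d = form ab (vec d)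

  -- The directions now play the linear forms in the variables y, and the origins of the tokens play
  -- the variables. Hence the matrix is transposed before `per-Φ` is applied.
  per-spans : (ts : List (V × V)) (zs : List (∃[ o₁ ] ∃[ o₂ ] Span o₁ o₂)) → All (λ t → inI (proj₂ t) ≡ false) ts →
              Φ (map (λ (_ , _ , s) → Binomial.linear (Span.binom s)) zs) (cnt (map proj₁ ts)) ≢ 0ℤ →
              per formᵈ ts (map (λ (_ , _ , s) → Span.dir s) zs) ≢ 0ℤ
  per-spans ts zs Jts Φ≢0 eq = per-Φ≢0 (map proj₁ ts) (map f zs) Φ≢0
    (≡-trans (per-transpose value (map f zs) (map proj₁ ts))
    (≡-trans (per-mapˡ (flip value) proj₁ ts (map f zs))
    (≡-trans (per-mapʳ (flip value ∘ proj₁) f ts zs)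
    (≡-trans (per-cong ts zs (λ {t} {z} t∈ _ → sym (entry t z (All.lookup Jts t∈))))
    (≡-trans (sym (per-mapʳ formᵈ (λ (_ , _ , s) → Span.dir s) ts zs)) eq)))))
    where
    f = λ ((_ , _ , s) : ∃[ o₁ ] ∃[ o₂ ] Span o₁ o₂) → Binomial.linear (Span.binom s)
    entry : ∀ t z → inI (proj₂ t) ≡ false → formᵈ t (Span.dir (proj₂ (proj₂ z))) ≡ value (f z) (proj₁ t)
    entry (o , j) (_ , _ , s) Jj = ≡-trans (cong (λ v → vec (Span.dir s) o - v) (Span.vec-J s Jj))
      (≡-trans (ℤₚ.+-identityʳ (vec (Span.dir s) o)) (Span.vec-value s o))

  squareSpans : List Square → List (∃[ o₁ ] ∃[ o₂ ] Span o₁ o₂)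
  squareSpans = map λ s → Square.o₁ s , Square.o₂ s , Square.span s

  linears : List (∃[ o₁ ] ∃[ o₂ ] Span o₁ o₂) → List (Linear n)
  linears = map λ (_ , _ , s) → Binomial.linear (Span.binom s)

  module Doubled (ss : List Square) where
    private
      zs = squareSpans ss
      bs = map (λ (_ , _ , s) → Span.binom s) zs

    squares-dirs : map (λ (_ , _ , s) → Span.dir s) (zs ++ zs) ≡ map Square.dir ss ++ map Square.dir ss
    squares-dirs = ≡-trans (Listₚ.map-++ _ zs zs) (cong₂ _++_ (sym (Listₚ.map-∘ ss)) (sym (Listₚ.map-∘ ss)))

    squares-linear : map Binomial.linear (bs ++ bs) ≡ linears (zs ++ zs)
    squares-linear = ≡-trans (cong (map Binomial.linear) (sym (Listₚ.map-++ _ zs zs))) (sym (Listₚ.map-∘ (zs ++ zs)))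

  squares-ends : ∀ ss → ends (map (λ (_ , _ , s) → Span.binom s) (squareSpans ss)) ≡ map proj₁ (concatMap tokens ss)
  squares-ends []       = refl
  squares-ends (s ∷ ss) = cong (λ l → Square.o₁ s ∷ Square.o₂ s ∷ l) (squares-ends ss)

  per-component : (c : Component) → All (λ t → inI (proj₂ t) ≡ false) (allTokens c) → per formᵈ (allTokens c) (allDirs c) ≢ 0ℤ
  per-component c Jts with extra c
  ... | nothing = λ eq → per-spans (concatMap tokens (squares c)) (zs ++ zs) Jts
      (λ z → Φ-squares bs (≡-trans (cong₂ Φ (Doubled.squares-linear (squares c)) (cong cnt (squares-ends (squares c)))) z))
      (≡-trans (cong (per formᵈ (concatMap tokens (squares c))) (Doubled.squares-dirs (squares c))) eq)
    where
    zs = squareSpans (squares c)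
    bs = map (λ (_ , _ , s) → Span.binom s) zs
  ... | just e = λ eq → per-spans ts ((_ , _ , Single.span e) ∷ zs ++ zs) Jts
      (λ z → Φ-squares-single (Single.binom e) bs (≡-trans (cong₂ Φ (cong (Binomial.linear (Single.binom e) ∷_) (Doubled.squares-linear (squares c)))
        (cong (cnt ∘ (Single.o₁ e ∷_)) (squares-ends (squares c)))) z))
      (≡-trans (cong (λ ds → per formᵈ ts (Single.dir e ∷ ds)) (Doubled.squares-dirs (squares c))) eq)
    where
    ts = (Single.o₁ e , Single.j₁ e) ∷ concatMap tokens (squares c)
    zs = squareSpans (squares c)
    bs = map (λ (_ , _ , s) → Span.binom s) zs

  span-vanishes : ∀ {o₁ o₂} (s : Span o₁ o₂) {o j} → inI j ≡ false → o ≢ o₁ → o ≢ o₂ → formᵈ (o , j) (Span.dir s) ≡ 0ℤ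
  span-vanishes s Jj ≢₁ ≢₂ = cong₂ _-_ (Span.vec-support s _ ≢₁ ≢₂) (Span.vec-J s Jj)

  ∈-squareDirs : ∀ (c : Component) {d} → d ∈ squareDirs c ++ squareDirs c →
                 ∃[ o₁ ] ∃[ o₂ ] Σ[ s ∈ Span o₁ o₂ ] (d ≡ Span.dir s × o₁ ∈ region c × o₂ ∈ region c)
  ∈-squareDirs c {d} d∈ with ∈-map⁻ Square.dir {xs = squares c} ([ id , id ]′ (∈-++⁻ (squareDirs c) d∈))
  ... | s , s∈ , refl = _ , _ , Square.span s , refl , All.lookup (squares⊆ c) s∈

  ∈-allDirs : ∀ (c : Component) {d} → d ∈ allDirs c →
              ∃[ o₁ ] ∃[ o₂ ] Σ[ s ∈ Span o₁ o₂ ] (d ≡ Span.dir s × o₁ ∈ region c × o₂ ∈ region c)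
  ∈-allDirs c d∈ with extra c | extra⊆ c
  ... | nothing | _ = ∈-squareDirs c d∈
  ∈-allDirs c (here refl) | just e | e⊆ = _ , _ , Single.span e , refl , e⊆ refl
  ∈-allDirs c (there d∈)  | just e | _  = ∈-squareDirs c d∈

  ∈-squareTokens : ∀ (c : Component) {t} → t ∈ concatMap tokens (squares c) → proj₁ t ∈ region c
  ∈-squareTokens c = go (squares c) (squares⊆ c)
    where
    go : ∀ ss → All (λ s → Square.o₁ s ∈ region c × Square.o₂ s ∈ region c) ss → ∀ {t} → t ∈ concatMap tokens ss → proj₁ t ∈ region c
    go (s ∷ ss) (p ∷ ps) (here refl)         = proj₁ p
    go (s ∷ ss) (p ∷ ps) (there (here refl)) = proj₂ p
    go (s ∷ ss) (p ∷ ps) (there (there t∈))  = go ss ps t∈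

  ∈-allTokens : ∀ (c : Component) {t} → t ∈ allTokens c → proj₁ t ∈ region c
  ∈-allTokens c t∈ with extra c | extra⊆ c
  ... | nothing | _ = ∈-squareTokens c t∈
  ∈-allTokens c (here refl) | just e | e⊆ = proj₁ (e⊆ refl)
  ∈-allTokens c (there t∈)  | just e | _  = ∈-squareTokens c t∈

  Disjoint : Component → Component → Set
  Disjoint c c′ = ∀ {v} → v ∈ region c → v ∉ region c′

  per-components : (cs : List Component) → AllPairs Disjoint cs → All (λ t → inI (proj₂ t) ≡ false) (concatMap allTokens cs) →
                   per formᵈ (concatMap allTokens cs) (concatMap allDirs cs) ≢ 0ℤ
  per-components []       _          _   = λ ()
  per-components (c ∷ cs) (d ∷ dis) Jts = λ eq → nonzero-* _ _ here≢0 (per-components cs dis (Allₚ.++⁻ʳ (allTokens c) Jts))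
      (≡-trans (sym (per-block formᵈ (allTokens c) (concatMap allTokens cs) (allDirs c) (concatMap allDirs cs)
        (per-length formᵈ (allTokens c) (allDirs c) here≢0) vanish)) eq)
    where
    here≢0 = per-component c (Allₚ.++⁻ˡ (allTokens c) Jts)
    later : ∀ cs → All (Disjoint c) cs → ∀ {t} → t ∈ concatMap allTokens cs → proj₁ t ∉ region c
    later (c′ ∷ cs) (d ∷ ds) t∈ r∈ with ∈-++⁻ (allTokens c′) t∈
    ... | inj₁ q = d r∈ (∈-allTokens c′ q)
    ... | inj₂ q = later cs ds q r∈
    vanish : ∀ {t w} → t ∈ concatMap allTokens cs → w ∈ allDirs c → formᵈ t w ≡ 0ℤ
    vanish t∈ w∈ with ∈-allDirs c w∈
    ... | _ , _ , s , refl , ∈₁ , ∈₂ = span-vanishes s (All.lookup (Allₚ.++⁻ʳ (allTokens c) Jts) t∈)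
      (λ { refl → later cs d t∈ ∈₁ }) (λ { refl → later cs d t∈ ∈₂ })

  -- Covers the form y_a − y_d with a and d in J; triangular with respect to the depth of a.
  record Lower : Set where
    field
      a d   : V
      dir   : Direction
      adj   : All Adjacent dir
      Ja    : inI a ≡ false
      Jd    : inI d ≡ false
      a<d   : dep a ℕ.< dep d
      vec-a : vec dir a ≡ 1ℤ
      vec-0 : ∀ v → v ≢ a → inI v ≡ false → dep a ℕ.≤ dep v → vec dir v ≡ 0ℤ

    ad : V × V
    ad = a , d

  -- Induction on the depth k of the upper vertex. A form whose upper vertex is deeper has both ends
  -- deeper than k and vanishes on the directions of depth k. On depth k itself the entries compare
  -- upper vertices: zeros and ones, with ones on the diagonal. N bounds the number of levels left.
  per-lower : (N k : ℕ) (ls : List Lower) → All (λ l → k ℕ.≤ dep (Lower.a l)) ls → All (λ l → dep (Lower.a l) ℕ.< k ℕ.+ N) ls →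
              per formᵈ (map Lower.ad ls) (map Lower.dir ls) ≢ 0ℤ
  per-lower zero k [] _ _ = λ ()
  per-lower zero k (l ∷ ls) (p ∷ _) (q ∷ _) = contradiction (ℕₚ.<-≤-trans q (ℕₚ.≤-trans (ℕₚ.≤-reflexive (ℕₚ.+-identityʳ k)) p)) (ℕₚ.<-irrefl refl)
  per-lower (suc N) k ls low high = λ eq → nonzero-* _ _ now≢0 later≢0
      (≡-trans (sym (per-block formᵈ (map Lower.ad now) (map Lower.ad later) (map Lower.dir now) (map Lower.dir later)
        (≡-trans (Listₚ.length-map Lower.ad now) (sym (Listₚ.length-map Lower.dir now))) vanish))
      (≡-trans (cong₂ (per formᵈ) (sym (Listₚ.map-++ Lower.ad now later)) (sym (Listₚ.map-++ Lower.dir now later)))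
      (≡-trans (per-↭ formᵈ (map Lower.dir (now ++ later)) (map⁺ Lower.ad perm)) (≡-trans (per-↭ʳ formᵈ (map Lower.ad ls) (map⁺ Lower.dir perm)) eq))))
    where
    k? = λ l → dep (Lower.a l) ℕ.≟ k
    now = filter k? ls
    later = filter (¬? ∘ k?) ls
    perm : now ++ later ↭ ls
    perm = filter-↭ k? ls
    later≢0 : per formᵈ (map Lower.ad later) (map Lower.dir later) ≢ 0ℤ
    later≢0 = per-lower N (suc k) later
      (All.zipWith (λ (k≤ , ≢k) → ℕₚ.≤∧≢⇒< k≤ (≢k ∘ sym)) (Allₚ.filter⁺ (¬? ∘ k?) low , Allₚ.all-filter (¬? ∘ k?) ls))
      (All.map (λ q → ℕₚ.<-≤-trans q (ℕₚ.≤-reflexive (ℕₚ.+-suc k N))) (Allₚ.filter⁺ (¬? ∘ k?) high))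
    vanish : ∀ {f w} → f ∈ map Lower.ad later → w ∈ map Lower.dir now → formᵈ f w ≡ 0ℤ
    vanish f∈ w∈ with ∈-map⁻ Lower.ad f∈ | ∈-map⁻ Lower.dir w∈
    ... | l , l∈ , refl | l′ , l′∈ , refl with ∈-filter⁻ (¬? ∘ k?) {xs = ls} l∈ | ∈-filter⁻ k? {xs = ls} l′∈
    ... | l∈ls , ≢k | _ , refl = cong₂ _-_
        (Lower.vec-0 l′ (Lower.a l) (λ { eq → ≢k (cong dep eq) }) (Lower.Ja l) k≤)
        (Lower.vec-0 l′ (Lower.d l) (λ { refl → ℕₚ.<-irrefl refl (ℕₚ.≤-<-trans k≤ (Lower.a<d l)) }) (Lower.Jd l) (ℕₚ.≤-trans k≤ (ℕₚ.<⇒≤ (Lower.a<d l))))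
      where k≤ = All.lookup low l∈ls
    now≢0 : per formᵈ (map Lower.ad now) (map Lower.dir now) ≢ 0ℤ
    now≢0 eq = case subst (1ℤ ℤ.≤_) (≡-trans (sym (per-cong now now entry)) (≡-trans (sym (≡-trans (per-mapˡ formᵈ Lower.ad now (map Lower.dir now))
        (per-mapʳ (formᵈ ∘ Lower.ad) Lower.dir now now))) eq))
        (per-diagonal (λ l l′ → δ (Lower.a l′) (Lower.a l)) (λ l l′ → χ≥0 (Lower.a l′ Finₚ.≟ Lower.a l)) (λ l → χ-yes (Lower.a l Finₚ.≟ Lower.a l) refl) now)
        of λ { (ℤ.+≤+ ()) }
      where
      χ≥0 : ∀ {P : Set} (d : Dec P) → 0ℤ ℤ.≤ χ d
      χ≥0 (yes _) = ℤ.+≤+ ℕ.z≤n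
      χ≥0 (no _)  = ℤ.+≤+ ℕ.z≤n
      entry : ∀ {l l′} → l ∈ now → l′ ∈ now → formᵈ (Lower.ad l) (Lower.dir l′) ≡ δ (Lower.a l′) (Lower.a l)
      entry {l} {l′} l∈ l′∈ with proj₂ (∈-filter⁻ k? {xs = ls} l∈) | proj₂ (∈-filter⁻ k? {xs = ls} l′∈)
      ... | dep≡ | dep≡′ = ≡-trans (cong₂ _-_ (top (Lower.a l′ Finₚ.≟ Lower.a l))
          (Lower.vec-0 l′ (Lower.d l) (λ eq → ℕₚ.<-irrefl (≡-trans dep≡ (≡-trans (sym dep≡′) (cong dep (sym eq)))) (Lower.a<d l)) (Lower.Jd l)
            (ℕₚ.≤-trans (ℕₚ.≤-reflexive (≡-trans dep≡′ (sym dep≡))) (ℕₚ.<⇒≤ (Lower.a<d l)))))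
          (ℤₚ.+-identityʳ (δ (Lower.a l′) (Lower.a l)))
        where
        top : (q : Dec (Lower.a l′ ≡ Lower.a l)) → vec (Lower.dir l′) (Lower.a l) ≡ χ q
        top (yes eq) = ≡-trans (cong (vec (Lower.dir l′)) (sym eq)) (Lower.vec-a l′)
        top (no ≢a)  = Lower.vec-0 l′ (Lower.a l) (≢a ∘ sym) (Lower.Ja l) (ℕₚ.≤-reflexive (≡-trans dep≡′ (sym dep≡)))

  orient : V × V → V × V
  orient (a , b) with a Finₚ.<? b
  ... | yes _ = a , b
  ... | no  _ = b , a

  module _ (cs : List Component) (ls : List Lower) where

    directions : List Direction
    directions = concatMap allDirs cs ++ map Lower.dir ls

    forms : List (V × V)
    forms = concatMap allTokens cs ++ map Lower.ad ls

    maxDep : List Lower → ℕ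
    maxDep []       = 0
    maxDep (l ∷ ls) = suc (dep (Lower.a l)) ℕ.⊔ maxDep ls

    <maxDep : ∀ ls → All (λ l → dep (Lower.a l) ℕ.< maxDep ls) ls
    <maxDep []       = []
    <maxDep (l ∷ ls) = ℕₚ.m≤m⊔n (suc (dep (Lower.a l))) (maxDep ls) ∷ All.map (λ p → ℕₚ.≤-trans p (ℕₚ.m≤n⊔m (suc (dep (Lower.a l))) (maxDep ls))) (<maxDep ls)

    per-forms : AllPairs Disjoint cs → All (λ t → inI (proj₂ t) ≡ false) (concatMap allTokens cs) → per formᵈ forms directions ≢ 0ℤ
    per-forms dis Jts eq = nonzero-* _ _ top≢0 (per-lower (maxDep ls) 0 ls (All.universal (λ _ → ℕ.z≤n) ls) (<maxDep ls))
      (≡-trans (sym (per-block formᵈ (concatMap allTokens cs) (map Lower.ad ls) (concatMap allDirs cs) (map Lower.dir ls)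
        (per-length formᵈ (concatMap allTokens cs) (concatMap allDirs cs) top≢0) vanish)) eq)
      where
      top≢0 = per-components cs dis Jts
      go : ∀ cs {w} → w ∈ concatMap allDirs cs → ∀ l → formᵈ (Lower.ad l) w ≡ 0ℤ
      go (c ∷ cs) w∈ l with ∈-++⁻ (allDirs c) w∈
      ... | inj₂ q = go cs q l
      ... | inj₁ q with ∈-allDirs c q
      ... | _ , _ , s , refl , _ = cong₂ _-_ (Span.vec-J s (Lower.Ja l)) (Span.vec-J s (Lower.Jd l))
      vanish : ∀ {f w} → f ∈ map Lower.ad ls → w ∈ concatMap allDirs cs → formᵈ f w ≡ 0ℤ
      vanish f∈ w∈ with ∈-map⁻ Lower.ad f∈
      ... | l , _ , refl = go cs w∈ l

    assemble : AllPairs Disjoint cs → All (λ t → inI (proj₂ t) ≡ false) (concatMap allTokens cs) →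
               map orient forms ↭ edges → (∀ a b → a ~ b → uses-all a b directions ℕ.≤ 4) → Algebraic⟨1, 5 ⟩-choosable
    assemble dis Jts perm bound = choosable directions adjs
      (λ eq → per-scale formᵈ orient sg orient-sg sg≢0 forms directions (per-forms dis Jts) (≡-trans (per-↭ formᵈ directions perm) eq))
      (λ e → bound (lo e) (hi e) (proj₂ (lo~hi e)))
      where
      sg : V × V → ℤ
      sg (a , b) with a Finₚ.<? b
      ... | yes _ = 1ℤ
      ... | no  _ = -1ℤ
      sg≢0 : ∀ f → sg f ≢ 0ℤ
      sg≢0 (a , b) with a Finₚ.<? b
      ... | yes _ = λ ()
      ... | no  _ = λ ()
      lemma : ∀ a b → b - a ≡ -1ℤ * (a - b)
      lemma = solve-∀
      orient-sg : ∀ f w → formᵈ (orient f) w ≡ sg f * formᵈ f w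
      orient-sg (a , b) w with a Finₚ.<? b
      ... | yes _ = sym (ℤₚ.*-identityˡ (formᵈ (a , b) w))
      ... | no  _ = lemma (vec w a) (vec w b)
      adj-components : ∀ cs → All (All Adjacent) (concatMap allDirs cs)
      adj-components [] = []
      adj-components (c ∷ cs) = Allₚ.++⁺ (All.tabulate (λ q → case ∈-allDirs c q of λ { (_ , _ , s , refl , _) → Span.adj s })) (adj-components cs)
      adjs : All (All Adjacent) directions
      adjs = Allₚ.++⁺ (adj-components cs) (Allₚ.map⁺ (All.tabulate (λ {l} _ → Lower.adj l)))

  -- Tokens carried along walks

  sg : Bool → ℤ
  sg true  = 1ℤ
  sg false = -1ℤ

  sg-not : ∀ b → sg (not b) ≡ - sg b
  sg-not true  = refl
  sg-not false = refl

  sg² : ∀ b → sg b * sg b ≡ 1ℤ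
  sg² true  = refl
  sg² false = refl

  -- `sg (opposite b b′)` is - sg b · sg b′, the coefficient with which two residues cancel.
  opposite : Bool → Bool → Bool
  opposite true  b = not b
  opposite false b = b

  vec-++ : ∀ d d′ v → vec (d ++ d′) v ≡ vec d v + vec d′ v
  vec-++ d d′ v = ∑-++ d d′

  scale : ℤ → Direction → Direction
  scale s = map λ (c , st) → s * c , st

  vec-scale : ∀ s d v → vec (scale s d) v ≡ s * vec d v
  vec-scale s d v = ≡-trans (∑-map (λ (c , st) → s * c , st) d)
    (≡-trans (∑-cong d (λ (c , a , b) → ℤₚ.*-assoc s c (δ a v + δ b v))) (∑-* s (λ (c , a , b) → c * (δ a v + δ b v)) d))

  uses-++ : ∀ a b d d′ → uses a b (d ++ d′) ≡ uses a b d ℕ.+ uses a b d′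
  uses-++ a b d d′ = ≡-trans (cong (tot (same a b)) (Listₚ.map-++ proj₂ d d′)) (tot-++ (same a b) (map proj₂ d) (map proj₂ d′))

  uses-scale : ∀ a b s d → uses a b (scale s d) ≡ uses a b d
  uses-scale a b s d = cong (tot (same a b)) (sym (Listₚ.map-∘ d))

  adj-scale : ∀ s {d} → All Adjacent d → All Adjacent (scale s d)
  adj-scale s = Allₚ.map⁺

  -- The token (o , j) stands for the form y_o − y_j with o ∈ I and j ∈ J, which acts on directions supported on I
  -- as the coordinate o. An item is a token moved to y by a walk; σ is the sign of its residue at y.
  record Item (y : V) : Set where
    field
      o j  : V
      σ    : Bool
      dir  : Direction
      adj  : All Adjacent dir
      vec≡ : ∀ v → vec dir v ≡ δ o v + sg σ * δ y v
      Io   : inI o ≡ true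

    tok : V × V
    tok = o , j

  open Item

  own : ∀ {i y} → inI i ≡ true → i ~ y → Item y
  own {i} {y} Ii i~y = record
    { o = i ; j = y ; σ = true ; dir = (1ℤ , i , y) ∷ [] ; adj = i~y ∷ []
    ; vec≡ = λ v → lemma (δ i v) (δ y v) ; Io = Ii }
    where
    lemma : ∀ a b → 1ℤ * (a + b) + 0ℤ ≡ a + 1ℤ * b
    lemma = solve-∀

  -- The empty walk: 0 = e_u - e_u has the required shape with residue -1 at u itself, and no edge
  -- is used.
  stay : ∀ {u} → inI u ≡ true → V → Item u
  stay {u} Iu j = record
    { o = u ; j = j ; σ = false ; dir = [] ; adj = []
    ; vec≡ = λ v → lemma (δ u v) ; Io = Iu }
    where
    lemma : ∀ a → 0ℤ ≡ a + -1ℤ * a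
    lemma = solve-∀

  cross : ∀ {d y} → Item d → d ~ y → Item y
  cross {d} {y} x d~y = record
    { o = o x ; j = j x ; σ = not (σ x)
    ; dir = dir x ++ (- sg (σ x) , d , y) ∷ []
    ; adj = Allₚ.++⁺ (adj x) (d~y ∷ [])
    ; vec≡ = λ v → ≡-trans (vec-++ (dir x) _ v) (≡-trans (cong (_+ (- sg (σ x) * (δ d v + δ y v) + 0ℤ)) (vec≡ x v))
        (≡-trans (lemma (δ (o x) v) (sg (σ x)) (δ d v) (δ y v)) (cong (λ s → δ (o x) v + s * δ y v) (sym (sg-not (σ x))))))
    ; Io = Io x }
    where
    lemma : ∀ a s d y → (a + s * d) + (- s * (d + y) + 0ℤ) ≡ a + - s * y
    lemma = solve-∀

  -- Items with residues of equal sign combine to e_o - e_o′, which must not vanish; with opposite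
  -- signs the result e_o + e_o′ is harmless.
  Compat : ∀ {y} → Item y → Item y → Set
  Compat x x′ = o x ≢ o x′ ⊎ σ x ≢ σ x′

  Compat-sym : ∀ {y} {x x′ : Item y} → Compat x x′ → Compat x′ x
  Compat-sym (inj₁ p) = inj₁ (p ∘ sym)
  Compat-sym (inj₂ p) = inj₂ (p ∘ sym)

  points≢0 : ∀ (o o′ : V) b → o ≢ o′ ⊎ b ≡ true → 1ℤ * point o + sg b * point o′ ≢ 0ℤ
  points≢0 o o′ true  _ eq = case ≡-trans (sym (lemma (point o) (point o′))) eq of λ ()
    where
    lemma : ∀ a b → 1ℤ * a + 1ℤ * b ≡ a + b
    lemma = solve-∀
  points≢0 o o′ false (inj₁ o≢o′) eq = o≢o′ (Finₚ.toℕ-injective (ℕₚ.suc-injective (ℤₚ.+-injective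
    (ℤₚ.i-j≡0⇒i≡j (point o) (point o′) (≡-trans (sym (lemma (point o) (point o′))) eq)))))
    where
    lemma : ∀ a b → 1ℤ * a + -1ℤ * b ≡ a + - b
    lemma = solve-∀

  pair : ∀ {y} (x x′ : Item y) → Compat x x′ → Span (o x) (o x′)
  pair {y} x x′ c = record
    { β = sg (opposite (σ x) (σ x′))
    ; dir = dir x ++ scale (sg (opposite (σ x) (σ x′))) (dir x′)
    ; adj = Allₚ.++⁺ (adj x) (adj-scale (sg (opposite (σ x) (σ x′))) (adj x′))
    ; β² = sg² (opposite (σ x) (σ x′))
    ; ≢0 = points≢0 (o x) (o x′) (opposite (σ x) (σ x′)) ([ inj₁ , inj₂ ∘ differ (σ x) (σ x′) ]′ c)
    ; vec≡ = λ v → ≡-trans (vec-++ (dir x) _ v) (≡-trans (cong₂ _+_ (vec≡ x v) (≡-trans (vec-scale (sg (opposite (σ x) (σ x′))) (dir x′) v) (cong (sg (opposite (σ x) (σ x′)) *_) (vec≡ x′ v))))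
        (cancels (σ x) (σ x′) (δ (o x) v) (δ (o x′) v) (δ y v)))
    ; I₁ = Io x ; I₂ = Io x′ }
    where
    differ : ∀ b b′ → b ≢ b′ → opposite b b′ ≡ true
    differ true  true  p = contradiction refl p
    differ true  false p = refl
    differ false true  p = refl
    differ false false p = contradiction refl p
    cancels : ∀ s s′ a a′ y → (a + sg s * y) + sg (opposite s s′) * (a′ + sg s′ * y) ≡ a + sg (opposite s s′) * a′
    cancels true  true  = solve-∀
    cancels true  false = solve-∀
    cancels false true  = solve-∀
    cancels false false = solve-∀

  pair-uses : ∀ {y} (x x′ : Item y) c a b → uses a b (Span.dir (pair x x′ c)) ≡ uses a b (dir x) ℕ.+ uses a b (dir x′)
  pair-uses x x′ c a b = ≡-trans (uses-++ a b (dir x) _) (cong (uses a b (dir x) ℕ.+_) (uses-scale a b (sg (opposite (σ x) (σ x′))) (dir x′)))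

  Pair : V → Set
  Pair y = Σ[ x ∈ Item y ] Σ[ x′ ∈ Item y ] Compat x x′

  flat : ∀ {y} → List (Pair y) → List (Item y)
  flat = concatMap λ (x , x′ , _) → x ∷ x′ ∷ []

  toSquare : ∀ {y} → Pair y → Square
  toSquare (x , x′ , c) = square (o x) (j x) (o x′) (j x′) (pair x x′ c)

  pairUp : ∀ {y} (xs : List (Item y)) → AllPairs Compat xs → Even (length xs) → Σ[ ps ∈ List (Pair y) ] flat ps ≡ xs
  pairUp []            _                     zero     = [] , refl
  pairUp (x ∷ x′ ∷ xs) ((c ∷ _) ∷ _ ∷ cs) (suc₂ e) with pairUp xs cs e
  ... | ps , eq = (x , x′ , c) ∷ ps , cong (λ l → x ∷ x′ ∷ l) eq

  itemsUse : ∀ {y} → V → V → List (Item y) → ℕ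
  itemsUse a b = tot (uses a b ∘ dir)

  squaresUse : V → V → List Square → ℕ
  squaresUse a b = tot (uses a b ∘ Square.dir)

  toSquares-uses : ∀ {y} (ps : List (Pair y)) a b → squaresUse a b (map toSquare ps) ≡ itemsUse a b (flat ps)
  toSquares-uses []                 a b = refl
  toSquares-uses ((x , x′ , c) ∷ ps) a b = ≡-trans (cong₂ ℕ._+_ (pair-uses x x′ c a b) (toSquares-uses ps a b)) (ℕₚ.+-assoc (uses a b (dir x)) _ _)

  toSquares-tokens : ∀ {y} (ps : List (Pair y)) → concatMap Square.tokens (map toSquare ps) ≡ map tok (flat ps)
  toSquares-tokens []                  = refl
  toSquares-tokens ((x , x′ , _) ∷ ps) = cong (λ l → tok x ∷ tok x′ ∷ l) (toSquares-tokens ps)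

  -- Emissions and the invariant of the induction

  data Tag : Set where
    tI tL tU : Tag

  -- An unpaired item at e, to be passed on to the ancestor t.
  record Emission : Set where
    field
      e t  : V
      e~t  : e ~ t
      item : Item e
      tag  : Tag
    open Item item public

    crossed : Item t
    crossed = cross item e~t

  open Emission using (e; t; e~t; item; tag; crossed)

  origin : Emission → V
  origin m = o (item m)

  -- Paths list the nearest ancestor first, so the topmost neighbour is the last one in the list.
  data Topmost (u : V) : List V → V → Set where
    here  : ∀ {z p} → (∀ {w} → w ∈ p → ¬ w ~ u) → Topmost u (z ∷ p) z
    there : ∀ {z p y} → Topmost u p y → Topmost u (z ∷ p) y

  roots : Forest V → List V
  roots ∅            = []
  roots (node v _ s) = v ∷ roots s

  data Head : List V → V → Set where
    head : ∀ {z p} → Head (z ∷ p) z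

  -- tI: emitted from I. tL: emitted from J, the token belonging to a neighbour of the emitter.
  -- tU: emitted from J, the token having no neighbour further up.
  data Kind (p : List V) (f : Forest V) (m : Emission) : Tag → Set where
    isI : inI (e m) ≡ true → Topmost (e m) p (t m) → σ (item m) ≡ false ⊎ (∀ {z} → z ∈ p → ¬ z ~ origin m) →
          origin m ≢ e m → Kind p f m tI
    isL : inI (e m) ≡ false → origin m ~ e m → σ (item m) ≡ true → Head p (t m) → e m ∈ roots f → Kind p f m tL
    isU : inI (e m) ≡ false → (∀ {z} → z ∈ p → ¬ z ~ origin m) → Kind p f m tU

  Cost : Set
  Cost = V → V → ℕ

  record Valid (p : List V) (f : Forest V) (cost : Cost) (m : Emission) : Set where
    field
      e∈   : e m ∈ verts f
      t∈   : t m ∈ p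
      o∈   : origin m ∈ verts f
      kind : Kind p f m (tag m)
      -- Crossing adds two uses. On an edge into I this exhausts the four; an edge inside J keeps
      -- one more use free for a walk that leaves through the emitter.
      toI  : inI (e m) ≡ false → inI (t m) ≡ true → cost (e m) (t m) ℕ.≤ 2
      toJ  : inI (e m) ≡ false → inI (t m) ≡ false → cost (e m) (t m) ℕ.≤ 1

  -- What makes arrivals compatible. Emissions from J have different origins. A tI and a tL item may
  -- share their origin, and then the signs must differ: the tL item has σ true, so the other one
  -- must have σ false. Different emitters mean that an edge is crossed by one emission only.
  Related : Emission → Emission → Set
  Related m m′ = e m ≢ e m′
    × (tag m ≢ tI → tag m′ ≢ tI → origin m ≢ origin m′)
    × (tag m ≡ tI → tag m′ ≡ tL → origin m ≡ origin m′ → σ (item m) ≡ false)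
    × (tag m′ ≡ tI → tag m ≡ tL → origin m ≡ origin m′ → σ (item m′) ≡ false)

  Related-sym : ∀ {m m′} → Related m m′ → Related m′ m
  Related-sym (p , q , r , s) = p ∘ sym , (λ x y → q y x ∘ sym) , (λ x y → s x y ∘ sym) , (λ x y → r x y ∘ sym)

  I? : ∀ v → Dec (inI v ≡ true)
  I? v = inI v ≟ᵇ true

  J? : ∀ v → Dec (inI v ≡ false)
  J? v = inI v ≟ᵇ false

  nbrsI : V → List V
  nbrsI y = filter (λ i → I? i ×-dec (i ~? y)) (allFin n)

  nbrsJ : V → List V → List V
  nbrsJ y p = filter (λ a → J? a ×-dec (a ~? y)) p

  tokensAt : V → List (V × V)
  tokensAt v with inI v
  ... | true  = []
  ... | false = map (_, v) (nbrsI v)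

  tokensIn : Forest V → List (V × V)
  tokensIn = concatMap tokensAt ∘ verts

  lowerAt : V → List V → List (V × V)
  lowerAt v p with inI v
  ... | true  = []
  ... | false = map (_, v) (nbrsJ v p)

  lowerIn : List V → Forest V → List (V × V)
  lowerIn p ∅            = []
  lowerIn p (node v c s) = lowerAt v p ++ lowerIn (v ∷ p) c ++ lowerIn p s

  pendUse : V → V → List Emission → ℕ
  pendUse a b = tot (uses a b ∘ dir ∘ item)

  lowerUse : V → V → List Lower → ℕ
  lowerUse a b = tot (uses a b ∘ Lower.dir)

  -- A walk z, d, i into I with room for one more use of each edge even after an item has crossed dz.
  record Fallback (cost : Cost) (d z : V) : Set where
    field
      i   : V
      Ii  : inI i ≡ true
      i~d : i ~ d
      id≤ : cost i d ℕ.≤ 3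
      dz≤ : cost d z ℕ.≤ 1

  -- Serves a token at z ∈ I when nothing arrives there to be paired with: the walk z, d, i uses two
  -- edges once more. As i ≠ z, its effect e_z - e_i is not zero.
  record Quiet (cost : Cost) (d z : V) : Set where
    field
      i   : V
      Ii  : inI i ≡ true
      i≢z : i ≢ z
      i~d : i ~ d
      id≤ : cost i d ℕ.≤ 3
      dz≤ : cost d z ℕ.≤ 3

  -- An origin may be an ancestor, because a vertex of J also handles the tokens of its neighbours
  -- in I above it.
  Near : List V → Forest V → V → Set
  Near p f v = v ∈ verts f ⊎ v ∈ p

  -- The outcome for the subtrees f below the path p. Besides the limit of four it records how much
  -- capacity is left on the edges that the vertices of p are going to use.
  record State (p : List V) (f : Forest V) : Set where
    field
      pend : List Emission
      sqs  : List Square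
      low  : List Lower

    -- Squares are made of a direction used twice, and a pending item will end up in one.
    cost : Cost
    cost a b = 2 ℕ.* pendUse a b pend ℕ.+ (2 ℕ.* squaresUse a b sqs ℕ.+ lowerUse a b low)

    field
      valid : All (Valid p f cost) pend
      rel   : AllPairs Related pend
      toks  : tokensIn f ↭ map (tok ∘ item) pend ++ concatMap Square.tokens sqs
      lows  : lowerIn p f ↭ map Lower.ad low
      sqs⊆  : All (λ s → Near p f (Square.o₁ s) × Near p f (Square.o₂ s)) sqs
      bound : ∀ {a b} → a ~ b → cost a b ℕ.≤ 4
      local : ∀ {a b} → a ∉ verts f → b ∉ verts f → cost a b ≡ 0
      -- An edge from I upwards is loaded only when its upper end is processed.
      upI   : ∀ {i y} → i ∈ verts f → inI i ≡ true → y ∈ p → cost i y ≡ 0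
      -- Only the J-J walks through d have used such an edge: once for the form on this edge, and
      -- once as the far end of another walk.
      upJ   : ∀ {d y} → d ∈ verts f → inI d ≡ false → y ∈ p → inI y ≡ false → cost d y ℕ.≤ 2
      -- Kept for a parent z in J that may need a second way into I, either to end its J-J walks or,
      -- at a root, as the partner of an odd token.
      back  : ∀ {d z} → d ∈ roots f → inI d ≡ false → Head p z → inI z ≡ false →
              Any (λ m → e m ≡ d × tag m ≡ tU) pend ⊎ Fallback cost d z
      quiet : ∀ {d z} → d ∈ roots f → inI d ≡ false → Head p z → inI z ≡ true → Any (λ m → e m ≡ d) pend ⊎ Quiet cost d z

  open State

  emptyState : ∀ p → State p ∅
  emptyState p = record
    { pend = [] ; sqs = [] ; low = [] ; valid = [] ; rel = [] ; toks = ↭-refl ; lows = ↭-refl ; sqs⊆ = []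
    ; bound = λ _ → z≤n ; local = λ _ _ → refl ; upI = λ () ; upJ = λ () ; back = λ () ; quiet = λ () }

  -- Merging sibling subtrees

  interchange : {A : Set} (ws xs ys zs : List A) → (ws ++ xs) ++ (ys ++ zs) ↭ (ws ++ ys) ++ (xs ++ zs)
  interchange ws xs ys zs = ↭-trans (++-assoc ws xs (ys ++ zs))
    (↭-trans (++⁺ˡ ws (shifts xs ys {zs})) (↭-sym (++-assoc ws ys (xs ++ zs))))

  roots⊆ : ∀ g {d} → d ∈ roots g → d ∈ verts g
  roots⊆ (node w _ g) (here eq)  = here eq
  roots⊆ (node w h g) (there d∈) = there (∈-++⁺ʳ (verts h) (roots⊆ g d∈))

  -- By `sep` no edge joins the two subtrees, and each state costs nothing outside its own, so on
  -- every edge at most one of the two costs is nonzero.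
  module Siblings {p : List V} {v : V} {c s : Forest V} (S₁ : State p (node v c ∅)) (S₂ : State p s)
           (disj : ∀ {a} → a ∈ v ∷ verts c → a ∉ verts s)
           (p∉₁ : ∀ {a} → a ∈ p → a ∉ v ∷ verts c) (p∉₂ : ∀ {a} → a ∈ p → a ∉ verts s)
           (sep : ∀ {a b} → a ∈ v ∷ verts c → b ∈ verts s → ¬ a ~ b) where

    private
      f₁ = node v c ∅
      f  = node v c s
      to₁ : ∀ {a} → a ∈ verts f₁ → a ∈ v ∷ verts c
      to₁ (here eq)  = here eq
      to₁ (there a∈) = there ([ id , (λ ()) ]′ (∈-++⁻ (verts c) a∈))
      from₁ : ∀ {a} → a ∈ v ∷ verts c → a ∈ verts f
      from₁ (here eq)  = here eq
      from₁ (there a∈) = there (∈-++⁺ˡ a∈)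
      in₁ : ∀ {a} → a ∈ verts f₁ → a ∈ verts f
      in₁ = from₁ ∘ to₁
      in₂ : ∀ {a} → a ∈ verts s → a ∈ verts f
      in₂ = there ∘ ∈-++⁺ʳ (verts c)
      cases : ∀ {a} → a ∈ verts f → a ∈ verts f₁ ⊎ a ∈ verts s
      cases (here eq)  = inj₁ (here eq)
      cases (there a∈) = [ inj₁ ∘ there ∘ ∈-++⁺ˡ , inj₂ ]′ (∈-++⁻ (verts c) a∈)
      d₁₂ : ∀ {a} → a ∈ verts f₁ → a ∉ verts s
      d₁₂ = disj ∘ to₁
      p₁ : ∀ {a} → a ∈ p → a ∉ verts f₁
      p₁ a∈ = p∉₁ a∈ ∘ to₁

      cost′ : Cost
      cost′ a b = 2 ℕ.* pendUse a b (pend S₁ ++ pend S₂) ℕ.+ (2 ℕ.* squaresUse a b (sqs S₁ ++ sqs S₂) ℕ.+ lowerUse a b (low S₁ ++ low S₂))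

      cost-+ : ∀ a b → cost′ a b ≡ cost S₁ a b ℕ.+ cost S₂ a b
      cost-+ a b = ≡-trans (cong₂ (λ x y → 2 ℕ.* x ℕ.+ y) (tot-++ _ (pend S₁) (pend S₂))
          (cong₂ (λ x y → 2 ℕ.* x ℕ.+ y) (tot-++ _ (sqs S₁) (sqs S₂)) (tot-++ _ (low S₁) (low S₂))))
        (lemma (pendUse a b (pend S₁)) (pendUse a b (pend S₂)) (squaresUse a b (sqs S₁)) (squaresUse a b (sqs S₂)) (lowerUse a b (low S₁)) (lowerUse a b (low S₂)))
        where
        lemma : ∀ x x′ y y′ z z′ → 2 ℕ.* (x ℕ.+ x′) ℕ.+ (2 ℕ.* (y ℕ.+ y′) ℕ.+ (z ℕ.+ z′)) ≡ (2 ℕ.* x ℕ.+ (2 ℕ.* y ℕ.+ z)) ℕ.+ (2 ℕ.* x′ ℕ.+ (2 ℕ.* y′ ℕ.+ z′))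
        lemma = solveℕ-∀

      only₁ : ∀ {a b} → a ∉ verts s → b ∉ verts s → cost′ a b ≡ cost S₁ a b
      only₁ {a} {b} a∉ b∉ = ≡-trans (cost-+ a b) (≡-trans (cong (cost S₁ a b ℕ.+_) (local S₂ a∉ b∉)) (ℕₚ.+-identityʳ _))

      only₂ : ∀ {a b} → a ∉ verts f₁ → b ∉ verts f₁ → cost′ a b ≡ cost S₂ a b
      only₂ {a} {b} a∉ b∉ = ≡-trans (cost-+ a b) (cong (ℕ._+ cost S₂ a b) (local S₁ a∉ b∉))

      near : ∀ {g a} → (∀ {x} → x ∈ verts g → x ∈ verts f) → Near p g a → Near p f a
      near inc (inj₁ q) = inj₁ (inc q)
      near inc (inj₂ q) = inj₂ q

      kind⁺ : ∀ {g m k} → (∀ {x} → x ∈ roots g → x ∈ roots f) → Kind p g m k → Kind p f m k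
      kind⁺ inc (isI x y z w)   = isI x y z w
      kind⁺ inc (isL x y z w r) = isL x y z w (inc r)
      kind⁺ inc (isU x y)       = isU x y

    merge : State p f
    merge = record
      { pend = pend S₁ ++ pend S₂ ; sqs = sqs S₁ ++ sqs S₂ ; low = low S₁ ++ low S₂
      ; valid = Allₚ.++⁺
          (All.map (λ {m} V → let open Valid V in record
            { e∈ = in₁ e∈ ; t∈ = t∈ ; o∈ = in₁ o∈ ; kind = kind⁺ {f₁} (λ { (here q) → here q }) kind
            ; toI = λ x y → ℕₚ.≤-trans (ℕₚ.≤-reflexive (only₁ (d₁₂ e∈) (p∉₂ t∈))) (toI x y)
            ; toJ = λ x y → ℕₚ.≤-trans (ℕₚ.≤-reflexive (only₁ (d₁₂ e∈) (p∉₂ t∈))) (toJ x y) }) (valid S₁))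
          (All.map (λ {m} V → let open Valid V in record
            { e∈ = in₂ e∈ ; t∈ = t∈ ; o∈ = in₂ o∈ ; kind = kind⁺ {s} there kind
            ; toI = λ x y → ℕₚ.≤-trans (ℕₚ.≤-reflexive (only₂ (λ q → d₁₂ q e∈) (p₁ t∈))) (toI x y)
            ; toJ = λ x y → ℕₚ.≤-trans (ℕₚ.≤-reflexive (only₂ (λ q → d₁₂ q e∈) (p₁ t∈))) (toJ x y) }) (valid S₂))
      ; rel = AllPairsₚ.++⁺ (rel S₁) (rel S₂) (All.map (λ V₁ → All.map (λ V₂ →
            (λ eq → d₁₂ (Valid.e∈ V₁) (subst (_∈ verts s) (sym eq) (Valid.e∈ V₂)))
          , (λ _ _ eq → d₁₂ (Valid.o∈ V₁) (subst (_∈ verts s) (sym eq) (Valid.o∈ V₂)))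
          , (λ _ _ eq → contradiction (subst (_∈ verts s) (sym eq) (Valid.o∈ V₂)) (d₁₂ (Valid.o∈ V₁)))
          , (λ _ _ eq → contradiction (subst (_∈ verts s) (sym eq) (Valid.o∈ V₂)) (d₁₂ (Valid.o∈ V₁)))) (valid S₂)) (valid S₁))
      ; toks = ↭-trans (↭-reflexive (≡-trans (cong (concatMap tokensAt) (cong (λ l → v ∷ l ++ verts s) (sym (Listₚ.++-identityʳ (verts c)))))
                 (Listₚ.concatMap-++ tokensAt (v ∷ verts c ++ []) (verts s))))
               (↭-trans (++⁺ (toks S₁) (toks S₂)) (↭-trans (interchange (map (tok ∘ item) (pend S₁)) (concatMap Square.tokens (sqs S₁)) (map (tok ∘ item) (pend S₂)) (concatMap Square.tokens (sqs S₂)))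
                 (↭-reflexive (sym (cong₂ _++_ (Listₚ.map-++ (tok ∘ item) (pend S₁) (pend S₂)) (Listₚ.concatMap-++ Square.tokens (sqs S₁) (sqs S₂)))))))
      ; lows = ↭-trans (↭-reflexive (≡-trans (cong (λ l → lowerAt v p ++ l ++ lowerIn p s) (sym (Listₚ.++-identityʳ (lowerIn (v ∷ p) c))))
                 (sym (Listₚ.++-assoc (lowerAt v p) (lowerIn (v ∷ p) c ++ []) (lowerIn p s)))))
               (↭-trans (++⁺ (lows S₁) (lows S₂)) (↭-reflexive (sym (Listₚ.map-++ Lower.ad (low S₁) (low S₂)))))
      ; sqs⊆ = Allₚ.++⁺ (All.map (λ (x , y) → near {f₁} in₁ x , near {f₁} in₁ y) (sqs⊆ S₁)) (All.map (λ (x , y) → near {s} in₂ x , near {s} in₂ y) (sqs⊆ S₂))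
      ; bound = bound′
      ; local = λ {a} {b} a∉ b∉ → ≡-trans (only₁ (a∉ ∘ in₂) (b∉ ∘ in₂)) (local S₁ (a∉ ∘ in₁) (b∉ ∘ in₁))
      ; upI = upI′
      ; upJ = upJ′
      ; back = back′
      ; quiet = quiet′ }
      where
      bound′ : ∀ {a b} → a ~ b → cost′ a b ℕ.≤ 4
      bound′ {a} {b} a~b with a ∈? (v ∷ verts c) | b ∈? (v ∷ verts c)
      ... | yes a∈ | _      = ℕₚ.≤-trans (ℕₚ.≤-reflexive (only₁ (disj a∈) (λ b∈ → sep a∈ b∈ a~b))) (bound S₁ a~b)
      ... | no _   | yes b∈ = ℕₚ.≤-trans (ℕₚ.≤-reflexive (only₁ (λ a∈ → sep b∈ a∈ (~-sym a~b)) (disj b∈))) (bound S₁ a~b)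
      ... | no a∉  | no b∉  = ℕₚ.≤-trans (ℕₚ.≤-reflexive (only₂ (a∉ ∘ to₁) (b∉ ∘ to₁))) (bound S₂ a~b)
      upI′ : ∀ {i y} → i ∈ verts f → inI i ≡ true → y ∈ p → cost′ i y ≡ 0
      upI′ i∈ Ii y∈ with cases i∈
      ... | inj₁ q = ≡-trans (only₁ (d₁₂ q) (p∉₂ y∈)) (upI S₁ q Ii y∈)
      ... | inj₂ q = ≡-trans (only₂ (λ r → d₁₂ r q) (p₁ y∈)) (upI S₂ q Ii y∈)
      upJ′ : ∀ {d y} → d ∈ verts f → inI d ≡ false → y ∈ p → inI y ≡ false → cost′ d y ℕ.≤ 2
      upJ′ d∈ Jd y∈ Jy with cases d∈
      ... | inj₁ q = ℕₚ.≤-trans (ℕₚ.≤-reflexive (only₁ (d₁₂ q) (p∉₂ y∈))) (upJ S₁ q Jd y∈ Jy)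
      ... | inj₂ q = ℕₚ.≤-trans (ℕₚ.≤-reflexive (only₂ (λ r → d₁₂ r q) (p₁ y∈))) (upJ S₂ q Jd y∈ Jy)
      fallback : ∀ {d z} {C : Cost} → (∀ {x} → x ~ d → cost′ x d ≡ C x d) → cost′ d z ≡ C d z → Fallback C d z → Fallback cost′ d z
      fallback e₁ e₂ F = record { i = i ; Ii = Ii ; i~d = i~d ; id≤ = ℕₚ.≤-trans (ℕₚ.≤-reflexive (e₁ i~d)) id≤ ; dz≤ = ℕₚ.≤-trans (ℕₚ.≤-reflexive e₂) dz≤ }
        where open Fallback F
      back′ : ∀ {d z} → d ∈ roots f → inI d ≡ false → Head p z → inI z ≡ false → Any (λ m → e m ≡ d × tag m ≡ tU) (pend S₁ ++ pend S₂) ⊎ Fallback cost′ d z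
      back′ (here refl) Jd (head {z}) Jz = Sum.map Anyₚ.++⁺ˡ
        (fallback (λ x~v → only₁ (λ x∈ → sep (here refl) x∈ (~-sym x~v)) (disj (here refl))) (only₁ (disj (here refl)) (p∉₂ (here refl)))) (back S₁ (here refl) Jd head Jz)
      back′ (there d∈) Jd (head {z}) Jz = Sum.map (Anyₚ.++⁺ʳ (pend S₁))
        (fallback (λ x~d → only₂ (λ x∈ → sep (to₁ x∈) d∈s x~d) (λ r → d₁₂ r d∈s)) (only₂ (λ r → d₁₂ r d∈s) (p₁ (here refl)))) (back S₂ d∈ Jd head Jz)
        where d∈s = roots⊆ s d∈
      quietly : ∀ {d z} {C : Cost} → (∀ {x} → x ~ d → cost′ x d ≡ C x d) → cost′ d z ≡ C d z → Quiet C d z → Quiet cost′ d z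
      quietly e₁ e₂ F = record { i = i ; Ii = Ii ; i≢z = i≢z ; i~d = i~d ; id≤ = ℕₚ.≤-trans (ℕₚ.≤-reflexive (e₁ i~d)) id≤ ; dz≤ = ℕₚ.≤-trans (ℕₚ.≤-reflexive e₂) dz≤ }
        where open Quiet F
      quiet′ : ∀ {d z} → d ∈ roots f → inI d ≡ false → Head p z → inI z ≡ true → Any (λ m → e m ≡ d) (pend S₁ ++ pend S₂) ⊎ Quiet cost′ d z
      quiet′ (here refl) Jd (head {z}) Iz = Sum.map Anyₚ.++⁺ˡ
        (quietly (λ x~v → only₁ (λ x∈ → sep (here refl) x∈ (~-sym x~v)) (disj (here refl))) (only₁ (disj (here refl)) (p∉₂ (here refl)))) (quiet S₁ (here refl) Jd head Iz)
      quiet′ (there d∈) Jd (head {z}) Iz = Sum.map (Anyₚ.++⁺ʳ (pend S₁))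
        (quietly (λ x~d → only₂ (λ x∈ → sep (to₁ x∈) d∈s x~d) (λ r → d₁₂ r d∈s)) (only₂ (λ r → d₁₂ r d∈s) (p₁ (here refl)))) (quiet S₂ d∈ Jd head Iz)
        where d∈s = roots⊆ s d∈

  -- Counting the uses of an edge, and sorting arrivals

  same-sym : ∀ a b s → same a b s ≡ same b a s
  same-sym a b s with same? a b s
  ... | yes p = sym (ι-yes (same? b a s) (Sum.swap p))
  ... | no ¬p = sym (ι-no (same? b a s) (¬p ∘ Sum.swap))

  uses-sym : ∀ a b d → uses a b d ≡ uses b a d
  uses-sym a b []            = refl
  uses-sym a b ((_ , s) ∷ d) = cong₂ ℕ._+_ (same-sym a b s) (uses-sym a b d)

  tot-cong : {A : Set} {φ ψ : A → ℕ} (xs : List A) → (∀ x → φ x ≡ ψ x) → tot φ xs ≡ tot ψ xs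
  tot-cong []       eq = refl
  tot-cong (x ∷ xs) eq = cong₂ ℕ._+_ (eq x) (tot-cong xs eq)

  tot-↭ : {A : Set} (φ : A → ℕ) {xs ys : List A} → xs ↭ ys → tot φ xs ≡ tot φ ys
  tot-↭ φ refl          = refl
  tot-↭ φ (prep x p)    = cong (φ x ℕ.+_) (tot-↭ φ p)
  tot-↭ φ (swap x y p)  = ≡-trans (cong (λ r → φ x ℕ.+ (φ y ℕ.+ r)) (tot-↭ φ p)) (lemma (φ x) (φ y) _)
    where
    lemma : ∀ a b c → a ℕ.+ (b ℕ.+ c) ≡ b ℕ.+ (a ℕ.+ c)
    lemma = solveℕ-∀
  tot-↭ φ (trans p q)   = ≡-trans (tot-↭ φ p) (tot-↭ φ q)

  tot-map : {A B : Set} (φ : B → ℕ) (g : A → B) (xs : List A) → tot φ (map g xs) ≡ tot (φ ∘ g) xs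
  tot-map φ g []       = refl
  tot-map φ g (x ∷ xs) = cong (φ (g x) ℕ.+_) (tot-map φ g xs)

  tot-+ : {A : Set} (φ ψ : A → ℕ) (xs : List A) → tot (λ x → φ x ℕ.+ ψ x) xs ≡ tot φ xs ℕ.+ tot ψ xs
  tot-+ φ ψ []       = refl
  tot-+ φ ψ (x ∷ xs) = ≡-trans (cong (φ x ℕ.+ ψ x ℕ.+_) (tot-+ φ ψ xs)) (lemma (φ x) (ψ x) (tot φ xs) (tot ψ xs))
    where
    lemma : ∀ a b c d → (a ℕ.+ b) ℕ.+ (c ℕ.+ d) ≡ (a ℕ.+ c) ℕ.+ (b ℕ.+ d)
    lemma = solveℕ-∀

  cost-sym : ∀ {p f} (S : State p f) a b → cost S a b ≡ cost S b a
  cost-sym S a b = cong₂ (λ x y → 2 ℕ.* x ℕ.+ y) (tot-cong (pend S) (λ m → uses-sym a b (dir (item m))))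
    (cong₂ (λ x y → 2 ℕ.* x ℕ.+ y) (tot-cong (sqs S) (λ s → uses-sym a b (Square.dir s))) (tot-cong (low S) (λ l → uses-sym a b (Lower.dir l))))

  steps : V → V → V → List V → ℕ
  steps a b y = tot λ w → same a b (w , y)

  steps-away : ∀ {a b y} ws → a ≢ y → b ≢ y → steps a b y ws ≡ 0
  steps-away []       _   _   = refl
  steps-away {a} {b} {y} (w ∷ ws) a≢y b≢y = cong₂ ℕ._+_
    (ι-no (same? a b (w , y)) (λ { (inj₁ (_ , eq)) → b≢y (sym eq) ; (inj₂ (_ , eq)) → a≢y (sym eq) })) (steps-away ws a≢y b≢y)

  steps-count : ∀ {x y} ws → x ≢ y → steps x y y ws ≡ count x ws
  steps-count {x} {y} ws x≢y = tot-cong ws go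
    where
    go : ∀ w → same x y (w , y) ≡ ι (w Finₚ.≟ x)
    go w = decide (w Finₚ.≟ x)
      where
      decide : (q : Dec (w ≡ x)) → same x y (w , y) ≡ ι q
      decide (yes eq) = ι-yes (same? x y (w , y)) (inj₁ (eq , refl))
      decide (no ≢x)  = ι-no (same? x y (w , y)) (λ { (inj₁ (eq , _)) → ≢x eq ; (inj₂ (_ , eq)) → x≢y (sym eq) })

  steps-sym : ∀ a b y ws → steps a b y ws ≡ steps b a y ws
  steps-sym a b y ws = tot-cong ws (λ w → same-sym a b (w , y))

  Arrival : V → Set
  Arrival y = Σ[ m ∈ Emission ] t m ≡ y

  arrivals : ∀ y → List Emission → List (Arrival y)
  arrivals y []       = []
  arrivals y (m ∷ ms) with t m Finₚ.≟ y
  ... | yes eq = (m , eq) ∷ arrivals y ms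
  ... | no _   = arrivals y ms

  others : V → List Emission → List Emission
  others y = filter λ m → ¬? (t m Finₚ.≟ y)

  arrivals-↭ : ∀ y ms → map proj₁ (arrivals y ms) ++ others y ms ↭ ms
  arrivals-↭ y []       = ↭-refl
  arrivals-↭ y (m ∷ ms) with t m Finₚ.≟ y
  ... | yes _ = prep m (arrivals-↭ y ms)
  ... | no _  = ↭-trans (shift m (map proj₁ (arrivals y ms)) (others y ms)) (prep m (arrivals-↭ y ms))

  arrive : ∀ {y} → Arrival y → Item y
  arrive (m , refl) = crossed m

  emitter : ∀ {y} → Arrival y → V
  emitter = e ∘ proj₁

  arrive-uses : ∀ {y} (x : Arrival y) a b → uses a b (dir (arrive x)) ≡ uses a b (dir (item (proj₁ x))) ℕ.+ same a b (emitter x , y)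
  arrive-uses (m , refl) a b = ≡-trans (uses-++ a b (dir (item m)) _) (cong (uses a b (dir (item m)) ℕ.+_) (ℕₚ.+-identityʳ _))

  arrive-tok : ∀ {y} (x : Arrival y) → tok (arrive x) ≡ tok (item (proj₁ x))
  arrive-tok (m , refl) = refl

  arrive-o : ∀ {y} (x : Arrival y) → o (arrive x) ≡ origin (proj₁ x)
  arrive-o (m , refl) = refl

  arrive-σ : ∀ {y} (x : Arrival y) → σ (arrive x) ≡ not (σ (item (proj₁ x)))
  arrive-σ (m , refl) = refl

  arriveUse : ∀ {y} (xs : List (Arrival y)) a b →
              itemsUse a b (map arrive xs) ≡ pendUse a b (map proj₁ xs) ℕ.+ steps a b y (map emitter xs)
  arriveUse {y} xs a b = ≡-trans (tot-map _ arrive xs) (≡-trans (tot-cong xs (λ x → arrive-uses x a b))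
    (≡-trans (tot-+ _ _ xs) (sym (cong₂ ℕ._+_ (tot-map (uses a b ∘ dir ∘ item) proj₁ xs) (tot-map (λ w → same a b (w , y)) emitter xs)))))

  arriveToks : ∀ {y} (xs : List (Arrival y)) → map tok (map arrive xs) ≡ map (tok ∘ item) (map proj₁ xs)
  arriveToks xs = ≡-trans (sym (Listₚ.map-∘ xs)) (≡-trans (Listₚ.map-cong arrive-tok xs) (Listₚ.map-∘ xs))

  topmost : ∀ u {z} p → z ∈ p → z ~ u → ∃[ y ] (Topmost u p y × y ∈ p × y ~ u)
  topmost u (z ∷ p) z∈ z~u with any? (_~? u) p
  ... | yes some = let w , w∈ , w~u = find some ; y , top , y∈ , y~u = topmost u p w∈ w~u in y , there top , there y∈ , y~u
  topmost u (z ∷ p) (here refl) z~u | no none = z , here (λ w∈ w~u → none (lose w∈ w~u)) , here refl , z~u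
  topmost u (z ∷ p) (there z∈)  z~u | no none = contradiction (lose z∈ z~u) none

  tokensAt-I : ∀ {v} → inI v ≡ true → tokensAt v ≡ []
  tokensAt-I {v} eq with inI v
  tokensAt-I refl | .true = refl

  lowerAt-I : ∀ {v} p → inI v ≡ true → lowerAt v p ≡ []
  lowerAt-I {v} p eq with inI v
  lowerAt-I p refl | .true = refl

  tokensAt-J : ∀ {v} → inI v ≡ false → tokensAt v ≡ map (_, v) (nbrsI v)
  tokensAt-J {v} eq with inI v
  tokensAt-J refl | .false = refl

  lowerAt-J : ∀ {v} p → inI v ≡ false → lowerAt v p ≡ map (_, v) (nbrsJ v p)
  lowerAt-J {v} p eq with inI v
  lowerAt-J p refl | .false = refl

  -- One vertex: what arrives there and what passes by

  module Node {p : List V} {v : V} {c : Forest V} (S : State (v ∷ p) c)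
              (nb : ∀ {w} → v ~ w → w ∈ p ⊎ w ∈ verts c)
              (v∉c : v ∉ verts c) (p∉ : ∀ {a} → a ∈ p → a ∉ v ∷ verts c) where

    f′ : Forest V
    f′ = node v c ∅

    in′ : ∀ {a} → a ∈ verts c → a ∈ verts f′
    in′ = there ∘ ∈-++⁺ˡ

    out′ : ∀ {a} → a ∈ verts f′ → a ≡ v ⊎ a ∈ verts c
    out′ (here eq)  = inj₁ eq
    out′ (there a∈) = inj₂ ([ id , (λ ()) ]′ (∈-++⁻ (verts c) a∈))

    p≢v : ∀ {a} → a ∈ p → a ≢ v
    p≢v a∈ refl = p∉ a∈ (here refl)

    c≢v : ∀ {a} → a ∈ verts c → a ≢ v
    c≢v a∈ refl = v∉c a∈

    p∉c : ∀ {a} → a ∈ p → a ∉ verts c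
    p∉c a∈ = p∉ a∈ ∘ there

    arr : List (Arrival v)
    arr = arrivals v (pend S)

    rest : List Emission
    rest = others v (pend S)

    perm : map proj₁ arr ++ rest ↭ pend S
    perm = arrivals-↭ v (pend S)

    relAll : AllPairs Related (map proj₁ arr ++ rest)
    relAll = AllPairs-↭ (λ {m} {m′} → Related-sym {m} {m′}) (↭-sym perm) (rel S)

    relArr : AllPairs Related (map proj₁ arr)
    relArr = AllPairs-++ˡ (map proj₁ arr) relAll

    relRest : AllPairs Related rest
    relRest = AllPairs-++ʳ (map proj₁ arr) relAll

    validAll : All (Valid (v ∷ p) c (cost S)) (map proj₁ arr ++ rest)
    validAll = All-resp-↭ (↭-sym perm) (valid S)

    validArr : ∀ {x} → x ∈ arr → Valid (v ∷ p) c (cost S) (proj₁ x)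
    validArr x∈ = All.lookup validAll (∈-++⁺ˡ (∈-map⁺ proj₁ x∈))

    rest-t : ∀ {m} → m ∈ rest → t m ≢ v
    rest-t m∈ = proj₂ (∈-filter⁻ (λ m → ¬? (t m Finₚ.≟ v)) {xs = pend S} m∈)

    validRest : ∀ {m} → m ∈ rest → Valid (v ∷ p) c (cost S) m
    validRest m∈ = All.lookup validAll (∈-++⁺ʳ (map proj₁ arr) m∈)

    emitters : List V
    emitters = map emitter arr

    emitters-unique : Unique emitters
    emitters-unique = subst Unique (sym (Listₚ.map-∘ {g = e} {f = proj₁} arr)) (AllPairsₚ.map⁺ (AllPairs.map proj₁ relArr))

    t∈p : ∀ {m} → m ∈ rest → t m ∈ p
    t∈p m∈ with Valid.t∈ (validRest m∈)
    ... | here eq  = contradiction eq (rest-t m∈)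
    ... | there q = q

    -- Items that pass v stay valid one level up. A tL item cannot be among them, since it always
    -- stops at the parent of its emitter.
    restValid : (C : Cost) → (∀ {m} → m ∈ rest → C (e m) (t m) ℕ.≤ cost S (e m) (t m)) → All (Valid p f′ C) rest
    restValid C le = All.tabulate λ {m} m∈ → let open Valid (validRest m∈) in record
      { e∈ = in′ e∈ ; t∈ = t∈p m∈ ; o∈ = in′ o∈ ; kind = kind⁺ m∈ kind
      ; toI = λ x y → ℕₚ.≤-trans (le m∈) (toI x y)
      ; toJ = λ x y → ℕₚ.≤-trans (le m∈) (toJ x y) }
      where
      kind⁺ : ∀ {m k} → m ∈ rest → Kind (v ∷ p) c m k → Kind p f′ m k
      kind⁺ m∈ (isI x (here _)    z w) = contradiction refl (rest-t m∈)
      kind⁺ m∈ (isI x (there top) (inj₁ z) w) = isI x top (inj₁ z) w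
      kind⁺ m∈ (isI x (there top) (inj₂ z) w) = isI x top (inj₂ (λ q → z (there q))) w
      kind⁺ m∈ (isL _ _ _ head _)      = contradiction refl (rest-t m∈)
      kind⁺ m∈ (isU x y)               = isU x (λ q → y (there q))

    rest-notL : ∀ {m} → m ∈ rest → tag m ≢ tL
    rest-notL {m} m∈ eq with subst (Kind (v ∷ p) c m) eq (Valid.kind (validRest m∈))
    ... | isL _ _ _ head _ = rest-t m∈ refl

    -- Such an item is tU, and its origin has no neighbour on the path. This separates it from the
    -- items that v emits, whose origins are adjacent to v or arrived there.
    rest-far : ∀ {m} → m ∈ rest → tag m ≢ tI → ¬ v ~ origin m
    rest-far {m} m∈ ≢I with tag m in eq | Valid.kind (validRest m∈)
    ... | tI | _       = contradiction refl ≢I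
    ... | tL | _       = contradiction eq (rest-notL m∈)
    ... | tU | isU _ q = q (here refl)

    near′ : ∀ {a} → Near (v ∷ p) c a → Near p f′ a
    near′ (inj₁ q)         = inj₁ (in′ q)
    near′ (inj₂ (here eq)) = inj₁ (here eq)
    near′ (inj₂ (there q)) = inj₂ q

    local-p : ∀ {a} → a ∈ p → cost S a v ≡ 0
    local-p a∈ = local S (p∉c a∈) v∉c

    tokens-node : tokensIn f′ ≡ tokensAt v ++ tokensIn c
    tokens-node = cong (λ l → tokensAt v ++ concatMap tokensAt l) (Listₚ.++-identityʳ (verts c))

    -- At v ∈ I the arrivals are paired up; one left over is passed on to the topmost neighbour of v.
    module IStep (Iv : inI v ≡ true) (kt : ∀ {w} → w ∈ verts c → v ~ w → inI w ≡ false) where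

      arrJ : ∀ {x} → x ∈ arr → inI (emitter x) ≡ false
      arrJ {m , refl} x∈ = kt (Valid.e∈ (validArr x∈)) (~-sym (e~t m))

      arr-tag : ∀ {x} → x ∈ arr → tag (proj₁ x) ≢ tI
      arr-tag {m , _} x∈ eq with subst (Kind (v ∷ p) c m) eq (Valid.kind (validArr x∈))
      ... | isI Im _ _ _ = case ≡-trans (sym Im) (arrJ x∈) of λ ()

      compat : ∀ (xs : List (Arrival v)) → (∀ {x} → x ∈ xs → x ∈ arr) → AllPairs Related (map proj₁ xs) → AllPairs Compat (map arrive xs)
      compat []       _   _        = []
      compat (x ∷ xs) sub (r ∷ rs) = Allₚ.map⁺ (All.tabulate (λ {x′} x′∈ → inj₁ (λ eq →
          proj₁ (proj₂ (All.lookup r (∈-map⁺ proj₁ x′∈))) (arr-tag (sub (here refl))) (arr-tag (sub (there x′∈)))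
            (≡-trans (sym (arrive-o x)) (≡-trans eq (arrive-o x′))))))
        ∷ compat xs (sub ∘ there) rs

      -- `outs` are the arrivals handed on as the emissions `us`. The same accounting serves the
      -- even case, the odd case and a root in I.
      module Finish (us : List Emission) (ps : List (Pair v)) (outs : List (Arrival v))
                    (items≡ : map arrive outs ++ flat ps ≡ map arrive arr)
                    (us-use : ∀ a b → pendUse a b us ≡ itemsUse a b (map arrive outs))
                    (us-tok : map (tok ∘ item) us ≡ map tok (map arrive outs))
                    (flat⊆ : All (λ x → o x ∈ verts c) (flat ps)) where

        cost′ : Cost
        cost′ a b = 2 ℕ.* pendUse a b (us ++ rest) ℕ.+ (2 ℕ.* squaresUse a b (map toSquare ps ++ sqs S) ℕ.+ lowerUse a b (low S))

        cost≡ : ∀ a b → cost′ a b ≡ cost S a b ℕ.+ 2 ℕ.* steps a b v emitters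
        cost≡ a b = begin
          cost′ a b
            ≡⟨ cong₂ (λ x y → 2 ℕ.* x ℕ.+ (2 ℕ.* y ℕ.+ lowerUse a b (low S))) (≡-trans (tot-++ _ us rest) (cong (ℕ._+ pendUse a b rest) (us-use a b)))
                 (≡-trans (tot-++ _ (map toSquare ps) (sqs S)) (cong (ℕ._+ squaresUse a b (sqs S)) (toSquares-uses ps a b))) ⟩
          2 ℕ.* (itemsUse a b (map arrive outs) ℕ.+ pendUse a b rest) ℕ.+ (2 ℕ.* (itemsUse a b (flat ps) ℕ.+ squaresUse a b (sqs S)) ℕ.+ lowerUse a b (low S))
            ≡⟨ lemma (itemsUse a b (map arrive outs)) (pendUse a b rest) (itemsUse a b (flat ps)) (squaresUse a b (sqs S)) (lowerUse a b (low S)) ⟩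
          2 ℕ.* ((itemsUse a b (map arrive outs) ℕ.+ itemsUse a b (flat ps)) ℕ.+ pendUse a b rest) ℕ.+ (2 ℕ.* squaresUse a b (sqs S) ℕ.+ lowerUse a b (low S))
            ≡⟨ cong (λ x → 2 ℕ.* (x ℕ.+ pendUse a b rest) ℕ.+ (2 ℕ.* squaresUse a b (sqs S) ℕ.+ lowerUse a b (low S)))
                 (≡-trans (sym (tot-++ _ (map arrive outs) (flat ps))) (≡-trans (cong (itemsUse a b) items≡) (arriveUse arr a b))) ⟩
          2 ℕ.* ((pendUse a b (map proj₁ arr) ℕ.+ steps a b v emitters) ℕ.+ pendUse a b rest) ℕ.+ (2 ℕ.* squaresUse a b (sqs S) ℕ.+ lowerUse a b (low S))
            ≡⟨ lemma₂ (pendUse a b (map proj₁ arr)) (steps a b v emitters) (pendUse a b rest) (2 ℕ.* squaresUse a b (sqs S) ℕ.+ lowerUse a b (low S)) ⟩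
          2 ℕ.* (pendUse a b (map proj₁ arr) ℕ.+ pendUse a b rest) ℕ.+ (2 ℕ.* squaresUse a b (sqs S) ℕ.+ lowerUse a b (low S)) ℕ.+ 2 ℕ.* steps a b v emitters
            ≡⟨ cong (λ x → 2 ℕ.* x ℕ.+ (2 ℕ.* squaresUse a b (sqs S) ℕ.+ lowerUse a b (low S)) ℕ.+ 2 ℕ.* steps a b v emitters)
                 (≡-trans (sym (tot-++ _ (map proj₁ arr) rest)) (tot-↭ _ perm)) ⟩
          cost S a b ℕ.+ 2 ℕ.* steps a b v emitters ∎
          where
          open ≡-Reasoning
          lemma : ∀ x r y s l → 2 ℕ.* (x ℕ.+ r) ℕ.+ (2 ℕ.* (y ℕ.+ s) ℕ.+ l) ≡ 2 ℕ.* ((x ℕ.+ y) ℕ.+ r) ℕ.+ (2 ℕ.* s ℕ.+ l)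
          lemma = solveℕ-∀
          lemma₂ : ∀ x s r l → 2 ℕ.* ((x ℕ.+ s) ℕ.+ r) ℕ.+ l ≡ 2 ℕ.* (x ℕ.+ r) ℕ.+ l ℕ.+ 2 ℕ.* s
          lemma₂ = solveℕ-∀

        away : ∀ {a b} → a ≢ v → b ≢ v → cost′ a b ≡ cost S a b
        away {a} {b} a≢ b≢ = ≡-trans (cost≡ a b) (≡-trans (cong (λ x → cost S a b ℕ.+ 2 ℕ.* x) (steps-away emitters a≢ b≢)) (ℕₚ.+-identityʳ _))

        at-v : ∀ {w} → w ≢ v → cost′ w v ≡ cost S w v ℕ.+ 2 ℕ.* count w emitters
        at-v {w} w≢ = ≡-trans (cost≡ w v) (cong (λ x → cost S w v ℕ.+ 2 ℕ.* x) (steps-count emitters w≢))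

        cost′-sym : ∀ a b → cost′ a b ≡ cost′ b a
        cost′-sym a b = ≡-trans (cost≡ a b) (≡-trans (cong₂ (λ x y → x ℕ.+ 2 ℕ.* y) (cost-sym S a b) (steps-sym a b v emitters)) (sym (cost≡ b a)))

        p∉emitters : ∀ {w} → w ∈ p → w ∉ emitters
        p∉emitters w∈ q with ∈-map⁻ emitter q
        ... | x , x∈ , refl = p∉c w∈ (Valid.e∈ (validArr x∈))

        zero-v : ∀ {w} → w ∈ p → cost′ w v ≡ 0
        zero-v {w} w∈ = ≡-trans (at-v (p≢v w∈)) (cong₂ (λ x y → x ℕ.+ 2 ℕ.* y) (local-p w∈) (count-∉ emitters (p∉emitters w∈)))

        bound-v : ∀ {w} → w ~ v → cost′ w v ℕ.≤ 4
        bound-v {w} w~v with w ∈? emitters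
        ... | no w∉ = ℕₚ.≤-trans (ℕₚ.≤-reflexive (≡-trans (at-v (λ eq → ~-irrefl eq w~v)) (≡-trans (cong (λ x → cost S w v ℕ.+ 2 ℕ.* x) (count-∉ emitters w∉)) (ℕₚ.+-identityʳ _)))) (bound S w~v)
        ... | yes w∈ with ∈-map⁻ emitter w∈
        -- At most two uses before, by `toI`, and two more for the only arrival from w.
        ... | (m , refl) , x∈ , refl = ℕₚ.≤-trans (ℕₚ.≤-reflexive (at-v (λ eq → ~-irrefl eq w~v)))
          (ℕₚ.+-mono-≤ (Valid.toI (validArr x∈) (arrJ x∈) Iv) (ℕₚ.*-monoʳ-≤ 2 (count-unique w emitters-unique)))

        toks′ : tokensIn f′ ↭ map (tok ∘ item) (us ++ rest) ++ concatMap Square.tokens (map toSquare ps ++ sqs S)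
        toks′ = begin
            tokensIn f′ ≡⟨ ≡-trans tokens-node (cong (_++ tokensIn c) (tokensAt-I Iv)) ⟩
            tokensIn c ↭⟨ toks S ⟩
            map (tok ∘ item) (pend S) ++ T ↭⟨ ++⁺ʳ T (map⁺ (tok ∘ item) (↭-sym perm)) ⟩
            map (tok ∘ item) (map proj₁ arr ++ rest) ++ T ≡⟨ cong (_++ T) (Listₚ.map-++ (tok ∘ item) (map proj₁ arr) rest) ⟩
            (map (tok ∘ item) (map proj₁ arr) ++ R) ++ T ≡⟨ cong (λ l → (l ++ R) ++ T) (≡-trans (sym (arriveToks arr)) (≡-trans (cong (map tok) (sym items≡)) (Listₚ.map-++ tok (map arrive outs) (flat ps)))) ⟩
            ((O ++ P) ++ R) ++ T ↭⟨ ++⁺ʳ T (↭-trans (++-assoc O P R) (↭-trans (++⁺ˡ O (++-comm P R)) (↭-sym (++-assoc O R P)))) ⟩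
            ((O ++ R) ++ P) ++ T ≡⟨ Listₚ.++-assoc (O ++ R) P T ⟩
            (O ++ R) ++ (P ++ T) ≡⟨ cong₂ _++_ (≡-trans (cong (_++ R) (sym us-tok)) (sym (Listₚ.map-++ (tok ∘ item) us rest)))
                                      (≡-trans (cong (_++ T) (sym (toSquares-tokens ps))) (sym (Listₚ.concatMap-++ Square.tokens (map toSquare ps) (sqs S)))) ⟩
            map (tok ∘ item) (us ++ rest) ++ concatMap Square.tokens (map toSquare ps ++ sqs S) ∎
          where
          open PermutationReasoning
          T = concatMap Square.tokens (sqs S)
          R = map (tok ∘ item) rest
          O = map tok (map arrive outs)
          P = map tok (flat ps)

        lows′ : lowerIn p f′ ↭ map Lower.ad (low S)
        lows′ = ↭-trans (↭-reflexive (cong₂ _++_ (lowerAt-I p Iv) (Listₚ.++-identityʳ (lowerIn (v ∷ p) c)))) (lows S)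

        sqs⊆′ : All (λ s → Near p f′ (Square.o₁ s) × Near p f′ (Square.o₂ s)) (map toSquare ps ++ sqs S)
        sqs⊆′ = Allₚ.++⁺ (pairs⊆ ps flat⊆) (All.map (λ (x , y) → near′ x , near′ y) (sqs⊆ S))
          where
          pairs⊆ : ∀ ps → All (λ x → o x ∈ verts c) (flat ps) → All (λ s → Near p f′ (Square.o₁ s) × Near p f′ (Square.o₂ s)) (map toSquare ps)
          pairs⊆ []       _            = []
          pairs⊆ (_ ∷ ps) (x ∷ y ∷ xs) = (inj₁ (in′ x) , inj₁ (in′ y)) ∷ pairs⊆ ps xs

        bound′ : ∀ {a b} → a ~ b → cost′ a b ℕ.≤ 4
        bound′ {a} {b} a~b with a Finₚ.≟ v | b Finₚ.≟ v
        ... | yes refl | _        = ℕₚ.≤-trans (ℕₚ.≤-reflexive (cost′-sym v b)) (bound-v (~-sym a~b))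
        ... | no _     | yes refl = bound-v a~b
        ... | no a≢    | no b≢    = ℕₚ.≤-trans (ℕₚ.≤-reflexive (away a≢ b≢)) (bound S a~b)

        local′ : ∀ {a b} → a ∉ verts f′ → b ∉ verts f′ → cost′ a b ≡ 0
        local′ = λ a∉ b∉ → ≡-trans (away (λ { refl → a∉ (here refl) }) (λ { refl → b∉ (here refl) })) (local S (a∉ ∘ in′) (b∉ ∘ in′))

        state : AllPairs Related (us ++ rest) → (∀ C → (∀ {y} → y ∈ p → C v y ≡ 0) → All (Valid p f′ C) us) → State p f′
        state us-rel us-valid = record
          { pend = us ++ rest ; sqs = map toSquare ps ++ sqs S ; low = low S
          ; valid = Allₚ.++⁺ (us-valid cost′ (λ y∈ → ≡-trans (cost′-sym v _) (zero-v y∈))) (restValid cost′ (λ m∈ → ℕₚ.≤-reflexive (away (c≢v (Valid.e∈ (validRest m∈))) (rest-t m∈))))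
          ; rel = us-rel ; toks = toks′ ; lows = lows′ ; sqs⊆ = sqs⊆′ ; bound = bound′ ; local = local′
          ; upI = λ i∈ Ii y∈ → [ (λ { refl → ≡-trans (cost′-sym v _) (zero-v y∈) }) , (λ q → ≡-trans (away (c≢v q) (p≢v y∈)) (upI S q Ii (there y∈))) ]′ (out′ i∈)
          ; upJ = λ d∈ Jd y∈ Jy → [ (λ { refl → case ≡-trans (sym Iv) Jd of λ () }) , (λ q → ℕₚ.≤-trans (ℕₚ.≤-reflexive (away (c≢v q) (p≢v y∈))) (upJ S q Jd (there y∈) Jy)) ]′ (out′ d∈)
          ; back = λ { (here refl) Jd _ _ → case ≡-trans (sym Iv) Jd of λ () }
          ; quiet = λ { (here refl) Jd _ _ → case ≡-trans (sym Iv) Jd of λ () } }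

      o∈c : ∀ xs → (∀ {x} → x ∈ xs → x ∈ arr) → All (λ x → o x ∈ verts c) (map arrive xs)
      o∈c xs sub = Allₚ.map⁺ (All.tabulate (λ {x} x∈ → subst (_∈ verts c) (sym (arrive-o x)) (Valid.o∈ (validArr (sub x∈)))))

      -- The second component tells a root directly above v that, if nothing is pending, all
      -- arrivals were paired at v and may be paired anew.
      StepI : Set
      StepI = Σ[ S′ ∈ State p f′ ] (pend S′ ≡ [] → rest ≡ [] × Even (length (map arrive arr)))

      stepI : ∀ {z} → z ∈ p → z ~ v → StepI
      stepI z∈p z~v with parity (length (map arrive arr))
      ... | inj₁ even with pairUp (map arrive arr) (compat arr id relArr) even
      ... | ps , eq = Finish.state [] ps [] eq (λ _ _ → refl) refl (subst (All _) (sym eq) (o∈c arr id)) relRest (λ _ _ → []) , λ q → q , even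
      stepI z∈p z~v | inj₂ odd = go arr refl odd
        where
        go : ∀ xs → xs ≡ arr → Even (suc (length (map arrive xs))) → StepI
        go ((m , refl) ∷ xs) eq odd with pairUp (map arrive xs) (compat xs (λ q → subst (_ ∈_) eq (there q)) (AllPairs.tail (subst (AllPairs Related ∘ map proj₁) (sym eq) relArr))) (suc₂⁻¹ odd)
        ... | ps , eq′ with topmost v p z∈p z~v
        ... | y , top , y∈ , y~v = Finish.state (em ∷ []) ps ((m , refl) ∷ []) (≡-trans (cong (crossed m ∷_) eq′) (cong (map arrive) eq)) (λ _ _ → refl) refl
              (subst (All _) (sym eq′) (o∈c xs (λ q → subst (_ ∈_) eq (there q))))
              (All.tabulate relate ∷ relRest) (λ C z → record
                { e∈ = here refl ; t∈ = y∈ ; o∈ = in′ (Valid.o∈ mv)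
                ; kind = isI Iv top (σ-or (tag m) (Valid.kind mv) (arr-tag m∈)) (c≢v (Valid.o∈ mv))
                ; toI = λ _ _ → ℕₚ.≤-trans (ℕₚ.≤-reflexive (z y∈)) z≤n
                ; toJ = λ _ _ → ℕₚ.≤-trans (ℕₚ.≤-reflexive (z y∈)) z≤n } ∷ []) , λ ()
          where
          m∈ : (m , refl) ∈ arr
          m∈ = subst (_ ∈_) eq (here refl)
          mv = validArr m∈
          em : Emission
          em = record { e = v ; t = y ; e~t = ~-sym y~v ; item = crossed m ; tag = tI }
          -- A tL item has residue -1 after crossing to v; the origin of a tU item has no neighbour
          -- further up. Either way, a later item with the same origin will not clash.
          σ-or : ∀ k → Kind (v ∷ p) c m k → k ≢ tI → not (σ (item m)) ≡ false ⊎ (∀ {w} → w ∈ p → ¬ w ~ origin m)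
          σ-or tI _                  ≢I = contradiction refl ≢I
          σ-or tL (isL _ _ σ≡ _ _)   _  = inj₁ (cong not σ≡)
          σ-or tU (isU _ q)          _  = inj₂ (λ w∈ → q (there w∈))
          relate : ∀ {m′} → m′ ∈ rest → Related em m′
          relate m′∈ = (λ eq → v∉c (subst (_∈ verts c) (sym eq) (Valid.e∈ (validRest m′∈))))
            , (λ ≢I _ → contradiction refl ≢I) , (λ _ L → contradiction L (rest-notL m′∈)) , (λ _ ())

  -- Tokens and J-J walks at a vertex of J

  tI? : ∀ k → Dec (k ≡ tI)
  tI? tI = yes refl
  tI? tL = no λ ()
  tI? tU = no λ ()

  tL? : ∀ k → Dec (k ≡ tL)
  tL? tI = no λ ()
  tL? tL = yes refl
  tL? tU = no λ ()

  Own : V → Set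
  Own v = Σ[ i ∈ V ] (inI i ≡ true × i ~ v)

  mkOwn : ∀ {v} → Own v → Item v
  mkOwn (i , Ii , i~v) = own Ii i~v

  ownUse : ∀ {v} (xs : List (Own v)) a b → itemsUse a b (map mkOwn xs) ≡ steps a b v (map proj₁ xs)
  ownUse []       a b = refl
  ownUse {v} ((i , _) ∷ xs) a b = cong₂ ℕ._+_ (ℕₚ.+-identityʳ (same a b (i , v))) (ownUse xs a b)

  ownToks : ∀ {v} (xs : List (Own v)) → map tok (map mkOwn xs) ≡ map (_, v) (map proj₁ xs)
  ownToks []       = refl
  ownToks (x ∷ xs) = cong (_ ∷_) (ownToks xs)

  Consumable : ∀ {v} → Arrival v → Set
  Consumable (m , _) = inI (e m) ≡ true × origin m ≢ e m

  -- The pair is formed at u, before the item would cross to v. The origins differ because the item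
  -- comes from elsewhere, as recorded in `isI`.
  consume : ∀ {v} → Σ (Arrival v) Consumable → Square
  consume {v} ((m , _) , Ie , o≢e) = square (origin m) (j (item m)) (e m) v (pair (item m) (stay Ie v) (inj₁ o≢e))

  consumeUse : ∀ {v} (xs : List (Σ (Arrival v) Consumable)) a b → squaresUse a b (map consume xs) ≡ pendUse a b (map (proj₁ ∘ proj₁) xs)
  consumeUse []                          a b = refl
  consumeUse {v} (((m , _) , Ie , o≢e) ∷ xs) a b = cong₂ ℕ._+_ (≡-trans (pair-uses (item m) (stay Ie v) (inj₁ o≢e) a b) (ℕₚ.+-identityʳ _)) (consumeUse xs a b)

  consumeToks : ∀ {v} (xs : List (Σ (Arrival v) Consumable)) →
                concatMap Square.tokens (map consume xs) ↭ map (tok ∘ item) (map (proj₁ ∘ proj₁) xs) ++ map (_, v) (map (emitter ∘ proj₁) xs)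
  consumeToks []                    = ↭-refl
  consumeToks {v} (((m , _) , _) ∷ xs) = prep (tok (item m)) (↭-trans (prep (e m , v) (consumeToks xs))
    (↭-sym (shift (e m , v) (map (tok ∘ item) (map (proj₁ ∘ proj₁) xs)) (map (_, v) (map (emitter ∘ proj₁) xs)))))

  -- Of the edges from v up to J, all but the topmost a are covered by a − a′ with a′ the next one up;
  -- the topmost one needs a walk from v into I.
  record Exit (v : V) : Set where
    field
      i    : V
      Ii   : inI i ≡ true
      {s}  : ℤ
      dir  : Direction
      adj  : All Adjacent dir
      vec≡ : ∀ x → vec dir x ≡ δ v x + s * δ i x

  module Chain {v : V} (Jv : inI v ≡ false) (ex : Exit v) where
    module E = Exit ex

    OK : V → Set
    OK a = inI a ≡ false × a ~ v × dep a ℕ.< dep v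

    -- From e_a + e_v the exit e_v + s e_i is subtracted. What remains at i ∈ I is invisible to the
    -- J-J forms.
    last : ∀ a → OK a → Lower
    last a (Ja , a~v , a<v) = record
      { a = a ; d = v ; dir = (1ℤ , a , v) ∷ scale -1ℤ E.dir ; adj = a~v ∷ adj-scale -1ℤ E.adj
      ; Ja = Ja ; Jd = Jv ; a<d = a<v
      ; vec-a = ≡-trans (eq a) (cong₂ (λ x y → x + - E.s * y) (χ-yes (a Finₚ.≟ a) refl) (χ-no (E.i Finₚ.≟ a) (J⇒≢I E.Ii Ja)) ⟨≡⟩ cong (1ℤ +_) (ℤₚ.*-zeroʳ (- E.s)))
      ; vec-0 = λ x x≢a Jx _ → ≡-trans (eq x) (cong₂ (λ y z → y + - E.s * z) (χ-no (a Finₚ.≟ x) (x≢a ∘ sym)) (χ-no (E.i Finₚ.≟ x) (J⇒≢I E.Ii Jx)) ⟨≡⟩ cong (0ℤ +_) (ℤₚ.*-zeroʳ (- E.s))) }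
      where
      infixr 5 _⟨≡⟩_
      _⟨≡⟩_ = ≡-trans
      lemma : ∀ a v s i → 1ℤ * (a + v) + -1ℤ * (v + s * i) ≡ a + - s * i
      lemma = solve-∀
      eq : ∀ x → vec ((1ℤ , a , v) ∷ scale -1ℤ E.dir) x ≡ δ a x + - E.s * δ E.i x
      eq x = ≡-trans (cong (1ℤ * (δ a x + δ v x) +_) (≡-trans (vec-scale -1ℤ E.dir x) (cong (-1ℤ *_) (E.vec≡ x)))) (lemma (δ a x) (δ v x) E.s (δ E.i x))

    -- The effect is e_a - e_a′ with a′ further up, where triangularity in the depth makes no
    -- demand.
    mid : ∀ a a′ → OK a → OK a′ → dep a′ ℕ.< dep a → Lower
    mid a a′ (Ja , a~v , a<v) (_ , a′~v , _) a′<a = record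
      { a = a ; d = v ; dir = (1ℤ , a , v) ∷ (-1ℤ , a′ , v) ∷ [] ; adj = a~v ∷ a′~v ∷ []
      ; Ja = Ja ; Jd = Jv ; a<d = a<v
      ; vec-a = ≡-trans (lemma (δ a a) (δ v a) (δ a′ a)) (cong₂ (λ x y → x + - y) (χ-yes (a Finₚ.≟ a) refl) (χ-no (a′ Finₚ.≟ a) (λ { refl → ℕₚ.<-irrefl refl a′<a })))
      ; vec-0 = λ x x≢a Jx a≤x → ≡-trans (lemma (δ a x) (δ v x) (δ a′ x)) (cong₂ (λ y z → y + - z) (χ-no (a Finₚ.≟ x) (x≢a ∘ sym))
          (χ-no (a′ Finₚ.≟ x) (λ { refl → ℕₚ.<-irrefl refl (ℕₚ.<-≤-trans a′<a a≤x) }))) }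
      where
      lemma : ∀ a v a′ → 1ℤ * (a + v) + (-1ℤ * (a′ + v) + 0ℤ) ≡ a + - a′
      lemma = solve-∀

    chain : ∀ l → All OK l → AllPairs (λ x y → dep y ℕ.< dep x) l → List Lower
    chain []           _              _                = []
    chain (a ∷ [])     (p ∷ [])       _                = last a p ∷ []
    chain (a ∷ a′ ∷ l) (p ∷ p′ ∷ ps) ((q ∷ _) ∷ qs) = mid a a′ p p′ q ∷ chain (a′ ∷ l) (p′ ∷ ps) qs

    chain-ad : ∀ l ps qs → map Lower.ad (chain l ps qs) ≡ map (_, v) l
    chain-ad []           _              _                = refl
    chain-ad (a ∷ [])     (p ∷ [])       _                = refl
    chain-ad (a ∷ a′ ∷ l) (p ∷ p′ ∷ ps) ((q ∷ _) ∷ qs) = cong ((a , v) ∷_) (chain-ad (a′ ∷ l) (p′ ∷ ps) qs)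

    -- Every upper neighbour starts one walk, and all but the nearest one x also end one; the exit
    -- is used once, by the topmost.
    chain-use : ∀ x l ps qs a b → lowerUse a b (chain (x ∷ l) ps qs) ≡ steps a b v (x ∷ l) ℕ.+ steps a b v l ℕ.+ uses a b E.dir
    chain-use x []      (p ∷ [])      _              a b = ≡-trans (ℕₚ.+-identityʳ _) (≡-trans (cong (same a b (x , v) ℕ.+_) (uses-scale a b -1ℤ E.dir)) (lemma (same a b (x , v)) (uses a b E.dir)))
      where
      lemma : ∀ s u → s ℕ.+ u ≡ (s ℕ.+ 0) ℕ.+ 0 ℕ.+ u
      lemma = solveℕ-∀
    chain-use x (x′ ∷ l) (p ∷ p′ ∷ ps) ((q ∷ _) ∷ qs) a b = ≡-trans (cong ((same a b (x , v) ℕ.+ (same a b (x′ , v) ℕ.+ 0)) ℕ.+_) (chain-use x′ l (p′ ∷ ps) qs a b))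
      (lemma (same a b (x , v)) (same a b (x′ , v)) (steps a b v l) (uses a b E.dir))
      where
      lemma : ∀ s s′ l u → (s ℕ.+ (s′ ℕ.+ 0)) ℕ.+ ((s′ ℕ.+ l) ℕ.+ l ℕ.+ u) ≡ (s ℕ.+ (s′ ℕ.+ l)) ℕ.+ (s′ ℕ.+ l) ℕ.+ u
      lemma = solveℕ-∀

  -- Pools of tokens at a vertex of J

  module JNode {p : List V} {v : V} {c : Forest V} (S : State (v ∷ p) c)
               (nb : ∀ {w} → v ~ w → w ∈ p ⊎ w ∈ verts c)
               (v∉c : v ∉ verts c) (p∉ : ∀ {a} → a ∈ p → a ∉ v ∷ verts c) (Jv : inI v ≡ false) where
    open Node S nb v∉c p∉ public

    private
      ?I : (x : Arrival v) → Dec (tag (proj₁ x) ≡ tI)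
      ?I x = tI? (tag (proj₁ x))

    arrI arrJ : List (Arrival v)
    arrI = filter ?I arr
    arrJ = filter (¬? ∘ ?I) arr

    arr↭ : arrI ++ arrJ ↭ arr
    arr↭ = filter-↭ ?I arr

    ∈arrI : ∀ {x} → x ∈ arrI → x ∈ arr × tag (proj₁ x) ≡ tI
    ∈arrI = ∈-filter⁻ ?I {xs = arr}

    ∈arrJ : ∀ {x} → x ∈ arrJ → x ∈ arr × tag (proj₁ x) ≢ tI
    ∈arrJ = ∈-filter⁻ (¬? ∘ ?I) {xs = arr}

    relIJ : AllPairs Related (map proj₁ arrI ++ map proj₁ arrJ)
    relIJ = subst (AllPairs Related) (Listₚ.map-++ proj₁ arrI arrJ)
      (AllPairs-↭ (λ {m} {m′} → Related-sym {m} {m′}) (map⁺ proj₁ (↭-sym arr↭)) relArr)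

    record FromI (m : Emission) : Set where
      field
        Ie   : inI (e m) ≡ true
        e∈c  : e m ∈ verts c
        e~v  : e m ~ v
        top  : ∀ {w} → w ∈ p → ¬ w ~ e m
        σ∨   : σ (item m) ≡ false ⊎ (∀ {z} → z ∈ v ∷ p → ¬ z ~ origin m)
        o≢e  : origin m ≢ e m
        o∈c  : origin m ∈ verts c

    fromI : ∀ {x} → x ∈ arrI → FromI (proj₁ x)
    fromI {m , refl} x∈ with ∈arrI x∈
    ... | x∈arr , tag≡ with subst (Kind (v ∷ p) c m) tag≡ (Valid.kind (validArr x∈arr))
    ... | isI Ie (here top)  σ∨ o≢e = record { Ie = Ie ; e∈c = Valid.e∈ (validArr x∈arr) ; e~v = e~t m ; top = top ; σ∨ = σ∨ ; o≢e = o≢e ; o∈c = Valid.o∈ (validArr x∈arr) }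
    ... | isI Ie (there top) σ∨ o≢e = contradiction (inPath top) (λ q → p≢v q refl)
      where
      inPath : ∀ {q y} → Topmost (e m) q y → y ∈ q
      inPath (here _)  = here refl
      inPath (there t) = there (inPath t)

    data FromJ (m : Emission) : Set where
      fromL : inI (e m) ≡ false → origin m ~ e m → σ (item m) ≡ true → e m ∈ roots c → tag m ≡ tL → FromJ m
      fromU : inI (e m) ≡ false → (∀ {z} → z ∈ v ∷ p → ¬ z ~ origin m) → tag m ≡ tU → FromJ m

    fromJ : ∀ {x} → x ∈ arrJ → FromJ (proj₁ x)
    fromJ {m , refl} x∈ with ∈arrJ x∈
    ... | x∈arr , ≢I with tag m in eq | Valid.kind (validArr x∈arr)
    ... | tI | _                  = contradiction refl ≢I
    ... | tL | isL J o~ σ≡ head r = fromL J o~ σ≡ r eq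
    ... | tU | isU J q            = fromU J q eq

    J-arrJ : ∀ {x} → x ∈ arrJ → inI (emitter x) ≡ false
    J-arrJ x∈ with fromJ x∈
    ... | fromL J _ _ _ _ = J
    ... | fromU J _ _     = J

    us : List V
    us = map emitter arrI

    unique-us : Unique us
    unique-us = subst Unique (sym (Listₚ.map-∘ {g = e} {f = proj₁} arrI)) (AllPairsₚ.map⁺ (AllPairs.map proj₁ (AllPairs-++ˡ (map proj₁ arrI) relIJ)))

    us-from : ∀ {u} → u ∈ us → ∃[ x ] (x ∈ arrI × u ≡ emitter x)
    us-from u∈ = ∈-map⁻ emitter u∈

    nbrI⁻ : ∀ {i} → i ∈ nbrsI v → inI i ≡ true × i ~ v
    nbrI⁻ i∈ = proj₂ (∈-filter⁻ (λ i → I? i ×-dec (i ~? v)) {xs = allFin n} i∈)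

    nbrI⁺ : ∀ {i} → inI i ≡ true → i ~ v → i ∈ nbrsI v
    nbrI⁺ {i} Ii i~v = ∈-filter⁺ (λ i → I? i ×-dec (i ~? v)) (∈-allFin i) (Ii , i~v)

    unique-nbrs : Unique (nbrsI v)
    unique-nbrs = Uniqueₚ.filter⁺ (λ i → I? i ×-dec (i ~? v)) (Uniqueₚ.allFin⁺ n)

    -- The neighbours in I whose tokens must be brought to v, as no arrival from them is available
    -- to consume the token at its origin.
    A : List V
    A = filter (λ i → ¬? (i ∈? us)) (nbrsI v)

    A⁻ : ∀ {i} → i ∈ A → (inI i ≡ true × i ~ v) × i ∉ us
    A⁻ i∈ = let q , i∉ = ∈-filter⁻ (λ i → ¬? (i ∈? us)) {xs = nbrsI v} i∈ in nbrI⁻ q , i∉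

    A⁺ : ∀ {i} → inI i ≡ true → i ~ v → i ∉ us → i ∈ A
    A⁺ Ii i~v i∉ = ∈-filter⁺ (λ i → ¬? (i ∈? us)) (nbrI⁺ Ii i~v) i∉

    unique-A : Unique A
    unique-A = Uniqueₚ.filter⁺ (λ i → ¬? (i ∈? us)) unique-nbrs

    nbrs↭ : nbrsI v ↭ A ++ us
    nbrs↭ = ↭-trans (↭-sym (filter-↭ (_∈? us) (nbrsI v))) (↭-trans (++-comm (filter (_∈? us) (nbrsI v)) A) (++⁺ˡ A
      (unique-↭ (Uniqueₚ.filter⁺ (_∈? us) unique-nbrs) unique-us (λ q → proj₂ (∈-filter⁻ (_∈? us) {xs = nbrsI v} q))
        (λ q → let x , x∈ , eq = us-from q in
               ∈-filter⁺ (_∈? us) (subst (_∈ nbrsI v) (sym eq) (nbrI⁺ (FromI.Ie (fromI x∈)) (FromI.e~v (fromI x∈)))) q))))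

    AO : List (Own v)
    AO = attach A (λ i∈ → proj₁ (A⁻ i∈))

    AO≡ : map proj₁ AO ≡ A
    AO≡ = attach-map A (λ i∈ → proj₁ (A⁻ i∈))

    compatOwn : (xs : List (Own v)) → Unique (map proj₁ xs) → AllPairs Compat (map mkOwn xs)
    compatOwn []       _        = []
    compatOwn (x ∷ xs) (q ∷ qs) = Allₚ.map⁺ (All.map (inj₁) (Allₚ.map⁻ q)) ∷ compatOwn xs qs

    compatJ : AllPairs Compat (map arrive arrJ)
    compatJ = go arrJ id (AllPairs-++ʳ (map proj₁ arrI) relIJ)
      where
      go : ∀ xs → (∀ {x} → x ∈ xs → x ∈ arrJ) → AllPairs Related (map proj₁ xs) → AllPairs Compat (map arrive xs)
      go []       _   _        = []
      go (x ∷ xs) sub (r ∷ rs) = Allₚ.map⁺ (All.tabulate (λ {x′} x′∈ → inj₁ (λ eq →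
          proj₁ (proj₂ (All.lookup r (∈-map⁺ proj₁ x′∈))) (proj₂ (∈arrJ (sub (here refl)))) (proj₂ (∈arrJ (sub (there x′∈))))
            (≡-trans (sym (arrive-o x)) (≡-trans eq (arrive-o x′))))))
        ∷ go xs (sub ∘ there) rs

    -- A tL arrival has residue -1 against the +1 of an own token. The origin of a tU arrival is not
    -- adjacent to v, so it is a different one.
    compatOwnJ : ∀ (x : Own v) {y} → y ∈ arrJ → Compat (mkOwn x) (arrive y)
    compatOwnJ (i , Ii , i~v) {y} y∈ with fromJ y∈
    ... | fromL _ _ σ≡ _ _ = inj₂ (λ eq → case ≡-trans eq (≡-trans (arrive-σ y) (cong not σ≡)) of λ ())
    ... | fromU _ far _    = inj₁ (λ eq → far (here refl) (subst (v ~_) (≡-trans eq (arrive-o y)) (~-sym i~v)))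

    base : AllPairs Compat (map mkOwn AO ++ map arrive arrJ)
    base = AllPairsₚ.++⁺ (compatOwn AO (subst Unique (sym AO≡) unique-A)) compatJ
      (Allₚ.map⁺ (All.tabulate (λ {x} _ → Allₚ.map⁺ (All.tabulate (λ y∈ → compatOwnJ x y∈)))))

    nearOwn : ∀ (x : Own v) → Near p f′ (proj₁ x)
    nearOwn (i , Ii , i~v) = [ inj₂ , inj₁ ∘ in′ ]′ (nb (~-sym i~v))

    nearArr : ∀ {x} → x ∈ arr → Near p f′ (o (arrive x))
    nearArr {x} x∈ = inj₁ (in′ (subst (_∈ verts c) (sym (arrive-o x)) (Valid.o∈ (validArr x∈))))

    -- An arrival from u ∈ I in con is paired with the token (u , v) without using the edge uv, whereas both the arrivals un
    -- and the tokens unO of their emitters are brought to v.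
    module Core (un con : List (Arrival v)) (permI : un ++ con ↭ arrI)
                (unO : List (Own v)) (unO≡ : map proj₁ unO ≡ map emitter un)
                (outs : List (Item v)) (ps : List (Pair v))
                (items↭ : outs ++ flat ps ↭ map mkOwn (AO ++ unO) ++ map arrive (un ++ arrJ)) where

      con⊆ : ∀ {x} → x ∈ con → x ∈ arrI
      con⊆ x∈ = ∈-resp-↭ permI (∈-++⁺ʳ un x∈)

      un⊆ : ∀ {x} → x ∈ un → x ∈ arrI
      un⊆ x∈ = ∈-resp-↭ permI (∈-++⁺ˡ x∈)

      conC : List (Σ (Arrival v) Consumable)
      conC = attach con (λ x∈ → let open FromI (fromI (con⊆ x∈)) in Ie , o≢e)

      conC≡ : map proj₁ conC ≡ con
      conC≡ = attach-map con _

      newSqs : List Square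
      newSqs = map toSquare ps ++ map consume conC

      -- `S2` lists the steps to v inside squares or pending items, each to be counted twice. A
      -- vertex of `un` occurs twice: for its own token and for its arrival.
      eun eJ S2 : List V
      eun = map emitter un
      eJ  = map emitter arrJ
      S2  = (A ++ eun) ++ (eun ++ eJ)

      pend↭ : pend S ↭ (map proj₁ un ++ map proj₁ con) ++ map proj₁ arrJ ++ rest
      pend↭ = ↭-trans (↭-sym perm) (↭-trans (++⁺ʳ rest (↭-trans (map⁺ proj₁ (↭-sym arr↭)) (↭-reflexive (Listₚ.map-++ proj₁ arrI arrJ))))
        (↭-trans (++-assoc (map proj₁ arrI) (map proj₁ arrJ) rest)
                 (++⁺ʳ (map proj₁ arrJ ++ rest) (↭-trans (map⁺ proj₁ (↭-sym permI)) (↭-reflexive (Listₚ.map-++ proj₁ un con))))))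

      use≡ : ∀ a b → (itemsUse a b outs ℕ.+ pendUse a b rest) ℕ.+ squaresUse a b newSqs ≡ pendUse a b (pend S) ℕ.+ steps a b v S2
      use≡ a b = begin
        (O ℕ.+ R) ℕ.+ squaresUse a b newSqs
          ≡⟨ cong ((O ℕ.+ R) ℕ.+_) (≡-trans (tot-++ _ (map toSquare ps) (map consume conC)) (cong₂ ℕ._+_ (toSquares-uses ps a b)
               (≡-trans (consumeUse conC a b) (cong (pendUse a b) (≡-trans (Listₚ.map-∘ conC) (cong (map proj₁) conC≡)))))) ⟩
        (O ℕ.+ R) ℕ.+ (F ℕ.+ C)
          ≡⟨ lemma₁ O R F C ⟩
        (O ℕ.+ F) ℕ.+ (R ℕ.+ C)
          ≡⟨ cong (ℕ._+ (R ℕ.+ C)) (≡-trans (sym (tot-++ _ outs (flat ps))) (≡-trans (tot-↭ _ items↭) (≡-trans (tot-++ _ (map mkOwn (AO ++ unO)) (map arrive (un ++ arrJ)))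
               (cong₂ ℕ._+_ (≡-trans (ownUse (AO ++ unO) a b) (cong (steps a b v) (≡-trans (Listₚ.map-++ proj₁ AO unO) (cong₂ _++_ AO≡ unO≡))))
                            (≡-trans (arriveUse (un ++ arrJ) a b) (cong₂ ℕ._+_ (≡-trans (cong (pendUse a b) (Listₚ.map-++ proj₁ un arrJ)) (tot-++ _ (map proj₁ un) (map proj₁ arrJ)))
                                                                              (cong (steps a b v) (Listₚ.map-++ emitter un arrJ)))))))) ⟩
        (X ℕ.+ ((U ℕ.+ K) ℕ.+ Y)) ℕ.+ (R ℕ.+ C)
          ≡⟨ lemma₂ X U K Y R C ⟩
        ((U ℕ.+ C) ℕ.+ (K ℕ.+ R)) ℕ.+ (X ℕ.+ Y)
          ≡⟨ cong₂ ℕ._+_ (sym (≡-trans (tot-↭ _ pend↭) (≡-trans (tot-++ _ (map proj₁ un ++ map proj₁ con) (map proj₁ arrJ ++ rest))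
               (cong₂ ℕ._+_ (tot-++ _ (map proj₁ un) (map proj₁ con)) (tot-++ _ (map proj₁ arrJ) rest))))) (sym (tot-++ _ (A ++ eun) (eun ++ eJ))) ⟩
        pendUse a b (pend S) ℕ.+ steps a b v S2 ∎
        where
        open ≡-Reasoning
        O = itemsUse a b outs
        R = pendUse a b rest
        F = itemsUse a b (flat ps)
        C = pendUse a b (map proj₁ con)
        U = pendUse a b (map proj₁ un)
        K = pendUse a b (map proj₁ arrJ)
        X = steps a b v (A ++ eun)
        Y = steps a b v (eun ++ eJ)
        lemma₁ : ∀ o r f c → (o ℕ.+ r) ℕ.+ (f ℕ.+ c) ≡ (o ℕ.+ f) ℕ.+ (r ℕ.+ c)
        lemma₁ = solveℕ-∀
        lemma₂ : ∀ x u k y r c → (x ℕ.+ ((u ℕ.+ k) ℕ.+ y)) ℕ.+ (r ℕ.+ c) ≡ ((u ℕ.+ c) ℕ.+ (k ℕ.+ r)) ℕ.+ (x ℕ.+ y)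
        lemma₂ = solveℕ-∀

      toks↭ : map (_, v) (nbrsI v) ++ map (tok ∘ item) (pend S) ↭ (map tok outs ++ map (tok ∘ item) rest) ++ concatMap Square.tokens newSqs
      toks↭ = begin
        map (_, v) (nbrsI v) ++ map (tok ∘ item) (pend S)
          ↭⟨ ++⁺ (map⁺ (_, v) (↭-trans nbrs↭ (++⁺ˡ A (↭-trans (map⁺ emitter (↭-sym permI)) (↭-reflexive (Listₚ.map-++ emitter un con)))))) (map⁺ (tok ∘ item) pend↭) ⟩
        map (_, v) (A ++ eun ++ econ) ++ map (tok ∘ item) ((map proj₁ un ++ map proj₁ con) ++ map proj₁ arrJ ++ rest)
          ≡⟨ cong₂ _++_ (≡-trans (Listₚ.map-++ (_, v) A (eun ++ econ)) (cong (τA ++_) (Listₚ.map-++ (_, v) eun econ)))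
               (≡-trans (Listₚ.map-++ (tok ∘ item) (map proj₁ un ++ map proj₁ con) (map proj₁ arrJ ++ rest))
                 (cong₂ _++_ (Listₚ.map-++ (tok ∘ item) (map proj₁ un) (map proj₁ con)) (Listₚ.map-++ (tok ∘ item) (map proj₁ arrJ) rest))) ⟩
        (τA ++ (τU ++ τC)) ++ ((ιU ++ ιC) ++ (ιJ ++ ιR))
          ↭⟨ reorder τA τU τC ιU ιC ιJ ιR ⟩
        ((τA ++ τU) ++ (ιU ++ ιJ)) ++ (ιR ++ (ιC ++ τC))
          ↭⟨ ++⁺ pool (++⁺ˡ ιR (↭-sym consumed)) ⟩
        (map tok outs ++ map tok (flat ps)) ++ (ιR ++ concatMap Square.tokens (map consume conC))
          ↭⟨ interchange (map tok outs) (map tok (flat ps)) ιR (concatMap Square.tokens (map consume conC)) ⟩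
        (map tok outs ++ ιR) ++ (map tok (flat ps) ++ concatMap Square.tokens (map consume conC))
          ≡⟨ cong ((map tok outs ++ ιR) ++_) (≡-trans (cong (_++ concatMap Square.tokens (map consume conC)) (sym (toSquares-tokens ps))) (sym (Listₚ.concatMap-++ Square.tokens (map toSquare ps) (map consume conC)))) ⟩
        (map tok outs ++ ιR) ++ concatMap Square.tokens newSqs ∎
        where
        open PermutationReasoning
        econ = map emitter con
        τA = map (_, v) A
        τU = map (_, v) eun
        τC = map (_, v) econ
        ιU = map (tok ∘ item) (map proj₁ un)
        ιC = map (tok ∘ item) (map proj₁ con)
        ιJ = map (tok ∘ item) (map proj₁ arrJ)
        ιR = map (tok ∘ item) rest
        reorder : ∀ {X : Set} (a b c d e f g : List X) → (a ++ (b ++ c)) ++ ((d ++ e) ++ (f ++ g)) ↭ ((a ++ b) ++ (d ++ f)) ++ (g ++ (e ++ c))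
        reorder a b c d e f g = ↭-trans (++⁺ (↭-reflexive (sym (Listₚ.++-assoc a b c))) (interchange d e f g))
          (↭-trans (interchange (a ++ b) c (d ++ f) (e ++ g)) (++⁺ˡ ((a ++ b) ++ (d ++ f)) (↭-trans (↭-reflexive (sym (Listₚ.++-assoc c e g))) (↭-trans (++-comm (c ++ e) g) (++⁺ˡ g (++-comm c e))))))
        pool : (τA ++ τU) ++ (ιU ++ ιJ) ↭ map tok outs ++ map tok (flat ps)
        pool = ↭-sym (↭-trans (↭-reflexive (sym (Listₚ.map-++ tok outs (flat ps)))) (↭-trans (map⁺ tok items↭)
          (↭-reflexive (≡-trans (Listₚ.map-++ tok (map mkOwn (AO ++ unO)) (map arrive (un ++ arrJ))) (cong₂ _++_
            (≡-trans (ownToks (AO ++ unO)) (≡-trans (cong (map (_, v)) (≡-trans (Listₚ.map-++ proj₁ AO unO) (cong₂ _++_ AO≡ unO≡))) (Listₚ.map-++ (_, v) A eun)))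
            (≡-trans (arriveToks (un ++ arrJ)) (≡-trans (cong (map (tok ∘ item)) (Listₚ.map-++ proj₁ un arrJ)) (Listₚ.map-++ (tok ∘ item) (map proj₁ un) (map proj₁ arrJ)))))))))
        consumed : concatMap Square.tokens (map consume conC) ↭ ιC ++ τC
        consumed = ↭-trans (consumeToks conC) (↭-reflexive (cong₂ _++_ (cong (map (tok ∘ item)) (≡-trans (Listₚ.map-∘ conC) (cong (map proj₁) conC≡)))
                                                                       (cong (map (_, v)) (≡-trans (Listₚ.map-∘ conC) (cong (map emitter) conC≡)))))

      near-flat : All (λ x → Near p f′ (o x)) (flat ps)
      near-flat = Allₚ.++⁻ʳ outs (All-resp-↭ (↭-sym items↭) (Allₚ.++⁺
        (Allₚ.map⁺ (All.tabulate (λ {x} _ → nearOwn x)))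
        (Allₚ.map⁺ (All.tabulate (λ {x} x∈ → nearArr ([ (λ q → proj₁ (∈arrI (un⊆ q))) , (λ q → proj₁ (∈arrJ q)) ]′ (∈-++⁻ un x∈)))))))

      newSqs⊆ : All (λ s → Near p f′ (Square.o₁ s) × Near p f′ (Square.o₂ s)) newSqs
      newSqs⊆ = Allₚ.++⁺ (paired ps near-flat) (Allₚ.map⁺ (All.tabulate (λ { {(m , eq) , _} q →
          let open FromI (fromI (con⊆ (subst ((m , eq) ∈_) conC≡ (∈-map⁺ proj₁ q)))) in inj₁ (in′ o∈c) , inj₁ (in′ e∈c) })))
        where
        paired : ∀ ps → All (λ x → Near p f′ (o x)) (flat ps) → All (λ s → Near p f′ (Square.o₁ s) × Near p f′ (Square.o₂ s)) (map toSquare ps)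
        paired []       _            = []
        paired (_ ∷ ps) (x ∷ y ∷ xs) = (x , y) ∷ paired ps xs

      eun⊆ : ∀ {u} → u ∈ eun → u ∈ us
      eun⊆ u∈ with ∈-map⁻ emitter u∈
      ... | x , x∈ , refl = ∈-map⁺ emitter (un⊆ x∈)

      unique-eun : Unique eun
      unique-eun = AllPairs-++ˡ eun (subst Unique (Listₚ.map-++ emitter un con) (AllPairs-↭ (_∘ sym) (map⁺ emitter (↭-sym permI)) unique-us))

      unique-eJ : Unique eJ
      unique-eJ = subst Unique (sym (Listₚ.map-∘ {g = e} {f = proj₁} arrJ)) (AllPairsₚ.map⁺ (AllPairs.map proj₁ (AllPairs-++ʳ (map proj₁ arrI) relIJ)))

      I∉eJ : ∀ {w} → inI w ≡ true → w ∉ eJ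
      I∉eJ Iw w∈ with ∈-map⁻ emitter w∈
      ... | x , x∈ , refl = case ≡-trans (sym Iw) (J-arrJ x∈) of λ ()

      J∉eun : ∀ {w} → inI w ≡ false → w ∉ eun
      J∉eun Jw w∈ with us-from (eun⊆ w∈)
      ... | x , x∈ , refl = case ≡-trans (sym (FromI.Ie (fromI x∈))) Jw of λ ()

      J∉A : ∀ {w} → inI w ≡ false → w ∉ A
      J∉A Jw w∈ = case ≡-trans (sym (proj₁ (proj₁ (A⁻ w∈)))) Jw of λ ()

      count-S2 : ∀ w → count w S2 ≡ (count w A ℕ.+ count w eun) ℕ.+ (count w eun ℕ.+ count w eJ)
      count-S2 w = ≡-trans (tot-++ _ (A ++ eun) (eun ++ eJ)) (cong₂ ℕ._+_ (tot-++ _ A eun) (tot-++ _ eun eJ))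

      S2-I : ∀ {w} → inI w ≡ true → w ∉ eun → count w S2 ℕ.≤ 1
      S2-I {w} Iw w∉ = ℕₚ.≤-trans (ℕₚ.≤-reflexive (≡-trans (count-S2 w) (≡-trans (cong₂ (λ x y → (count w A ℕ.+ x) ℕ.+ (x ℕ.+ y)) (count-∉ eun w∉) (count-∉ eJ (I∉eJ Iw))) (lemma (count w A))))) (count-unique w unique-A)
        where
        lemma : ∀ a → (a ℕ.+ 0) ℕ.+ (0 ℕ.+ 0) ≡ a
        lemma = solveℕ-∀

      S2-u : ∀ {w} → w ∈ eun → count w S2 ℕ.≤ 2
      S2-u {w} w∈ = ℕₚ.≤-trans (ℕₚ.≤-reflexive (≡-trans (count-S2 w) (cong₂ (λ x y → (x ℕ.+ count w eun) ℕ.+ (count w eun ℕ.+ y)) (count-∉ A (λ q → proj₂ (A⁻ q) (eun⊆ w∈))) (count-∉ eJ (I∉eJ Iw)))))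
        (ℕₚ.+-mono-≤ (count-unique w unique-eun) (ℕₚ.≤-trans (ℕₚ.≤-reflexive (ℕₚ.+-identityʳ _)) (count-unique w unique-eun)))
        where
        Iw : inI w ≡ true
        Iw with us-from (eun⊆ w∈)
        ... | x , x∈ , refl = FromI.Ie (fromI x∈)

      S2-J : ∀ {w} → inI w ≡ false → count w S2 ≡ count w eJ
      S2-J {w} Jw = ≡-trans (count-S2 w) (cong₂ (λ x y → (x ℕ.+ y) ℕ.+ (y ℕ.+ count w eJ)) (count-∉ A (J∉A Jw)) (count-∉ eun (J∉eun Jw)))

      eJ⊆ : ∀ {w} → w ∈ eJ → ∃[ x ] (x ∈ arrJ × w ≡ emitter x)
      eJ⊆ = ∈-map⁻ emitter

  -- A vertex of J that has a parent

  ∈-↭ : {X : Set} {x : X} {xs : List X} → x ∈ xs → ∃[ ys ] xs ↭ x ∷ ys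
  ∈-↭ {x = x} x∈ with ∈-∃++ x∈
  ... | l , r , refl = l ++ r , shift x l r

  drop⊆ : ∀ k {w} {xs : List V} → w ∈ drop k xs → w ∈ xs
  drop⊆ zero    q                = q
  drop⊆ (suc k) {xs = x ∷ xs} q = there (drop⊆ k q)

  module JStep {z : V} {p′ : List V} {v : V} {c : Forest V} (S : State (v ∷ z ∷ p′) c)
               (nb : ∀ {w} → v ~ w → w ∈ z ∷ p′ ⊎ w ∈ verts c)
               (v∉c : v ∉ verts c) (p∉ : ∀ {a} → a ∈ z ∷ p′ → a ∉ v ∷ verts c) (Jv : inI v ≡ false)
               (z~v : z ~ v) (kf : ∃[ w ] (w ∈ verts c × v ~ w × inI w ≡ true))
               (deeper : All (λ a → dep a ℕ.< dep v) (z ∷ p′))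
               (sorted : AllPairs (λ x y → dep y ℕ.< dep x) (z ∷ p′)) where
    open JNode S nb v∉c p∉ Jv public

    p : List V
    p = z ∷ p′

    l : List V
    l = nbrsJ v p

    l⁻ : ∀ {a} → a ∈ l → a ∈ p × inI a ≡ false × a ~ v
    l⁻ = ∈-filter⁻ (λ a → J? a ×-dec (a ~? v)) {xs = p}

    l-sorted : AllPairs (λ x y → dep y ℕ.< dep x) l
    l-sorted = AllPairsₚ.filter⁺ (λ a → J? a ×-dec (a ~? v)) sorted

    l-unique : Unique l
    l-unique = AllPairs.map (λ { q refl → ℕₚ.<-irrefl refl q }) l-sorted

    head-l : inI z ≡ false → l ≡ z ∷ nbrsJ v p′
    head-l Jz = Listₚ.filter-accept (λ a → J? a ×-dec (a ~? v)) (Jz , z~v)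

    -- How the last direction of the chain at v reaches I: directly, or through a vertex of J emitting to v.
    data Ex (un : List (Arrival v)) : Set where
      direct : (x : Own v) → proj₁ x ∉ map emitter un → Ex un
      borrow : ∀ {x} → x ∈ arrJ → Fallback (cost S) (emitter x) v → Ex un

    Direct : ∀ {un} → Ex un → Set
    Direct ex = ∃[ x ] ∃[ x∉ ] ex ≡ direct x x∉

    gate : ∀ {un} → Ex un → V
    gate (direct x _)         = proj₁ x
    gate (borrow {x} _ _)     = emitter x

    ext : ∀ {un} → Ex un → V → V → ℕ
    ext (direct _ _)     a b = 0
    ext (borrow {x} _ F) a b = same a b (Fallback.i F , emitter x)

    exit : ∀ {un} → Ex un → Exit v
    exit (direct (i , Ii , i~v) _) = record { i = i ; Ii = Ii ; s = 1ℤ ; dir = (1ℤ , i , v) ∷ [] ; adj = i~v ∷ [] ; vec≡ = λ x → lemma (δ i x) (δ v x) }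
      where
      lemma : ∀ i v → 1ℤ * (i + v) + 0ℤ ≡ v + 1ℤ * i
      lemma = solve-∀
    exit (borrow {m , refl} _ F) = record { i = F.i ; Ii = F.Ii ; s = -1ℤ ; dir = (1ℤ , e m , v) ∷ (-1ℤ , F.i , e m) ∷ [] ; adj = e~t m ∷ F.i~d ∷ []
      ; vec≡ = λ x → lemma (δ (e m) x) (δ v x) (δ F.i x) }
      where
      module F = Fallback F
      lemma : ∀ d v i → 1ℤ * (d + v) + (-1ℤ * (i + d) + 0ℤ) ≡ v + -1ℤ * i
      lemma = solve-∀

    exit-use : ∀ {un} (ex : Ex un) a b → uses a b (Exit.dir (exit ex)) ≡ same a b (gate ex , v) ℕ.+ ext ex a b
    exit-use (direct _ _)              a b = refl
    exit-use (borrow {m , refl} _ F) a b = cong (same a b (e m , v) ℕ.+_) (ℕₚ.+-identityʳ _)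

    ext-≡0 : ∀ {un} (ex : Ex un) {a b} → (∀ {x} → x ∈ arrJ → inI (emitter x) ≡ false → ∀ {i} → inI i ≡ true → ¬ Same a b (i , emitter x)) → ext ex a b ≡ 0
    ext-≡0 (direct _ _)   _ = refl
    ext-≡0 (borrow x∈ F) {a} {b} ¬same = ι-no (same? a b _) (¬same x∈ (J-arrJ x∈) (Fallback.Ii F))

    arrJ∈c : ∀ {x} → x ∈ arrJ → emitter x ∈ verts c
    arrJ∈c x∈ = Valid.e∈ (validArr (proj₁ (∈arrJ x∈)))

    gate∉ : ∀ {un} (ex : Ex un) {a} → a ∈ p → inI a ≡ false → gate ex ≢ a
    gate∉ (direct (_ , Ii , _) _) a∈ Ja refl = case ≡-trans (sym Ii) Ja of λ ()
    gate∉ (borrow x∈ _)           a∈ Ja refl = p∉c a∈ (arrJ∈c x∈)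

    -- All cases of `stepJ` end here. `ems-valid` hands them what the new costs guarantee: at most
    -- one use of the edge to the nearest neighbour in J above, and at most two of an edge up to I
    -- unless it is the gate of a nonempty chain.
    module Finish (un con : List (Arrival v)) (permI : un ++ con ↭ arrI)
                  (unO : List (Own v)) (unO≡ : map proj₁ unO ≡ map emitter un)
                  (outs : List (Item v)) (ps : List (Pair v))
                  (items↭ : outs ++ flat ps ↭ map mkOwn (AO ++ unO) ++ map arrive (un ++ arrJ))
                  (ex : Ex un) (ems : List Emission)
                  (ems-use : ∀ a b → pendUse a b ems ≡ itemsUse a b outs)
                  (ems-tok : map (tok ∘ item) ems ≡ map tok outs)
                  (ems-rel : AllPairs Related (ems ++ rest))
                  (ems-valid : ∀ C → (∀ {y l′} → l ≡ y ∷ l′ → C v y ℕ.≤ 1) → (∀ {y} → y ∈ p → inI y ≡ true → l ≡ [] ⊎ gate ex ≢ y → C v y ℕ.≤ 2) →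
                               All (Valid p f′ C) ems)
                  (fallback : Direct ex ⊎ Any (λ m → e m ≡ v × tag m ≡ tU) ems)
                  (calm : un ≡ [] ⊎ Any (λ m → e m ≡ v) ems) where
      open Core un con permI unO unO≡ outs ps items↭
      open Chain Jv (exit ex)

      OKl : All OK l
      OKl = All.tabulate (λ a∈ → let a∈p , Ja , a~v = l⁻ a∈ in Ja , a~v , All.lookup deeper a∈p)

      lowers : List Lower
      lowers = chain l OKl l-sorted

      low≤ : ∀ a b → lowerUse a b lowers ℕ.≤ steps a b v l ℕ.+ steps a b v (drop 1 l) ℕ.+ (same a b (gate ex , v) ℕ.+ ext ex a b)
      low≤ a b = go l OKl l-sorted
        where
        go : ∀ l ok so → lowerUse a b (chain l ok so) ℕ.≤ steps a b v l ℕ.+ steps a b v (drop 1 l) ℕ.+ (same a b (gate ex , v) ℕ.+ ext ex a b)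
        go []      _  _  = z≤n
        go (x ∷ l) ok so = ℕₚ.≤-reflexive (≡-trans (chain-use x l ok so a b) (cong (steps a b v (x ∷ l) ℕ.+ steps a b v l ℕ.+_) (exit-use ex a b)))

      low-[] : l ≡ [] → ∀ a b → lowerUse a b lowers ≡ 0
      low-[] eq a b = go l OKl l-sorted eq
        where
        go : ∀ l ok so → l ≡ [] → lowerUse a b (chain l ok so) ≡ 0
        go .[] _ _ refl = refl

      cost′ : Cost
      cost′ a b = 2 ℕ.* pendUse a b (ems ++ rest) ℕ.+ (2 ℕ.* squaresUse a b (newSqs ++ sqs S) ℕ.+ lowerUse a b (lowers ++ low S))

      cost≡ : ∀ a b → cost′ a b ≡ cost S a b ℕ.+ (2 ℕ.* steps a b v S2 ℕ.+ lowerUse a b lowers)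
      cost≡ a b = begin
        cost′ a b
          ≡⟨ cong₂ (λ x y → 2 ℕ.* x ℕ.+ y) (≡-trans (tot-++ _ ems rest) (cong (ℕ._+ R) (ems-use a b)))
               (cong₂ (λ x y → 2 ℕ.* x ℕ.+ y) (tot-++ _ newSqs (sqs S)) (tot-++ _ lowers (low S))) ⟩
        2 ℕ.* (O ℕ.+ R) ℕ.+ (2 ℕ.* (N ℕ.+ Q) ℕ.+ (L ℕ.+ L₀))
          ≡⟨ lemma O R N Q L L₀ ⟩
        2 ℕ.* ((O ℕ.+ R) ℕ.+ N) ℕ.+ (2 ℕ.* Q ℕ.+ (L ℕ.+ L₀))
          ≡⟨ cong (λ x → 2 ℕ.* x ℕ.+ (2 ℕ.* Q ℕ.+ (L ℕ.+ L₀))) (use≡ a b) ⟩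
        2 ℕ.* (pendUse a b (pend S) ℕ.+ steps a b v S2) ℕ.+ (2 ℕ.* Q ℕ.+ (L ℕ.+ L₀))
          ≡⟨ lemma₂ (pendUse a b (pend S)) (steps a b v S2) Q L L₀ ⟩
        cost S a b ℕ.+ (2 ℕ.* steps a b v S2 ℕ.+ L) ∎
        where
        open ≡-Reasoning
        O = itemsUse a b outs
        R = pendUse a b rest
        N = squaresUse a b newSqs
        Q = squaresUse a b (sqs S)
        L = lowerUse a b lowers
        L₀ = lowerUse a b (low S)
        lemma : ∀ o r n q l m → 2 ℕ.* (o ℕ.+ r) ℕ.+ (2 ℕ.* (n ℕ.+ q) ℕ.+ (l ℕ.+ m)) ≡ 2 ℕ.* ((o ℕ.+ r) ℕ.+ n) ℕ.+ (2 ℕ.* q ℕ.+ (l ℕ.+ m))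
        lemma = solveℕ-∀
        lemma₂ : ∀ u s q l m → 2 ℕ.* (u ℕ.+ s) ℕ.+ (2 ℕ.* q ℕ.+ (l ℕ.+ m)) ≡ (2 ℕ.* u ℕ.+ (2 ℕ.* q ℕ.+ m)) ℕ.+ (2 ℕ.* s ℕ.+ l)
        lemma₂ = solveℕ-∀

      away : ∀ {a b} → a ≢ v → b ≢ v → cost′ a b ℕ.≤ cost S a b ℕ.+ ext ex a b
      away {a} {b} a≢ b≢ = ℕₚ.≤-trans (ℕₚ.≤-reflexive (cost≡ a b)) (ℕₚ.+-monoʳ-≤ (cost S a b)
        (ℕₚ.≤-trans (ℕₚ.≤-reflexive (cong (λ x → 2 ℕ.* x ℕ.+ lowerUse a b lowers) (steps-away S2 a≢ b≢)))
        (ℕₚ.≤-trans (low≤ a b) (ℕₚ.≤-reflexive (≡-trans (cong₂ (λ x y → x ℕ.+ y ℕ.+ (same a b (gate ex , v) ℕ.+ ext ex a b)) (steps-away l a≢ b≢) (steps-away (drop 1 l) a≢ b≢))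
          (cong (ℕ._+ ext ex a b) (≡-trans (sym (ℕₚ.+-identityʳ _)) (steps-away (gate ex ∷ []) a≢ b≢))))))))

      away₀ : ∀ {a b} → a ≢ v → b ≢ v → ext ex a b ≡ 0 → cost′ a b ℕ.≤ cost S a b
      away₀ {a} {b} a≢ b≢ z = ℕₚ.≤-trans (away a≢ b≢) (ℕₚ.≤-reflexive (≡-trans (cong (cost S a b ℕ.+_) z) (ℕₚ.+-identityʳ _)))

      S1 : V → ℕ
      S1 w = count w l ℕ.+ count w (drop 1 l) ℕ.+ count w (gate ex ∷ [])

      at-v : ∀ {w} → w ≢ v → cost′ w v ℕ.≤ cost S w v ℕ.+ (2 ℕ.* count w S2 ℕ.+ S1 w)
      at-v {w} w≢ = ℕₚ.≤-trans (ℕₚ.≤-reflexive (cost≡ w v)) (ℕₚ.+-monoʳ-≤ (cost S w v) (ℕₚ.+-mono-≤ (ℕₚ.≤-reflexive (cong (2 ℕ.*_) (steps-count S2 w≢)))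
        (ℕₚ.≤-trans (low≤ w v) (ℕₚ.≤-reflexive (cong₂ ℕ._+_ (cong₂ ℕ._+_ (steps-count l w≢) (steps-count (drop 1 l) w≢))
          (≡-trans (cong (same w v (gate ex , v) ℕ.+_) (ext-≡0 ex (λ { x∈ Jx Ii (inj₁ (_ , eq)) → v∉c (subst (_∈ verts c) eq (arrJ∈c x∈)) ; x∈ Jx Ii (inj₂ (eq , _)) → J⇒≢I Ii Jv eq })))
                   (steps-count (gate ex ∷ []) w≢)))))))

      at-v-[] : l ≡ [] → ∀ {w} → w ≢ v → cost′ w v ≡ cost S w v ℕ.+ 2 ℕ.* count w S2
      at-v-[] eq {w} w≢ = ≡-trans (cost≡ w v) (cong (cost S w v ℕ.+_) (≡-trans (cong₂ (λ x y → 2 ℕ.* x ℕ.+ y) (steps-count S2 w≢) (low-[] eq w v)) (ℕₚ.+-identityʳ _)))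

      cost′-sym : ∀ a b → cost′ a b ≡ cost′ b a
      cost′-sym a b = cong₂ (λ x y → 2 ℕ.* x ℕ.+ y) (tot-cong (ems ++ rest) (λ m → uses-sym a b (dir (item m))))
        (cong₂ (λ x y → 2 ℕ.* x ℕ.+ y) (tot-cong (newSqs ++ sqs S) (λ s → uses-sym a b (Square.dir s))) (tot-cong (lowers ++ low S) (λ l → uses-sym a b (Lower.dir l))))

      zero-I : ∀ {w} → inI w ≡ true → w ~ v → cost S w v ≡ 0
      zero-I Iw w~v = [ local-p , (λ q → upI S q Iw (here refl)) ]′ (nb (~-sym w~v))

      I∉l : ∀ {w} → inI w ≡ true → ∀ k → w ∉ drop k l
      I∉l Iw k w∈ = case ≡-trans (sym Iw) (proj₁ (proj₂ (l⁻ (drop⊆ k w∈)))) of λ ()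

      S1-I : ∀ {w} → inI w ≡ true → S1 w ≡ count w (gate ex ∷ [])
      S1-I {w} Iw = cong₂ (λ x y → x ℕ.+ y ℕ.+ count w (gate ex ∷ [])) (count-∉ l (I∉l Iw 0)) (count-∉ (drop 1 l) (I∉l Iw 1))

      one≤1 : ∀ (w x : V) → count w (x ∷ []) ℕ.≤ 1
      one≤1 w x = count-unique w {x ∷ []} ([] ∷ [])

      ∉-one : ∀ {w x : V} → x ≢ w → count w (x ∷ []) ≡ 0
      ∉-one {w} {x} x≢w = count-∉ (x ∷ []) (λ { (here eq) → x≢w (sym eq) })

      gate-un : ∀ (ex : Ex un) {w} → w ∈ eun → gate ex ≢ w
      gate-un (direct _ x∉) w∈ refl = x∉ w∈
      gate-un (borrow x∈ _) w∈ refl = J∉eun (J-arrJ x∈) w∈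

      -- A neighbour in I outside `un` sends at most one item, used twice, and is at most once the
      -- gate of the chain. The remaining use is what `Fallback` and `Quiet` offer.
      three : ∀ {w} → inI w ≡ true → w ~ v → w ∉ eun → cost′ w v ℕ.≤ 3
      three {w} Iw w~v w∉ = ℕₚ.≤-trans (at-v (λ eq → ~-irrefl eq w~v)) (ℕₚ.≤-trans (ℕₚ.≤-reflexive (cong₂ (λ x y → x ℕ.+ (2 ℕ.* count w S2 ℕ.+ y)) (zero-I Iw w~v) (S1-I Iw)))
        (ℕₚ.+-mono-≤ (ℕₚ.*-monoʳ-≤ 2 (S2-I Iw w∉)) (one≤1 w (gate ex))))

      tail∉ : ∀ {w : V} xs → Unique xs → count w xs ℕ.+ count w (drop 1 xs) ℕ.≤ 2
      tail∉ {w} xs u = ℕₚ.+-mono-≤ (count-unique w u) (count-unique w (drop-unique xs u))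
        where
        drop-unique : ∀ (xs : List V) → Unique xs → Unique (drop 1 xs)
        drop-unique []       _       = []
        drop-unique (x ∷ xs) (_ ∷ u) = u

      p∩J : ∀ {w} → w ∈ p → inI w ≡ false → cost′ w v ℕ.≤ count w l ℕ.+ count w (drop 1 l)
      p∩J {w} w∈ Jw = ℕₚ.≤-trans (at-v (p≢v w∈)) (ℕₚ.≤-reflexive (≡-trans (cong₂ (λ x y → x ℕ.+ (2 ℕ.* y ℕ.+ S1 w)) (local-p w∈) (≡-trans (S2-J Jw) (count-∉ eJ w∉eJ)))
        (≡-trans (cong (count w l ℕ.+ count w (drop 1 l) ℕ.+_) (∉-one (gate∉ ex w∈ Jw))) (ℕₚ.+-identityʳ _))))
        where
        w∉eJ : w ∉ eJ
        w∉eJ q with eJ⊆ q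
        ... | x , x∈ , refl = p∉c w∈ (arrJ∈c x∈)

      bound-v : ∀ {w} → w ~ v → cost′ w v ℕ.≤ 4
      bound-v {w} w~v with inI w in eqw
      ... | true with w ∈? eun
      -- Two items cross from a vertex of `un` and exhaust its edge, so the exit has to avoid it.
      ... | yes w∈ = ℕₚ.≤-trans (at-v (λ eq → ~-irrefl eq w~v)) (ℕₚ.≤-trans (ℕₚ.≤-reflexive (cong₂ (λ x y → x ℕ.+ (2 ℕ.* count w S2 ℕ.+ y)) (zero-I eqw w~v) (≡-trans (S1-I eqw) (∉-one (gate-un ex w∈)))))
                       (ℕₚ.+-mono-≤ (ℕₚ.*-monoʳ-≤ 2 (S2-u w∈)) (z≤n {0})))
      ... | no w∉ = ℕₚ.≤-trans (three eqw w~v w∉) (ℕₚ.n≤1+n 3)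
      bound-v {w} w~v | false with nb (~-sym w~v)
      ... | inj₁ w∈p = ℕₚ.≤-trans (p∩J w∈p eqw) (ℕₚ.≤-trans (tail∉ l l-unique) (s≤s (s≤s z≤n)))
      ... | inj₂ w∈c = ℕₚ.≤-trans (at-v (λ eq → ~-irrefl eq w~v)) (ℕₚ.≤-trans (ℕₚ.≤-reflexive (cong₂ (λ x y → cost S w v ℕ.+ (2 ℕ.* x ℕ.+ y)) (S2-J eqw) S1≡)) fin)
        where
        w∉l : ∀ k → w ∉ drop k l
        w∉l k q = p∉c (proj₁ (l⁻ (drop⊆ k q))) w∈c
        S1≡ : S1 w ≡ count w (gate ex ∷ [])
        S1≡ = cong₂ (λ x y → x ℕ.+ y ℕ.+ count w (gate ex ∷ [])) (count-∉ l (w∉l 0)) (count-∉ (drop 1 l) (w∉l 1))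
        fin : cost S w v ℕ.+ (2 ℕ.* count w eJ ℕ.+ count w (gate ex ∷ [])) ℕ.≤ 4
        fin with w ∈? eJ
        ... | no w∉ = ℕₚ.≤-trans (ℕₚ.≤-reflexive (cong₂ (λ x y → cost S w v ℕ.+ (2 ℕ.* x ℕ.+ y)) (count-∉ eJ w∉) (∉-one (gate≢ ex))))
                        (ℕₚ.≤-trans (ℕₚ.≤-reflexive (ℕₚ.+-identityʳ _)) (ℕₚ.≤-trans (upJ S w∈c eqw (here refl) Jv) (s≤s (s≤s z≤n))))
          where
          gate≢ : ∀ (ex : Ex un) → gate ex ≢ w
          gate≢ (direct (_ , Ii , _) _) refl = case ≡-trans (sym Ii) eqw of λ ()
          gate≢ (borrow x∈ _)           refl = w∉ (∈-map⁺ emitter x∈)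
        ... | yes w∈ with eJ⊆ w∈
        -- The tight case: at most one use before, two for the arrival from w, and one if the exit
        -- is borrowed from w.
        ... | (m , refl) , x∈ , refl = ℕₚ.+-mono-≤ (Valid.toJ (validArr (proj₁ (∈arrJ x∈))) (J-arrJ x∈) Jv)
                (ℕₚ.+-mono-≤ (ℕₚ.*-monoʳ-≤ 2 (count-unique w unique-eJ)) (one≤1 w (gate ex)))

      -- The nearest neighbour in J starts a walk of the chain but ends none, so its edge is the one
      -- with room for an emission.
      toHead : ∀ {y l′} → l ≡ y ∷ l′ → cost′ v y ℕ.≤ 1
      toHead {y} {l′} eq = ℕₚ.≤-trans (ℕₚ.≤-reflexive (cost′-sym v y)) (ℕₚ.≤-trans (p∩J (proj₁ y∈) (proj₁ (proj₂ y∈)))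
          (ℕₚ.+-mono-≤ (count-unique y l-unique) (ℕₚ.≤-reflexive (count-∉ (drop 1 l) (subst (λ xs → y ∉ drop 1 xs) (sym eq) (λ q → All.lookup (AllPairs.head (subst Unique eq l-unique)) q refl))))))
        where y∈ = l⁻ (subst (y ∈_) (sym eq) (here refl))

      toIv : ∀ {y} → y ∈ p → inI y ≡ true → l ≡ [] ⊎ gate ex ≢ y → cost′ v y ℕ.≤ 2
      toIv {y} y∈ Iy either = ℕₚ.≤-trans (ℕₚ.≤-reflexive (cost′-sym v y)) (go either)
        where
        y∉ : y ∉ eun
        y∉ q with us-from (eun⊆ q)
        ... | x , x∈ , refl = p∉c y∈ (FromI.e∈c (fromI x∈))
        go : l ≡ [] ⊎ gate ex ≢ y → cost′ y v ℕ.≤ 2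
        go (inj₁ eq) = ℕₚ.≤-trans (ℕₚ.≤-reflexive (≡-trans (at-v-[] eq (p≢v y∈)) (cong (ℕ._+ 2 ℕ.* count y S2) (local-p y∈)))) (ℕₚ.*-monoʳ-≤ 2 (S2-I Iy y∉))
        go (inj₂ g≢) = ℕₚ.≤-trans (at-v (p≢v y∈)) (ℕₚ.≤-trans (ℕₚ.≤-reflexive (cong₂ (λ x y′ → x ℕ.+ (2 ℕ.* count y S2 ℕ.+ y′)) (local-p y∈) (≡-trans (S1-I Iy) (∉-one g≢))))
          (ℕₚ.≤-trans (ℕₚ.≤-reflexive (ℕₚ.+-identityʳ _)) (ℕₚ.*-monoʳ-≤ 2 (S2-I Iy y∉))))

      state : State p f′
      state = record
        { pend = ems ++ rest ; sqs = newSqs ++ sqs S ; low = lowers ++ low S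
        ; valid = Allₚ.++⁺ (ems-valid cost′ toHead toIv) (restValid cost′ (λ m∈ → away₀ (c≢v (Valid.e∈ (validRest m∈))) (rest-t m∈) (ext-≡0 ex (λ
            { x∈ Jx Ii (inj₁ (_ , eq)) → p∉c (t∈p m∈) (subst (_∈ verts c) eq (arrJ∈c x∈))
            ; x∈ Jx Ii (inj₂ (_ , eq)) → proj₁ (AllPairs-cross (map proj₁ arr) relAll (∈-map⁺ proj₁ (proj₁ (∈arrJ x∈))) m∈) eq }))))
        ; rel = ems-rel
        ; toks = begin
            tokensIn f′ ≡⟨ ≡-trans tokens-node (cong (_++ tokensIn c) (tokensAt-J Jv)) ⟩
            map (_, v) (nbrsI v) ++ tokensIn c ↭⟨ ++⁺ˡ (map (_, v) (nbrsI v)) (toks S) ⟩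
            map (_, v) (nbrsI v) ++ (map (tok ∘ item) (pend S) ++ T) ≡⟨ Listₚ.++-assoc (map (_, v) (nbrsI v)) (map (tok ∘ item) (pend S)) T ⟨
            (map (_, v) (nbrsI v) ++ map (tok ∘ item) (pend S)) ++ T ↭⟨ ++⁺ʳ T toks↭ ⟩
            ((map tok outs ++ map (tok ∘ item) rest) ++ concatMap Square.tokens newSqs) ++ T ≡⟨ Listₚ.++-assoc (map tok outs ++ map (tok ∘ item) rest) (concatMap Square.tokens newSqs) T ⟩
            (map tok outs ++ map (tok ∘ item) rest) ++ (concatMap Square.tokens newSqs ++ T)
              ≡⟨ cong₂ _++_ (≡-trans (cong (_++ map (tok ∘ item) rest) (sym ems-tok)) (sym (Listₚ.map-++ (tok ∘ item) ems rest))) (sym (Listₚ.concatMap-++ Square.tokens newSqs (sqs S))) ⟩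
            map (tok ∘ item) (ems ++ rest) ++ concatMap Square.tokens (newSqs ++ sqs S) ∎
        ; lows = ↭-trans (↭-reflexive (cong₂ _++_ (≡-trans (lowerAt-J p Jv) (sym (chain-ad l OKl l-sorted))) (Listₚ.++-identityʳ (lowerIn (v ∷ p) c))))
            (↭-trans (++⁺ˡ (map Lower.ad lowers) (lows S)) (↭-reflexive (sym (Listₚ.map-++ Lower.ad lowers (low S)))))
        ; sqs⊆ = Allₚ.++⁺ newSqs⊆ (All.map (λ (x , y) → near′ x , near′ y) (sqs⊆ S))
        ; bound = bound′
        ; local = λ a∉ b∉ → ℕₚ.n≤0⇒n≡0 (ℕₚ.≤-trans (away₀ (λ { refl → a∉ (here refl) }) (λ { refl → b∉ (here refl) }) (ext-≡0 ex (λ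
            { x∈ Jx Ii (inj₁ (_ , eq)) → b∉ (in′ (subst (_∈ verts c) eq (arrJ∈c x∈)))
            ; x∈ Jx Ii (inj₂ (_ , eq)) → a∉ (in′ (subst (_∈ verts c) eq (arrJ∈c x∈))) }))) (ℕₚ.≤-reflexive (local S (a∉ ∘ in′) (b∉ ∘ in′))))
        ; upI = λ i∈ Ii y∈ → [ (λ { refl → case ≡-trans (sym Ii) Jv of λ () }) , (λ q → ℕₚ.n≤0⇒n≡0 (ℕₚ.≤-trans (away₀ (c≢v q) (p≢v y∈) (ext-≡0 ex (λ
            { x∈ Jx Ii′ (inj₁ (_ , eq)) → p∉c y∈ (subst (_∈ verts c) eq (arrJ∈c x∈))
            ; x∈ Jx Ii′ (inj₂ (_ , eq)) → J⇒≢I Ii Jx (sym eq) }))) (ℕₚ.≤-reflexive (upI S q Ii (there y∈))))) ]′ (out′ i∈)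
        ; upJ = λ d∈ Jd y∈ Jy → [ (λ { refl → ℕₚ.≤-trans (ℕₚ.≤-reflexive (cost′-sym v _)) (ℕₚ.≤-trans (p∩J y∈ Jy) (tail∉ l l-unique)) })
            , (λ q → ℕₚ.≤-trans (away₀ (c≢v q) (p≢v y∈) (ext-≡0 ex (λ
            { x∈ Jx Ii′ (inj₁ (eq , _)) → J⇒≢I Ii′ Jd eq
            ; x∈ Jx Ii′ (inj₂ (eq , _)) → J⇒≢I Ii′ Jy eq }))) (upJ S q Jd (there y∈) Jy)) ]′ (out′ d∈)
        ; back = λ { (here refl) _ head Jz → back′ fallback Jz }
        ; quiet = λ { (here refl) _ head Iz → quiet′ calm Iz } }
        where
        open PermutationReasoning
        T = concatMap Square.tokens (sqs S)
        bound′ : ∀ {a b} → a ~ b → cost′ a b ℕ.≤ 4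
        bound′ {a} {b} a~b with a Finₚ.≟ v | b Finₚ.≟ v
        ... | yes refl | _        = ℕₚ.≤-trans (ℕₚ.≤-reflexive (cost′-sym v b)) (bound-v (~-sym a~b))
        ... | no _     | yes refl = bound-v a~b
        ... | no a≢    | no b≢    = ℕₚ.≤-trans (away a≢ b≢) (far ex)
          where
          far : ∀ (ex : Ex un) → cost S a b ℕ.+ ext ex a b ℕ.≤ 4
          far (direct _ _)     = ℕₚ.≤-trans (ℕₚ.≤-reflexive (ℕₚ.+-identityʳ _)) (bound S a~b)
          far (borrow {x} x∈ F) with same? a b (Fallback.i F , emitter x)
          ... | no _                   = ℕₚ.≤-trans (ℕₚ.≤-reflexive (ℕₚ.+-identityʳ _)) (bound S a~b)
          ... | yes (inj₁ (refl , refl)) = ℕₚ.+-monoˡ-≤ 1 (Fallback.id≤ F)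
          ... | yes (inj₂ (refl , refl)) = ℕₚ.+-monoˡ-≤ 1 (ℕₚ.≤-trans (ℕₚ.≤-reflexive (cost-sym S a b)) (Fallback.id≤ F))
        back′ : Direct ex ⊎ Any (λ m → e m ≡ v × tag m ≡ tU) ems → inI z ≡ false → Any (λ m → e m ≡ v × tag m ≡ tU) (ems ++ rest) ⊎ Fallback cost′ v z
        back′ (inj₂ some) _ = inj₁ (Anyₚ.++⁺ˡ some)
        back′ (inj₁ ((i , Ii , i~v) , i∉ , refl)) Jz = inj₂ (record { i = i ; Ii = Ii ; i~d = i~v ; id≤ = three Ii i~v i∉ ; dz≤ = toHead (head-l Jz) })
        quiet′ : un ≡ [] ⊎ Any (λ m → e m ≡ v) ems → inI z ≡ true → Any (λ m → e m ≡ v) (ems ++ rest) ⊎ Quiet cost′ v z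
        quiet′ (inj₂ some) _ = inj₁ (Anyₚ.++⁺ˡ some)
        quiet′ (inj₁ refl) Iz = let w , w∈ , v~w , Iw = kf in inj₂ (record
          { i = w ; Ii = Iw ; i≢z = λ { refl → p∉c (here refl) w∈ } ; i~d = ~-sym v~w ; id≤ = three Iw (~-sym v~w) (λ ())
          ; dz≤ = ℕₚ.≤-trans (ℕₚ.≤-reflexive (cost′-sym v z)) (three Iz z~v (λ ())) })

    pool : List (Item v)
    pool = map mkOwn AO ++ map arrive arrJ

    below : Own v
    below = let w , _ , v~w , Iw = kf in w , Iw , ~-sym v~w

    pool≡ : map mkOwn (AO ++ []) ++ map arrive arrJ ≡ pool
    pool≡ = cong (λ xs → map mkOwn xs ++ map arrive arrJ) (Listₚ.++-identityʳ AO)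

    -- The new origin is adjacent to v, whereas the origin of a passing item from J is not. For a
    -- passing tI item with the same origin, the alternative in `isI` leaves only σ false.
    relate : ∀ {m m′} → e m ≡ v → tag m ≢ tI → origin m ~ v → m′ ∈ rest → Related m m′
    relate {m} {m′} refl ≢I o~v m′∈ =
        (λ eq → v∉c (subst (_∈ verts c) (sym eq) (Valid.e∈ (validRest m′∈))))
      , (λ _ ≢I′ eq → rest-far m′∈ ≢I′ (subst (v ~_) eq (~-sym o~v)))
      , (λ I _ _ → contradiction I ≢I)
      , (λ I′ _ eq → resolve (subst (Kind (v ∷ p) c m′) I′ (Valid.kind (validRest m′∈))) eq)
      where
      resolve : Kind (v ∷ p) c m′ tI → origin m ≡ origin m′ → σ (item m′) ≡ false
      resolve (isI _ _ (inj₁ q) _) _  = q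
      resolve (isI _ _ (inj₂ q) _) eq = contradiction (subst (v ~_) eq (~-sym o~v)) (q (here refl))

    stepEven : Even (length pool) → State p f′
    stepEven even with pairUp pool base even
    ... | ps , eq = Finish.state [] arrI ↭-refl [] refl [] ps (↭-reflexive (≡-trans eq (sym pool≡))) (direct below λ ()) []
          (λ _ _ → refl) refl relRest (λ _ _ _ → []) (inj₁ (below , (λ ()) , refl)) (inj₁ refl)

    -- The origin x lies below v, so its token may be emitted, and it goes to the parent z. If z is
    -- in I it differs from x, the gate of the chain, so the edge vz still has room.
    stepL : Even (suc (length pool)) → ∀ {x} → x ∈ AO → proj₁ x ∈ verts c → State p f′
    stepL odd {x} x∈ o∈c with ∈-↭ x∈
    ... | AO′ , AO↭ with pairUp (map mkOwn AO′ ++ map arrive arrJ) (AllPairs.tail (AllPairs-↭ (λ {a} {b} → Compat-sym {x = a} {b}) items base))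
                              (suc₂⁻¹ (subst (Even ∘ suc) (↭-length items) odd))
      where
      items : pool ↭ mkOwn x ∷ map mkOwn AO′ ++ map arrive arrJ
      items = ++⁺ʳ (map arrive arrJ) (map⁺ mkOwn AO↭)
    ... | ps , eq = Finish.state [] arrI ↭-refl [] refl (mkOwn x ∷ []) ps
          (↭-trans (↭-reflexive (cong (mkOwn x ∷_) eq)) (↭-trans (++⁺ʳ (map arrive arrJ) (map⁺ mkOwn (↭-sym AO↭))) (↭-reflexive (sym pool≡))))
          (direct x λ ()) (em ∷ []) (λ _ _ → refl) refl
          (All.tabulate (λ m′∈ → relate {em} refl (λ ()) (proj₂ (proj₂ x)) m′∈) ∷ relRest)
          (λ C F₁ F₂ → record
            { e∈ = here refl ; t∈ = here refl ; o∈ = in′ o∈c ; kind = isL Jv (proj₂ (proj₂ x)) refl head (here refl)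
            ; toI = λ _ Iz → F₂ (here refl) Iz (inj₂ (λ { refl → p∉c (here refl) o∈c }))
            ; toJ = λ _ Jz → F₁ (head-l Jz) } ∷ [])
          (inj₁ (x , (λ ()) , refl)) (inj₁ refl)
      where
      em : Emission
      em = record { e = v ; t = z ; e~t = ~-sym z~v ; item = mkOwn x ; tag = tL }

    module Unconsumed {u : Arrival v} {con : List (Arrival v)} (arrI≡ : arrI ≡ u ∷ con) where
      u∈ : u ∈ arrI
      u∈ = subst (u ∈_) (sym arrI≡) (here refl)
      open FromI (fromI u∈) public

      uO : Own v
      uO = emitter u , Ie , e~v

      module _ {y : V} (y~v : y ~ v) where
        em : Emission
        em = record { e = v ; t = y ; e~t = ~-sym y~v ; item = mkOwn uO ; tag = tU }

        em-rel : AllPairs Related (em ∷ rest)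
        em-rel = All.tabulate (λ m′∈ → relate {em} refl (λ ()) e~v m′∈) ∷ relRest

    -- All of A lies above v, while an emitted token must originate in the processed part. So one
    -- arrival from some u is not consumed but paired with a token of A, and the token (u, v) is
    -- sent up instead. As v is the topmost neighbour of u, this token meets no neighbour of its
    -- origin further up.
    stepU : Even (suc (length pool)) → (∀ {i} → i ∈ A → i ∉ verts c) →
            ∀ {α AO′} → AO ≡ α ∷ AO′ → ∀ {u con} → arrI ≡ u ∷ con → State p f′
    stepU odd none {α} {AO′} AO-eq {u} {con} arrI≡
      with pairUp (map mkOwn AO′ ++ map arrive arrJ) (AllPairs.tail (subst (λ xs → AllPairs Compat (map mkOwn xs ++ map arrive arrJ)) AO-eq base))
             (suc₂⁻¹ (subst (λ xs → Even (suc (length (map mkOwn xs ++ map arrive arrJ)))) AO-eq odd))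
    ... | ps , eq = go l refl
      where
      open Unconsumed arrI≡
      α∈A : proj₁ α ∈ A
      α∈A = subst (proj₁ α ∈_) (≡-trans (cong (map proj₁) (sym AO-eq)) AO≡) (here refl)
      α∈p : proj₁ α ∈ p
      α∈p = [ id , (λ q → contradiction q (none α∈A)) ]′ (nb (~-sym (proj₂ (proj₂ α))))
      α≢ : o (mkOwn α) ≢ o (arrive u)
      α≢ eq′ = p∉c α∈p (subst (_∈ verts c) (sym (≡-trans eq′ (arrive-o u))) o∈c)
      items : mkOwn uO ∷ mkOwn α ∷ arrive u ∷ flat ps ↭ map mkOwn (AO ++ uO ∷ []) ++ arrive u ∷ map arrive arrJ
      items = ↭-trans (↭-reflexive (cong (λ xs → mkOwn uO ∷ mkOwn α ∷ arrive u ∷ xs) eq))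
        (↭-trans (prep (mkOwn uO) (prep (mkOwn α) (↭-sym (shift (arrive u) (map mkOwn AO′) (map arrive arrJ)))))
        (↭-trans (↭-sym (shift (mkOwn uO) (map mkOwn (α ∷ AO′)) (arrive u ∷ map arrive arrJ)))
        (↭-reflexive (≡-trans (sym (Listₚ.++-assoc (map mkOwn (α ∷ AO′)) (mkOwn uO ∷ []) (arrive u ∷ map arrive arrJ)))
          (cong (_++ arrive u ∷ map arrive arrJ) (≡-trans (sym (Listₚ.map-++ mkOwn (α ∷ AO′) (uO ∷ []))) (cong (λ xs → map mkOwn (xs ++ uO ∷ [])) (sym AO-eq))))))))
      ex : Ex (u ∷ [])
      ex = direct α (λ { (here q) → proj₂ (A⁻ α∈A) (subst (_∈ us) (sym q) (∈-map⁺ emitter u∈)) })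
      finish : ∀ {y} (y~v : y ~ v) → (∀ C → _ → _ → All (Valid p f′ C) (em y~v ∷ [])) → State p f′
      finish y~v val = Finish.state (u ∷ []) con (↭-reflexive (sym arrI≡)) (uO ∷ []) refl (mkOwn uO ∷ []) ((mkOwn α , arrive u , inj₁ α≢) ∷ ps) items
        ex (em y~v ∷ []) (λ _ _ → refl) refl (em-rel y~v) val (inj₁ (α , _ , refl)) (inj₂ (here refl))
      -- The emission takes the edge to the nearest neighbour in J if there is one; otherwise there
      -- is no chain, and the edge to the parent has room.
      go : ∀ l′ → l ≡ l′ → State p f′
      go [] eql = finish z~v (λ C F₁ F₂ → record
        { e∈ = here refl ; t∈ = here refl ; o∈ = in′ e∈c ; kind = isU Jv top
        ; toI = λ _ Iz → F₂ (here refl) Iz (inj₁ eql)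
        ; toJ = λ _ Jz → case ≡-trans (sym eql) (head-l Jz) of λ () } ∷ [])
      go (y ∷ l′) eql = finish (proj₂ (proj₂ y∈)) (λ C F₁ F₂ → record
        { e∈ = here refl ; t∈ = proj₁ y∈ ; o∈ = in′ e∈c ; kind = isU Jv top
        ; toI = λ _ Iy → case ≡-trans (sym Iy) (proj₁ (proj₂ y∈)) of λ ()
        ; toJ = λ _ _ → F₁ eql } ∷ [])
        where y∈ = l⁻ (subst (y ∈_) (sym eql) (here refl))

    -- Here u may be the only neighbour of v in I, and the edge uv is exhausted by two items, so the
    -- chain must leave elsewhere. It leaves through the emitter of a tL arrival, for which the
    -- invariant `back` provides a way into I.
    stepBorrow : Even (suc (length (map arrive arrJ))) → AO ≡ [] → inI z ≡ false → ∀ {u con} → arrI ≡ u ∷ con →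
                 ∀ {x} → x ∈ arrJ → tag (proj₁ x) ≡ tL → State p f′
    stepBorrow odd AO-eq Jz {u} {con} arrI≡ {x} x∈ xL with ∈-↭ x∈
    ... | J′ , J↭ with pairUp (map arrive J′) (AllPairs.tail (AllPairs-↭ (λ {a} {b} → Compat-sym {x = a} {b}) (map⁺ arrive J↭) compatJ))
                          (suc₂⁻¹ (subst (Even ∘ suc) (↭-length (map⁺ arrive J↭)) odd))
    ... | ps , eq = Finish.state (u ∷ []) con (↭-reflexive (sym arrI≡)) (uO ∷ []) refl (mkOwn uO ∷ []) ((arrive x , arrive u , compatible) ∷ ps) items
          (borrow x∈ fallback) (em z~v ∷ []) (λ _ _ → refl) refl (em-rel z~v)
          (λ C F₁ F₂ → record
            { e∈ = here refl ; t∈ = here refl ; o∈ = in′ e∈c ; kind = isU Jv top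
            ; toI = λ _ Iz → case ≡-trans (sym Iz) Jz of λ ()
            ; toJ = λ _ _ → F₁ (head-l Jz) } ∷ [])
          (inj₂ (here (refl , refl))) (inj₂ (here refl))
      where
      open Unconsumed arrI≡
      items : mkOwn uO ∷ arrive x ∷ arrive u ∷ flat ps ↭ map mkOwn (AO ++ uO ∷ []) ++ arrive u ∷ map arrive arrJ
      items = ↭-trans (↭-reflexive (cong (λ xs → mkOwn uO ∷ arrive x ∷ arrive u ∷ xs) eq))
        (↭-trans (prep (mkOwn uO) (↭-trans (swap (arrive x) (arrive u) ↭-refl) (prep (arrive u) (↭-sym (map⁺ arrive J↭)))))
        (↭-reflexive (cong (λ xs → map mkOwn (xs ++ uO ∷ []) ++ arrive u ∷ map arrive arrJ) (sym AO-eq))))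
      related : Related (proj₁ u) (proj₁ x)
      related = AllPairs-cross (map proj₁ arrI) relIJ (∈-map⁺ proj₁ u∈) (∈-map⁺ proj₁ x∈)
      σx : σ (arrive x) ≡ false
      σx with fromJ x∈
      ... | fromL _ _ σ≡ _ _ = ≡-trans (arrive-σ x) (cong not σ≡)
      ... | fromU _ _ xU     = case ≡-trans (sym xL) xU of λ ()
      compatible : Compat (arrive x) (arrive u)
      compatible with origin (proj₁ u) Finₚ.≟ origin (proj₁ x)
      ... | no ≢o  = inj₁ (λ eq′ → ≢o (≡-trans (sym (arrive-o u)) (≡-trans (sym eq′) (arrive-o x))))
      -- For equal origins the third clause of `Related` gives the tI item σ false, so the signs at
      -- v differ.
      ... | yes eq′ = inj₂ (λ σ≡ → case ≡-trans (sym σx) (≡-trans σ≡ (≡-trans (arrive-σ u) (cong not (proj₁ (proj₂ (proj₂ related)) (proj₂ (∈arrI u∈)) xL eq′)))) of λ ())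
      fallback : Fallback (cost S) (emitter x) v
      fallback with fromJ x∈
      ... | fromU _ _ xU         = case ≡-trans (sym xL) xU of λ ()
      ... | fromL Jx _ _ root _ with back S root Jx head Jv
      ... | inj₂ F = F
      ... | inj₁ some with find some
      -- A vertex emits at most once, and this one has emitted its tL item.
      ... | m′ , m′∈ , e≡ , m′U = contradiction (sym e≡) (proj₁ (AllPairs-∈ (λ {a} {b} → Related-sym {a} {b}) (rel S)
              (∈-resp-↭ perm (∈-++⁺ˡ (∈-map⁺ proj₁ (proj₁ (∈arrJ x∈))))) m′∈ (λ { refl → case ≡-trans (sym xL) m′U of λ () })))

    -- All arrivals from J are tU, with origins that have no neighbour further up, so one of them
    -- may simply be passed on.
    stepThrough : AO ≡ [] → inI z ≡ false → (∀ {x} → x ∈ arrJ → tag (proj₁ x) ≢ tL) →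
                  ∀ {x J′} → arrJ ≡ x ∷ J′ → Even (length (map arrive J′)) → State p f′
    stepThrough AO-eq Jz noL {x} {J′} arrJ≡ even
      with pairUp (map arrive J′) (AllPairs.tail (subst (AllPairs Compat ∘ map arrive) arrJ≡ compatJ)) even
    ... | ps , eq = Finish.state [] arrI ↭-refl [] refl (arrive x ∷ []) ps
          (↭-reflexive (≡-trans (cong (arrive x ∷_) eq) (≡-trans (cong (map arrive) (sym arrJ≡)) (cong (λ xs → map mkOwn (xs ++ []) ++ map arrive arrJ) (sym AO-eq)))))
          (direct below λ ()) (em ∷ []) (λ _ _ → refl) refl (All.tabulate rel′ ∷ relRest)
          (λ C F₁ F₂ → record
            { e∈ = here refl ; t∈ = here refl ; o∈ = in′ (subst (_∈ verts c) (sym (arrive-o x)) (Valid.o∈ (validArr (proj₁ (∈arrJ x∈)))))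
            ; kind = isU Jv (λ w∈ → subst (λ i → ¬ _ ~ i) (sym (arrive-o x)) (far (there w∈)))
            ; toI = λ _ Iz → case ≡-trans (sym Iz) Jz of λ ()
            ; toJ = λ _ _ → F₁ (head-l Jz) } ∷ [])
          (inj₁ (below , (λ ()) , refl)) (inj₁ refl)
      where
      x∈ : x ∈ arrJ
      x∈ = subst (x ∈_) (sym arrJ≡) (here refl)
      far : ∀ {w} → w ∈ v ∷ p → ¬ w ~ origin (proj₁ x)
      far with fromJ x∈
      ... | fromL _ _ _ _ xL = contradiction xL (noL x∈)
      ... | fromU _ q _      = q
      em : Emission
      em = record { e = v ; t = z ; e~t = ~-sym z~v ; item = arrive x ; tag = tU }
      rel′ : ∀ {m′} → m′ ∈ rest → Related em m′
      rel′ m′∈ = (λ eq′ → v∉c (subst (_∈ verts c) (sym eq′) (Valid.e∈ (validRest m′∈))))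
        , (λ _ ≢I eq′ → proj₁ (proj₂ (AllPairs-cross (map proj₁ arr) relAll (∈-map⁺ proj₁ (proj₁ (∈arrJ x∈))) m′∈)) (proj₂ (∈arrJ x∈)) ≢I (≡-trans (sym (arrive-o x)) eq′))
        , (λ ()) , (λ _ ())

    stepJ : State p f′
    stepJ with parity (length pool)
    ... | inj₁ even = stepEven even
    ... | inj₂ odd with any? (_∈? verts c) A
    ... | yes some = let i , i∈A , i∈c = find some ; x , x∈ , eq = ∈-map⁻ proj₁ (subst (i ∈_) (sym AO≡) i∈A) in stepL odd x∈ (subst (_∈ verts c) eq i∈c)
    ... | no none = go AO refl arrI refl
      where
      -- A neighbour in I below v that is not in A must have emitted to v.
      us-∈ : proj₁ below ∈ us
      us-∈ with proj₁ below ∈? us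
      ... | yes q = q
      ... | no ∉us = contradiction (lose (A⁺ (proj₁ (proj₂ below)) (proj₂ (proj₂ below)) ∉us) (proj₁ (proj₂ kf))) none
      -- A parent in I could not have emitted to v from below, so it would be in A.
      Jz : AO ≡ [] → inI z ≡ false
      Jz eqA with inI z in eqz
      ... | false = refl
      ... | true  = case subst (z ∈_) (≡-trans (sym AO≡) (cong (map proj₁) eqA)) (A⁺ eqz z~v (λ q → let x , x∈ , eq = us-from q in p∉c (here refl) (subst (_∈ verts c) (sym eq) (FromI.e∈c (fromI x∈))))) of λ ()
      go : ∀ xs → AO ≡ xs → ∀ ys → arrI ≡ ys → State p f′
      go xs       eqA []        eqI = case subst (λ ys → proj₁ below ∈ map emitter ys) eqI us-∈ of λ ()
      go (α ∷ xs) eqA (u ∷ con) eqI = stepU odd (λ i∈ i∈c → none (lose i∈ i∈c)) eqA eqI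
      go []       eqA (u ∷ con) eqI with any? (λ x → tL? (tag (proj₁ x))) arrJ
      ... | yes some = let x , x∈ , xL = find some in stepBorrow odd′ eqA (Jz eqA) eqI x∈ xL
        where
        odd′ : Even (suc (length (map arrive arrJ)))
        odd′ = subst (λ xs → Even (suc (length (map mkOwn xs ++ map arrive arrJ)))) eqA odd
      ... | no noL = through arrJ refl
        where
        through : ∀ ys → arrJ ≡ ys → State p f′
        through [] eqJ = case subst₂′ eqA eqJ odd of λ ()
          where
          subst₂′ : AO ≡ [] → arrJ ≡ [] → Even (suc (length pool)) → Even 1
          subst₂′ e₁ e₂ = subst Even (cong₂ (λ xs ys → suc (length (map mkOwn xs ++ map arrive ys))) e₁ e₂)
        through (x ∷ J′) eqJ = stepThrough eqA (Jz eqA) (λ x∈ xL → noL (lose x∈ xL)) eqJ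
          (suc₂⁻¹ (subst Even (cong₂ (λ xs ys → suc (length (map mkOwn xs ++ map arrive ys))) eqA eqJ) odd))

  -- The induction over the vertices below a root

  Tree : List V → Forest V → Set
  Tree = Good inI dep

  I∨J : ∀ v → inI v ≡ true ⊎ inI v ≡ false
  I∨J v with inI v
  ... | true  = inj₁ refl
  ... | false = inj₂ refl

  closed : ∀ p f → Tree p f → ∀ {a b} → a ∈ verts f → a ~ b → b ∈ p ⊎ b ∈ verts f
  closed p (node v c s) (_ , nb , _) (here refl) a~b = Sum.map₂ (there ∘ ∈-++⁺ˡ) (nb a~b)
  closed p (node v c s) (_ , _ , _ , _ , _ , gc , gs) (there a∈) a~b with ∈-++⁻ (verts c) a∈
  ... | inj₂ q = Sum.map₂ (there ∘ ∈-++⁺ʳ (verts c)) (closed p s gs q a~b)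
  ... | inj₁ q with closed (v ∷ p) c gc q a~b
  ... | inj₁ (here eq) = inj₂ (here eq)
  ... | inj₁ (there r) = inj₁ r
  ... | inj₂ r         = inj₂ (there (∈-++⁺ˡ r))

  roots-attached : ∀ {z p} f → Tree (z ∷ p) f → ∀ {d} → d ∈ roots f → z ~ d
  roots-attached (node v c s) (z~v , _) (here refl) = z~v
  roots-attached (node v c s) (_ , _ , _ , _ , _ , _ , gs) (there d∈) = roots-attached s gs d∈

  record Path (p : List V) : Set where
    field
      shallow : All (λ a → dep a ℕ.< length p) p
      sorted  : AllPairs (λ x y → dep y ℕ.< dep x) p

  rootPath : Path []
  rootPath = record { shallow = [] ; sorted = [] }

  above : ∀ {v p} → dep v ≡ length p → Path p → All (λ a → dep a ℕ.< dep v) p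
  above dv P = All.map (λ q → ℕₚ.<-≤-trans q (ℕₚ.≤-reflexive (sym dv))) (Path.shallow P)

  extend : ∀ {v p} → dep v ≡ length p → Path p → Path (v ∷ p)
  extend dv P = record
    { shallow = s≤s (ℕₚ.≤-reflexive dv) ∷ All.map ℕₚ.m<n⇒m<1+n (Path.shallow P)
    ; sorted = above dv P ∷ Path.sorted P }

  module Shape {p : List V} {v : V} {c s : Forest V} (g : Tree p (node v c s)) (u : Unique (verts (node v c s)))
               (p∉ : ∀ {a} → a ∈ p → a ∉ verts (node v c s)) where

    v∉c : v ∉ verts c
    v∉c v∈ = All.lookup (AllPairs.head u) (∈-++⁺ˡ v∈) refl

    p∉₁ : ∀ {a} → a ∈ p → a ∉ v ∷ verts c
    p∉₁ a∈ (here eq)  = p∉ a∈ (here eq)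
    p∉₁ a∈ (there q) = p∉ a∈ (there (∈-++⁺ˡ q))

    p∉c : ∀ {a} → a ∈ v ∷ p → a ∉ verts c
    p∉c (here refl) = v∉c
    p∉c (there a∈)  = p∉₁ a∈ ∘ there

    p∉s : ∀ {a} → a ∈ p → a ∉ verts s
    p∉s a∈ q = p∉ a∈ (there (∈-++⁺ʳ (verts c) q))

    uc : Unique (verts c)
    uc = AllPairs-++ˡ (verts c) (AllPairs.tail u)

    us : Unique (verts s)
    us = AllPairs-++ʳ (verts c) (AllPairs.tail u)

    disj : ∀ {a} → a ∈ v ∷ verts c → a ∉ verts s
    disj (here refl) q = All.lookup (AllPairs.head u) (∈-++⁺ʳ (verts c) q) refl
    disj (there a∈)  q = AllPairs-cross (verts c) (AllPairs.tail u) a∈ q refl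

    sep : ∀ {a b} → a ∈ v ∷ verts c → b ∈ verts s → ¬ a ~ b
    sep a∈ b∈ a~b with closed p (node v c ∅) (let at , nb , kt , kf , dv , gc , _ = g in at , nb , kt , kf , dv , gc , tt)
                         (subst (λ l → _ ∈ v ∷ l) (sym (Listₚ.++-identityʳ (verts c))) a∈) a~b
    ... | inj₁ q = p∉s q b∈
    ... | inj₂ q = disj (subst (λ l → _ ∈ v ∷ l) (Listₚ.++-identityʳ (verts c)) q) b∈

  -- The path is nonempty, so an odd token always has somewhere to go; roots are treated separately.
  process : ∀ z p f → Tree (z ∷ p) f → Unique (verts f) → (∀ {a} → a ∈ z ∷ p → a ∉ verts f) → Path (z ∷ p) → State (z ∷ p) f
  process z p ∅ _ _ _ _ = emptyState _
  process z p (node v c s) g@(z~v , nb , kt , kf , dv , gc , gs) u p∉ P =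
    Siblings.merge S₁ (process z p s gs us p∉s P) disj p∉₁ p∉s sep
    where
    open Shape g u p∉
    S₀ : State (v ∷ z ∷ p) c
    S₀ = process v (z ∷ p) c gc uc p∉c (extend dv P)
    S₁ : State (z ∷ p) (node v c ∅)
    S₁ = [ (λ Iv → proj₁ (Node.IStep.stepI S₀ nb v∉c p∉₁ Iv (kt Iv) (here refl) z~v))
         , (λ Jv → JStep.stepJ S₀ nb v∉c p∉₁ Jv z~v (kf Jv) (above dv P) (Path.sorted P)) ]′ (I∨J v)

  -- Solutions for whole trees

  record Solution (f : Forest V) : Set where
    field
      comps  : List Component
      lowers : List Lower

    use : Cost
    use a b = uses-all a b (concatMap Component.allDirs comps) ℕ.+ lowerUse a b lowers

    field
      tokens↭  : tokensIn f ↭ concatMap Component.allTokens comps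
      lowers↭  : lowerIn [] f ↭ map Lower.ad lowers
      inside   : All (λ k → ∀ a → a ∈ Component.region k → a ∈ verts f) comps
      disjoint : AllPairs Disjoint comps
      bounded  : ∀ {a b} → a ~ b → use a b ℕ.≤ 4
      locally  : ∀ {a b} → a ∉ verts f → b ∉ verts f → use a b ≡ 0

  singleUse : V → V → Maybe Single → ℕ
  singleUse a b nothing  = 0
  singleUse a b (just s) = uses a b (Single.dir s)

  singleTok : Maybe Single → List (V × V)
  singleTok nothing  = []
  singleTok (just s) = (Single.o₁ s , Single.j₁ s) ∷ []

  component-toks : ∀ k → Component.allTokens k ≡ singleTok (Component.extra k) ++ concatMap Square.tokens (Component.squares k)
  component-toks k with Component.extra k
  ... | nothing = refl
  ... | just _  = refl

  squareDirs-uses : ∀ k a b → uses-all a b (Component.squareDirs k ++ Component.squareDirs k) ≡ 2 ℕ.* squaresUse a b (Component.squares k)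
  squareDirs-uses k a b = ≡-trans (tot-++ _ (Component.squareDirs k) (Component.squareDirs k)) (cong₂ ℕ._+_ (tot-map _ Square.dir (Component.squares k))
    (≡-trans (tot-map _ Square.dir (Component.squares k)) (sym (ℕₚ.+-identityʳ _))))

  component-uses : ∀ k a b → uses-all a b (Component.allDirs k) ≡ singleUse a b (Component.extra k) ℕ.+ 2 ℕ.* squaresUse a b (Component.squares k)
  component-uses k a b with Component.extra k
  ... | nothing = squareDirs-uses k a b
  ... | just s  = cong (uses a b (Single.dir s) ℕ.+_) (squareDirs-uses k a b)

  -- C is any upper bound for the uses, which allows bounds obtained for a different pairing to be
  -- reused.
  solve : ∀ {f} (ex : Maybe Single) (sqs : List Square) (low : List Lower) →
          (∀ {s} → ex ≡ just s → Single.o₁ s ∈ verts f × Single.o₂ s ∈ verts f) →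
          All (λ s → Near [] f (Square.o₁ s) × Near [] f (Square.o₂ s)) sqs →
          tokensIn f ↭ singleTok ex ++ concatMap Square.tokens sqs → lowerIn [] f ↭ map Lower.ad low →
          (C : Cost) → (∀ a b → singleUse a b ex ℕ.+ (2 ℕ.* squaresUse a b sqs ℕ.+ lowerUse a b low) ℕ.≤ C a b) →
          (∀ {a b} → a ~ b → C a b ℕ.≤ 4) → (∀ {a b} → a ∉ verts f → b ∉ verts f → C a b ≡ 0) → Solution f
  solve {f} ex sqs low ex⊆ sqs⊆ toks lows C C≥ bound local = record
    { comps = k ∷ [] ; lowers = low
    ; tokens↭ = ↭-trans toks (↭-reflexive (sym (≡-trans (Listₚ.++-identityʳ _) (component-toks k))))
    ; lowers↭ = lows ; inside = (λ _ → id) ∷ [] ; disjoint = [] ∷ []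
    ; bounded = λ {a} {b} a~b → ℕₚ.≤-trans (use≤ a b) (bound a~b)
    ; locally = λ {a} {b} a∉ b∉ → ℕₚ.n≤0⇒n≡0 (ℕₚ.≤-trans (use≤ a b) (ℕₚ.≤-reflexive (local a∉ b∉))) }
    where
    here⊆ : ∀ {a} → Near [] f a → a ∈ verts f
    here⊆ = [ id , (λ ()) ]′
    k : Component
    k = record { squares = sqs ; extra = ex ; region = verts f ; squares⊆ = All.map (λ (x , y) → here⊆ x , here⊆ y) sqs⊆ ; extra⊆ = ex⊆ }
    use≤ : ∀ a b → uses-all a b (Component.allDirs k ++ []) ℕ.+ lowerUse a b low ℕ.≤ C a b
    use≤ a b = ℕₚ.≤-trans (ℕₚ.≤-reflexive (≡-trans (cong (ℕ._+ lowerUse a b low) (≡-trans (cong (uses-all a b) (Listₚ.++-identityʳ (Component.allDirs k))) (component-uses k a b)))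
      (ℕₚ.+-assoc (singleUse a b ex) (2 ℕ.* squaresUse a b sqs) (lowerUse a b low)))) (C≥ a b)

  combine : ∀ {v c s} → Tree [] (node v c s) → Unique (verts (node v c s)) → Solution (node v c ∅) → Solution s → Solution (node v c s)
  combine {v} {c} {s} g u S₁ S₂ = record
    { comps = S₁.comps ++ S₂.comps ; lowers = S₁.lowers ++ S₂.lowers
    ; tokens↭ = ↭-trans (↭-reflexive (≡-trans (cong (λ l → concatMap tokensAt (v ∷ l ++ verts s)) (sym (Listₚ.++-identityʳ (verts c)))) (Listₚ.concatMap-++ tokensAt (v ∷ verts c ++ []) (verts s))))
             (↭-trans (++⁺ S₁.tokens↭ S₂.tokens↭) (↭-reflexive (sym (Listₚ.concatMap-++ Component.allTokens S₁.comps S₂.comps))))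
    ; lowers↭ = ↭-trans (↭-reflexive (≡-trans (cong (λ l → lowerAt v [] ++ l ++ lowerIn [] s) (sym (Listₚ.++-identityʳ (lowerIn (v ∷ []) c))))
               (sym (Listₚ.++-assoc (lowerAt v []) (lowerIn (v ∷ []) c ++ []) (lowerIn [] s)))))
             (↭-trans (++⁺ S₁.lowers↭ S₂.lowers↭) (↭-reflexive (sym (Listₚ.map-++ Lower.ad S₁.lowers S₂.lowers))))
    ; inside = Allₚ.++⁺ (All.map (λ q a r → in₁ (q a r)) S₁.inside) (All.map (λ q a r → in₂ (q a r)) S₂.inside)
    ; disjoint = AllPairsₚ.++⁺ S₁.disjoint S₂.disjoint (All.tabulate {P = λ k → All (Disjoint k) S₂.comps} (λ {k} k∈ → All.tabulate {P = Disjoint k} (λ k′∈ {a} r r′ → disj (to₁ (All.lookup S₁.inside k∈ a r)) (All.lookup S₂.inside k′∈ a r′))))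
    ; bounded = bound′
    ; locally = λ {a} {b} a∉ b∉ → ≡-trans (use-+ a b) (cong₂ ℕ._+_ (S₁.locally (a∉ ∘ in₁) (b∉ ∘ in₁)) (S₂.locally (a∉ ∘ in₂) (b∉ ∘ in₂))) }
    where
    open Shape g u (λ ())
    module S₁ = Solution S₁
    module S₂ = Solution S₂
    to₁ : ∀ {a} → a ∈ verts (node v c ∅) → a ∈ v ∷ verts c
    to₁ = subst (λ l → _ ∈ v ∷ l) (Listₚ.++-identityʳ (verts c))
    in₁ : ∀ {a} → a ∈ verts (node v c ∅) → a ∈ verts (node v c s)
    in₁ q with to₁ q
    ... | here eq = here eq
    ... | there r = there (∈-++⁺ˡ r)
    in₂ : ∀ {a} → a ∈ verts s → a ∈ verts (node v c s)
    in₂ = there ∘ ∈-++⁺ʳ (verts c)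
    use-+ : ∀ a b → uses-all a b (concatMap Component.allDirs (S₁.comps ++ S₂.comps)) ℕ.+ lowerUse a b (S₁.lowers ++ S₂.lowers) ≡ S₁.use a b ℕ.+ S₂.use a b
    use-+ a b = ≡-trans (cong₂ ℕ._+_ (≡-trans (cong (uses-all a b) (Listₚ.concatMap-++ Component.allDirs S₁.comps S₂.comps)) (tot-++ _ (concatMap Component.allDirs S₁.comps) (concatMap Component.allDirs S₂.comps)))
        (tot-++ _ S₁.lowers S₂.lowers))
      (lemma (uses-all a b (concatMap Component.allDirs S₁.comps)) (uses-all a b (concatMap Component.allDirs S₂.comps)) (lowerUse a b S₁.lowers) (lowerUse a b S₂.lowers))
      where
      lemma : ∀ x y z w → (x ℕ.+ y) ℕ.+ (z ℕ.+ w) ≡ (x ℕ.+ z) ℕ.+ (y ℕ.+ w)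
      lemma = solveℕ-∀
    only₁ : ∀ {a b} → a ~ b → a ∉ verts s → b ∉ verts s → S₁.use a b ℕ.+ S₂.use a b ℕ.≤ 4
    only₁ {a} {b} a~b a∉ b∉ = ℕₚ.≤-trans (ℕₚ.≤-reflexive (≡-trans (cong (S₁.use a b ℕ.+_) (S₂.locally a∉ b∉)) (ℕₚ.+-identityʳ _))) (S₁.bounded a~b)
    bound″ : ∀ {a b} → a ~ b → S₁.use a b ℕ.+ S₂.use a b ℕ.≤ 4
    bound″ {a} {b} a~b with a ∈? (v ∷ verts c) | b ∈? (v ∷ verts c)
    ... | yes a∈ | _      = only₁ a~b (disj a∈) (λ b∈ → sep a∈ b∈ a~b)
    ... | no _   | yes b∈ = only₁ a~b (λ a∈ → sep b∈ a∈ (~-sym a~b)) (disj b∈)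
    ... | no a∉  | no b∉  = ℕₚ.≤-trans (ℕₚ.≤-reflexive (cong (ℕ._+ S₂.use a b) (S₁.locally (a∉ ∘ to₁) (b∉ ∘ to₁)))) (S₂.bounded a~b)
    bound′ : ∀ {a b} → a ~ b → _ ℕ.≤ 4
    bound′ {a} {b} a~b = ℕₚ.≤-trans (ℕₚ.≤-reflexive (use-+ a b)) (bound″ a~b)

  -- Roots

  empty : {X : Set} (xs : List X) → (∀ {x} → x ∉ xs) → xs ≡ []
  empty []       _  = refl
  empty (x ∷ xs) ∉ = contradiction (here refl) ∉

  module RootI {v : V} {c : Forest V} (S : State (v ∷ []) c) (nb : ∀ {w} → v ~ w → w ∈ [] ⊎ w ∈ verts c)
               (v∉c : v ∉ verts c) (Iv : inI v ≡ true) (kt : ∀ {w} → w ∈ verts c → v ~ w → inI w ≡ false) where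
    open Node S nb v∉c (λ ())
    open IStep Iv kt

    rest≡[] : rest ≡ []
    rest≡[] = empty rest (λ m∈ → case t∈p m∈ of λ ())

    finish : (us : List Emission) (ps : List (Pair v)) (outs : List (Arrival v)) →
             map arrive outs ++ flat ps ≡ map arrive arr → (∀ a b → pendUse a b us ≡ itemsUse a b (map arrive outs)) →
             map (tok ∘ item) us ≡ map tok (map arrive outs) → All (λ x → o x ∈ verts c) (flat ps) →
             (ex : Maybe Single) → (∀ a b → singleUse a b ex ℕ.≤ pendUse a b us) → singleTok ex ≡ map (tok ∘ item) us →
             (∀ {s} → ex ≡ just s → Single.o₁ s ∈ verts f′ × Single.o₂ s ∈ verts f′) → Solution f′
    finish us ps outs items≡ us-use us-tok flat⊆ ex ex-use ex-tok ex⊆ = solve ex (map toSquare ps ++ sqs S) (low S) ex⊆ sqs⊆′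
        (↭-trans toks′ (↭-reflexive (cong (_++ concatMap Square.tokens (map toSquare ps ++ sqs S))
          (≡-trans (cong (map (tok ∘ item)) (≡-trans (cong (us ++_) rest≡[]) (Listₚ.++-identityʳ us))) (sym ex-tok)))))
        lows′ cost′
        (λ a b → ℕₚ.+-monoˡ-≤ (2 ℕ.* squaresUse a b (map toSquare ps ++ sqs S) ℕ.+ lowerUse a b (low S))
          (ℕₚ.≤-trans (ex-use a b) (ℕₚ.≤-trans (ℕₚ.≤-trans (ℕₚ.m≤m+n _ (pendUse a b rest)) (ℕₚ.≤-reflexive (sym (tot-++ _ us rest)))) (ℕₚ.m≤m+n _ _))))
        bound′ local′
      where open Finish us ps outs items≡ us-use us-tok flat⊆

    solution : Solution f′
    solution with parity (length (map arrive arr))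
    ... | inj₁ even with pairUp (map arrive arr) (compat arr id relArr) even
    ... | ps , eq = finish [] ps [] eq (λ _ _ → refl) refl (subst (All _) (sym eq) (o∈c arr id)) nothing (λ _ _ → z≤n) refl (λ ())
    solution | inj₂ odd = go arr refl odd
      where
      go : ∀ xs → xs ≡ arr → Even (suc (length (map arrive xs))) → Solution f′
      go ((m , refl) ∷ xs) eq odd with pairUp (map arrive xs) (compat xs (λ q → subst (_ ∈_) eq (there q)) (AllPairs.tail (subst (AllPairs Related ∘ map proj₁) (sym eq) relArr))) (suc₂⁻¹ odd)
      ... | ps , eq′ = finish (em ∷ []) ps ((m , refl) ∷ []) (≡-trans (cong (crossed m ∷_) eq′) (cong (map arrive) eq)) (λ _ _ → refl) refl
              (subst (All _) (sym eq′) (o∈c xs (λ q → subst (_ ∈_) eq (there q))))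
              -- The left-over item meets the empty walk at v. Its origin lies below v, so the
              -- result is not zero.
              (just (single′ (origin m) (j (item m)) v (pair (crossed m) (stay Iv v) (inj₁ (c≢v m∈c)))))
              (λ a b → ℕₚ.≤-reflexive (pair-uses (crossed m) (stay Iv v) (inj₁ (c≢v m∈c)) a b)) refl (λ { refl → in′ m∈c , here refl })
        where
        m∈c : origin m ∈ verts c
        m∈c = Valid.o∈ (validArr {m , refl} (subst ((m , refl) ∈_) eq (here refl)))
        -- The endpoints are irrelevant: em only accounts for the token left over at the root.
        em : Emission
        em = record { e = v ; t = e m ; e~t = ~-sym (e~t m) ; item = crossed m ; tag = tI }

  -- A root starts no J-J walks, so every edge at v keeps one use free for the partner of an odd
  -- item. `special` is the case in which no partner can be found at v.
  module RootJ {v : V} {c : Forest V} (S : State (v ∷ []) c) (nb : ∀ {w} → v ~ w → w ∈ [] ⊎ w ∈ verts c)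
               (v∉c : v ∉ verts c) (Jv : inI v ≡ false) (kf : ∃[ w ] (w ∈ verts c × v ~ w × inI w ≡ true))
               (gc : Tree (v ∷ []) c)
               (special : pend S ≡ [] → ∀ α → (∀ {w} → inI w ≡ true → w ~ v → w ≡ α) → (∀ {d} → d ∈ roots c → inI d ≡ true) → Solution (node v c ∅)) where
    open JNode S nb v∉c (λ ()) Jv

    rest≡[] : rest ≡ []
    rest≡[] = empty rest (λ m∈ → case t∈p m∈ of λ ())

    pool : List (Item v)
    pool = map mkOwn AO ++ map arrive arrJ

    inside : ∀ {a} → Near [] f′ a → a ∈ verts f′
    inside = [ id , (λ ()) ]′

    pool⊆ : All (λ x → o x ∈ verts f′) pool
    pool⊆ = Allₚ.++⁺ (Allₚ.map⁺ (All.tabulate (λ {x} _ → inside (nearOwn x)))) (Allₚ.map⁺ (All.tabulate (λ x∈ → inside (nearArr (proj₁ (∈arrJ x∈))))))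

    -- `E` counts the uses by the walk of the partner. It enters once only, because a single
    -- direction is not doubled.
    finish : (outs : List (Item v)) (ps : List (Pair v)) → outs ++ flat ps ↭ pool →
             (ex : Maybe Single) (E : Cost) → (∀ a b → singleUse a b ex ℕ.≤ itemsUse a b outs ℕ.+ E a b) → singleTok ex ≡ map tok outs →
             (∀ {s} → ex ≡ just s → Single.o₁ s ∈ verts f′ × Single.o₂ s ∈ verts f′) →
             (∀ a b → E a b ≡ E b a) → (∀ {a b} → a ≢ v → b ≢ v → a ~ b → cost S a b ℕ.+ E a b ℕ.≤ 4) →
             (∀ {w} → w ~ v → E w v ℕ.≤ 1) → (∀ {a b} → a ∉ verts f′ → b ∉ verts f′ → E a b ≡ 0) → Solution f′
    finish outs ps items ex E ex-use ex-tok ex⊆ E-sym E-away E-v E-local =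
      solve ex (newSqs ++ sqs S) (low S) ex⊆ (Allₚ.++⁺ newSqs⊆ (All.map (λ (x , y) → near′ x , near′ y) (sqs⊆ S))) toks′ lows′ C C≥ bound′ local′
      where
      open Core [] arrI ↭-refl [] refl outs ps (↭-trans items (↭-reflexive (cong (λ xs → map mkOwn xs ++ map arrive arrJ) (sym (Listₚ.++-identityʳ AO)))))
      C : Cost
      C a b = (cost S a b ℕ.+ 2 ℕ.* steps a b v S2) ℕ.+ E a b
      C≥ : ∀ a b → singleUse a b ex ℕ.+ (2 ℕ.* squaresUse a b (newSqs ++ sqs S) ℕ.+ lowerUse a b (low S)) ℕ.≤ C a b
      C≥ a b = ℕₚ.≤-trans (ℕₚ.+-mono-≤ (ℕₚ.≤-trans (ex-use a b) (ℕₚ.+-monoˡ-≤ (E a b) (ℕₚ.m≤m+n O (O ℕ.+ 2 ℕ.* R))))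
          (ℕₚ.≤-reflexive (cong (λ x → 2 ℕ.* x ℕ.+ L) (tot-++ _ newSqs (sqs S)))))
        (ℕₚ.≤-reflexive (≡-trans (lemma₁ O R (E a b) N Q L) (≡-trans (cong (λ x → 2 ℕ.* x ℕ.+ (2 ℕ.* Q ℕ.+ L) ℕ.+ E a b) (use≡ a b)) (lemma₂ (pendUse a b (pend S)) (steps a b v S2) (2 ℕ.* Q ℕ.+ L) (E a b)))))
        where
        O = itemsUse a b outs
        R = pendUse a b rest
        N = squaresUse a b newSqs
        Q = squaresUse a b (sqs S)
        L = lowerUse a b (low S)
        lemma₁ : ∀ o r e n q l → ((o ℕ.+ (o ℕ.+ 2 ℕ.* r)) ℕ.+ e) ℕ.+ (2 ℕ.* (n ℕ.+ q) ℕ.+ l) ≡ 2 ℕ.* ((o ℕ.+ r) ℕ.+ n) ℕ.+ (2 ℕ.* q ℕ.+ l) ℕ.+ e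
        lemma₁ = solveℕ-∀
        lemma₂ : ∀ u s k e → 2 ℕ.* (u ℕ.+ s) ℕ.+ k ℕ.+ e ≡ ((2 ℕ.* u ℕ.+ k) ℕ.+ 2 ℕ.* s) ℕ.+ e
        lemma₂ = solveℕ-∀
      C-sym : ∀ a b → C a b ≡ C b a
      C-sym a b = cong₂ ℕ._+_ (cong₂ (λ x y → x ℕ.+ 2 ℕ.* y) (cost-sym S a b) (steps-sym a b v S2)) (E-sym a b)
      C-away : ∀ {a b} → a ≢ v → b ≢ v → C a b ≡ cost S a b ℕ.+ E a b
      C-away {a} {b} a≢ b≢ = cong (ℕ._+ E a b) (≡-trans (cong (λ x → cost S a b ℕ.+ 2 ℕ.* x) (steps-away S2 a≢ b≢)) (ℕₚ.+-identityʳ _))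
      base≤3 : ∀ {w} → w ~ v → cost S w v ℕ.+ 2 ℕ.* count w S2 ℕ.≤ 3
      base≤3 {w} w~v with I∨J w | nb (~-sym w~v)
      ... | inj₁ Iw | inj₂ w∈c = ℕₚ.≤-trans (ℕₚ.+-mono-≤ (ℕₚ.≤-reflexive (upI S w∈c Iw (here refl))) (ℕₚ.*-monoʳ-≤ 2 (S2-I Iw (λ ())))) (ℕₚ.n≤1+n 2)
      ... | inj₂ Jw | inj₂ w∈c with w ∈? eJ
      ... | no w∉  = ℕₚ.≤-trans (ℕₚ.+-mono-≤ (upJ S w∈c Jw (here refl) Jv) (ℕₚ.≤-reflexive (cong (2 ℕ.*_) (≡-trans (S2-J Jw) (count-∉ eJ w∉))))) (ℕₚ.n≤1+n 2)
      ... | yes w∈ with eJ⊆ w∈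
      ... | (m , refl) , x∈ , refl = ℕₚ.+-mono-≤ (Valid.toJ (validArr (proj₁ (∈arrJ x∈))) Jw Jv)
              (ℕₚ.*-monoʳ-≤ 2 (ℕₚ.≤-trans (ℕₚ.≤-reflexive (S2-J Jw)) (count-unique w unique-eJ)))
      bound-v : ∀ {w} → w ~ v → C w v ℕ.≤ 4
      bound-v {w} w~v = ℕₚ.+-mono-≤ (ℕₚ.≤-trans (ℕₚ.≤-reflexive (cong (λ x → cost S w v ℕ.+ 2 ℕ.* x) (steps-count S2 (λ eq → ~-irrefl eq w~v)))) (base≤3 w~v)) (E-v w~v)
      bound′ : ∀ {a b} → a ~ b → C a b ℕ.≤ 4
      bound′ {a} {b} a~b with a Finₚ.≟ v | b Finₚ.≟ v
      ... | yes refl | _        = ℕₚ.≤-trans (ℕₚ.≤-reflexive (C-sym v b)) (bound-v (~-sym a~b))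
      ... | no _     | yes refl = bound-v a~b
      ... | no a≢    | no b≢    = ℕₚ.≤-trans (ℕₚ.≤-reflexive (C-away a≢ b≢)) (E-away a≢ b≢ a~b)
      local′ : ∀ {a b} → a ∉ verts f′ → b ∉ verts f′ → C a b ≡ 0
      local′ a∉ b∉ = ≡-trans (C-away (λ { refl → a∉ (here refl) }) (λ { refl → b∉ (here refl) })) (cong₂ ℕ._+_ (local S (a∉ ∘ in′) (b∉ ∘ in′)) (E-local a∉ b∉))
      lows′ : lowerIn [] f′ ↭ map Lower.ad (low S)
      lows′ = ↭-trans (↭-reflexive (cong₂ _++_ (lowerAt-J [] Jv) (Listₚ.++-identityʳ (lowerIn (v ∷ []) c)))) (lows S)
      toks′ : tokensIn f′ ↭ singleTok ex ++ concatMap Square.tokens (newSqs ++ sqs S)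
      toks′ = begin
        tokensIn f′ ≡⟨ ≡-trans tokens-node (cong (_++ tokensIn c) (tokensAt-J Jv)) ⟩
        N ++ tokensIn c ↭⟨ ++⁺ˡ N (toks S) ⟩
        N ++ (map (tok ∘ item) (pend S) ++ T) ≡⟨ sym (Listₚ.++-assoc N (map (tok ∘ item) (pend S)) T) ⟩
        (N ++ map (tok ∘ item) (pend S)) ++ T ↭⟨ ++⁺ʳ T toks↭ ⟩
        ((map tok outs ++ map (tok ∘ item) rest) ++ Q) ++ T ≡⟨ cong (λ l → (l ++ Q) ++ T) (≡-trans (cong (λ r → map tok outs ++ map (tok ∘ item) r) rest≡[]) (≡-trans (Listₚ.++-identityʳ (map tok outs)) (sym ex-tok))) ⟩
        (singleTok ex ++ Q) ++ T ≡⟨ Listₚ.++-assoc (singleTok ex) Q T ⟩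
        singleTok ex ++ (Q ++ T) ≡⟨ cong (singleTok ex ++_) (sym (Listₚ.concatMap-++ Square.tokens newSqs (sqs S))) ⟩
        singleTok ex ++ concatMap Square.tokens (newSqs ++ sqs S) ∎
        where
        open PermutationReasoning
        N = map (_, v) (nbrsI v)
        T = concatMap Square.tokens (sqs S)
        Q = concatMap Square.tokens newSqs

    module Odd (odd : Even (suc (length pool))) {x : Item v} {xs : List (Item v)} (pool↭ : pool ↭ x ∷ xs) where

      with-partner : (y : Item v) → Compat x y → o y ∈ verts f′ →
             (∀ {a b} → a ≢ v → b ≢ v → a ~ b → cost S a b ℕ.+ uses a b (dir y) ℕ.≤ 4) →
             (∀ {w} → w ~ v → uses w v (dir y) ℕ.≤ 1) → (∀ {a b} → a ∉ verts f′ → b ∉ verts f′ → uses a b (dir y) ≡ 0) → Solution f′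
      with-partner y xy y∈ away at-v loc with pairUp xs (AllPairs.tail (AllPairs-↭ (λ {a} {b} → Compat-sym {x = a} {b}) pool↭ base)) (suc₂⁻¹ (subst (Even ∘ suc) (↭-length pool↭) odd))
      ... | ps , eq = finish (x ∷ []) ps (↭-trans (↭-reflexive (cong (x ∷_) eq)) (↭-sym pool↭)) (just (single′ (o x) (j x) (o y) (pair x y xy))) (λ a b → uses a b (dir y))
            (λ a b → ℕₚ.≤-reflexive (≡-trans (pair-uses x y xy a b) (cong (ℕ._+ uses a b (dir y)) (sym (ℕₚ.+-identityʳ _))))) refl
            (λ { refl → All.head (All-resp-↭ pool↭ pool⊆) , y∈ }) (λ a b → uses-sym a b (dir y)) away at-v loc

      with-own : (y : Own v) → Compat x (mkOwn y) → Solution f′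
      with-own y@(i , Ii , i~v) xy = with-partner (mkOwn y) xy i∈
          (λ {a} {b} a≢ b≢ a~b → ℕₚ.≤-trans (ℕₚ.≤-reflexive (≡-trans (cong (cost S a b ℕ.+_) (steps-away (i ∷ []) a≢ b≢)) (ℕₚ.+-identityʳ _))) (bound S a~b))
          (λ {w} w~v → ℕₚ.≤-trans (ℕₚ.≤-reflexive (steps-count (i ∷ []) (λ eq → ~-irrefl eq w~v))) (count-unique w {i ∷ []} ([] ∷ [])))
          (λ a∉ b∉ → steps-away (i ∷ []) (λ { refl → a∉ (here refl) }) (λ { refl → b∉ (here refl) }))
        where
        i∈ : i ∈ verts f′
        i∈ = inside (nearOwn y)

      -- The walk i, d, v arrives with residue -1 against the +1 of x, so the pair is admissible
      -- even if i is the origin of x.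
      with-fallback : ∀ {d} → d ~ v → d ∈ verts c → inI d ≡ false → Fallback (cost S) d v → σ x ≡ true → Solution f′
      with-fallback {d} d~v d∈c Jd F σx = with-partner y (inj₂ (λ eq → case ≡-trans (sym σx) eq of λ ())) i∈ away at-v loc
        where
        open Fallback F
        y : Item v
        y = cross (own Ii i~d) d~v
        i∈ : i ∈ verts f′
        i∈ with closed (v ∷ []) c gc d∈c (~-sym i~d)
        ... | inj₁ (here eq) = contradiction eq (J⇒≢I Ii Jv)
        ... | inj₂ q         = in′ q
        away : ∀ {a b} → a ≢ v → b ≢ v → a ~ b → cost S a b ℕ.+ uses a b (dir y) ℕ.≤ 4
        away {a} {b} a≢ b≢ a~b = ℕₚ.≤-trans (ℕₚ.≤-reflexive (cong (λ k → cost S a b ℕ.+ (same a b (i , d) ℕ.+ k)) (steps-away (d ∷ []) a≢ b≢))) (decide (same? a b (i , d)))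
          where
          decide : (q : Dec (Same a b (i , d))) → cost S a b ℕ.+ (ι q ℕ.+ 0) ℕ.≤ 4
          decide (no _)                   = ℕₚ.≤-trans (ℕₚ.≤-reflexive (ℕₚ.+-identityʳ _)) (bound S a~b)
          decide (yes (inj₁ (refl , refl))) = ℕₚ.+-monoˡ-≤ 1 id≤
          decide (yes (inj₂ (refl , refl))) = ℕₚ.+-monoˡ-≤ 1 (ℕₚ.≤-trans (ℕₚ.≤-reflexive (cost-sym S d i)) id≤)
        at-v : ∀ {w} → w ~ v → uses w v (dir y) ℕ.≤ 1
        at-v {w} w~v = ℕₚ.≤-trans (ℕₚ.≤-reflexive (cong₂ ℕ._+_ (ι-no (same? w v (i , d)) (λ { (inj₁ (_ , eq)) → c≢v d∈c eq ; (inj₂ (eq , _)) → J⇒≢I Ii Jv eq }))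
          (steps-count (d ∷ []) (λ eq → ~-irrefl eq w~v)))) (count-unique w {d ∷ []} ([] ∷ []))
        loc : ∀ {a b} → a ∉ verts f′ → b ∉ verts f′ → uses a b (dir y) ≡ 0
        loc {a} {b} a∉ b∉ = cong₂ ℕ._+_ (ι-no (same? a b (i , d)) (λ { (inj₁ (refl , _)) → a∉ i∈ ; (inj₂ (refl , _)) → b∉ i∈ }))
          (steps-away (d ∷ []) (λ { refl → a∉ (here refl) }) (λ { refl → b∉ (here refl) }))

    solution : Solution f′
    solution with parity (length pool)
    ... | inj₁ even with pairUp pool base even
    ... | ps , eq = finish [] ps (↭-reflexive eq) nothing (λ _ _ → 0) (λ _ _ → z≤n) refl (λ ()) (λ _ _ → refl)
          (λ _ _ a~b → ℕₚ.≤-trans (ℕₚ.≤-reflexive (ℕₚ.+-identityʳ _)) (bound S a~b)) (λ _ → z≤n) (λ _ _ → refl)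
    solution | inj₂ odd = viaJ arrJ refl
      where
      below : Own v
      below = let w , _ , v~w , Iw = kf in w , Iw , ~-sym v~w
      pool-∷ : ∀ {α AO′} → AO ≡ α ∷ AO′ → pool ↭ mkOwn α ∷ map mkOwn AO′ ++ map arrive arrJ
      pool-∷ eqA = ↭-reflexive (cong (λ xs → map mkOwn xs ++ map arrive arrJ) eqA)
      viaA : arrJ ≡ [] → ∀ {α AO′} → AO ≡ α ∷ AO′ → Solution f′
      viaA eqJ {α} {AO′} eqA with any? (λ i → ¬? (proj₁ α Finₚ.≟ i)) (nbrsI v)
      ... | yes some = let i , i∈ , α≢i = find some in Odd.with-own odd (pool-∷ eqA) (i , nbrI⁻ i∈) (inj₁ α≢i)
      -- The vertex α is now the only neighbour of v in I. An arrival from I would come from α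
      -- itself, which is in A, so nothing at all is pending.
      ... | no none = viaRoots (any? J? (roots c))
        where
        only : ∀ {w} → inI w ≡ true → w ~ v → w ≡ proj₁ α
        only {w} Iw w~v with proj₁ α Finₚ.≟ w
        ... | yes eq = sym eq
        ... | no ≢w  = contradiction (lose (nbrI⁺ Iw w~v) ≢w) none
        α∈A : proj₁ α ∈ A
        α∈A = subst (proj₁ α ∈_) (≡-trans (cong (map proj₁) (sym eqA)) AO≡) (here refl)
        arrI≡[] : arrI ≡ []
        arrI≡[] = empty arrI (λ {x} x∈ → let open FromI (fromI x∈) in proj₂ (A⁻ α∈A) (subst (_∈ us) (only Ie e~v) (∈-map⁺ emitter x∈)))
        pend≡[] : pend S ≡ []
        pend≡[] = ↭-empty-inv (↭-trans (↭-sym perm) (↭-trans (++⁺ (map⁺ proj₁ (↭-sym arr↭)) (↭-reflexive rest≡[]))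
          (↭-reflexive (cong₂ (λ xs ys → map proj₁ (xs ++ ys) ++ []) arrI≡[] eqJ))))
        viaRoots : Dec (Any (λ d → inI d ≡ false) (roots c)) → Solution f′
        viaRoots (no ¬J) = special pend≡[] (proj₁ α) only (λ {d} d∈ → [ id , (λ Jd → contradiction (lose d∈ Jd) ¬J) ]′ (I∨J d))
        viaRoots (yes some) with find some
        ... | d , d∈ , Jd with back S d∈ Jd head Jv
        ... | inj₁ q = case subst (Any _) pend≡[] q of λ ()
        ... | inj₂ F = Odd.with-fallback odd (pool-∷ eqA) (~-sym (roots-attached c gc d∈)) (roots⊆ c d∈) Jd F refl
      viaJ : ∀ xs → arrJ ≡ xs → Solution f′
      viaJ (x ∷ J′) eqJ = Odd.with-own odd pool↭ below (Compat-sym {x = mkOwn below} {arrive x} (compatOwnJ below (subst (x ∈_) (sym eqJ) (here refl))))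
        where
        pool↭ : pool ↭ arrive x ∷ map mkOwn AO ++ map arrive J′
        pool↭ = ↭-trans (↭-reflexive (cong (λ xs → map mkOwn AO ++ map arrive xs) eqJ)) (shift (arrive x) (map mkOwn AO) (map arrive J′))
      viaJ [] eqJ = go AO refl
        where
        go : ∀ ys → AO ≡ ys → Solution f′
        go []        eqA = case subst Even (cong₂ (λ xs ys → suc (length (map mkOwn xs ++ map arrive ys))) eqA eqJ) odd of λ ()
        go (α ∷ AO′) eqA = viaA eqJ eqA

  -- The only child u of the root v is its only neighbour in I and everything below u has been paired up.
  -- The token (u , v) then replaces one of a pair at u, or is covered by a walk u, w, i through a child w of u.
  module Pendant {v u : V} {c : Forest V} (S : State (u ∷ v ∷ []) c)
                 (nb : ∀ {w} → u ~ w → w ∈ v ∷ [] ⊎ w ∈ verts c) (u∉c : u ∉ verts c)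
                 (p∉ : ∀ {a} → a ∈ v ∷ [] → a ∉ u ∷ verts c) (Iu : inI u ≡ true)
                 (kt : ∀ {w} → w ∈ verts c → u ~ w → inI w ≡ false) (gc : Tree (u ∷ v ∷ []) c)
                 (Jv : inI v ≡ false) (v~u : v ~ u) (only : ∀ {w} → inI w ≡ true → w ~ v → w ≡ u)
                 (rest≡[] : Node.rest S nb u∉c p∉ ≡ []) (even : Even (length (map arrive (Node.arr S nb u∉c p∉)))) (c≢∅ : c ≢ ∅) where
    open Node S nb u∉c p∉
    open IStep Iu kt

    F : Forest V
    F = node v (node u c ∅) ∅

    v∈ : v ∈ verts F
    v∈ = here refl

    u∈ : u ∈ verts F
    u∈ = there (here refl)

    in″ : ∀ {a} → a ∈ verts f′ → a ∈ verts F
    in″ = there ∘ ∈-++⁺ˡ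

    near″ : ∀ {a} → Near (u ∷ v ∷ []) c a → Near [] F a
    near″ (inj₁ q)                 = inj₁ (in″ (in′ q))
    near″ (inj₂ (here refl))         = inj₁ u∈
    near″ (inj₂ (there (here refl))) = inj₁ v∈

    nbrs≡ : nbrsI v ↭ u ∷ []
    nbrs≡ = unique-↭ (Uniqueₚ.filter⁺ P? (Uniqueₚ.allFin⁺ n)) ([] ∷ [])
      (λ q → let Iw , w~v = proj₂ (∈-filter⁻ P? {xs = allFin n} q) in here (only Iw w~v))
      (λ { (here refl) → ∈-filter⁺ P? (∈-allFin u) (Iu , ~-sym v~u) })
      where P? = λ i → I? i ×-dec (i ~? v)

    tokens-F : tokensIn F ↭ (u , v) ∷ map (tok ∘ item) (map proj₁ arr) ++ concatMap Square.tokens (sqs S)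
    tokens-F = begin
      tokensIn F ≡⟨ cong (λ l → tokensAt v ++ concatMap tokensAt l) (Listₚ.++-identityʳ (u ∷ verts c ++ [])) ⟩
      tokensAt v ++ tokensIn f′ ≡⟨ cong₂ _++_ (tokensAt-J Jv) (≡-trans tokens-node (cong (_++ tokensIn c) (tokensAt-I Iu))) ⟩
      map (_, v) (nbrsI v) ++ tokensIn c ↭⟨ ++⁺ (map⁺ (_, v) nbrs≡) (↭-trans (toks S) (++⁺ʳ Q (map⁺ (tok ∘ item) (↭-sym perm)))) ⟩
      (u , v) ∷ map (tok ∘ item) (map proj₁ arr ++ rest) ++ Q ≡⟨ cong (λ l → (u , v) ∷ map (tok ∘ item) l ++ Q) (≡-trans (cong (map proj₁ arr ++_) rest≡[]) (Listₚ.++-identityʳ _)) ⟩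
      (u , v) ∷ map (tok ∘ item) (map proj₁ arr) ++ Q ∎
      where
      open PermutationReasoning
      Q = concatMap Square.tokens (sqs S)

    lowers-F : lowerIn [] F ↭ map Lower.ad (low S)
    lowers-F = ↭-trans (↭-reflexive (≡-trans (cong₂ _++_ (lowerAt-J [] Jv) (Listₚ.++-identityʳ (lowerAt u (v ∷ []) ++ lowerIn (u ∷ v ∷ []) c ++ [])))
      (cong₂ _++_ (lowerAt-I (v ∷ []) Iu) (Listₚ.++-identityʳ (lowerIn (u ∷ v ∷ []) c))))) (lows S)

    sqs-F : All (λ s → Near [] F (Square.o₁ s) × Near [] F (Square.o₂ s)) (sqs S)
    sqs-F = All.map (λ (x , y) → near″ x , near″ y) (sqs⊆ S)

    -- The first two items at u are separated: one forms the single direction with u as its partner,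
    -- the other a square with the token (u, v), which stays at u. No edge is used more often than
    -- in the pairing of all arrivals.
    busy : ∀ {x₀ x₁ xs} → arr ≡ x₀ ∷ x₁ ∷ xs → Even (length (map arrive xs)) → Solution F
    busy {x₀} {x₁} {xs} eq ev with pairUp (map arrive arr) (compat arr id relArr) even
                              | pairUp (map arrive xs) (compat xs (λ q → subst (_ ∈_) (sym eq) (there (there q))) (AllPairs.tail (AllPairs.tail (subst (AllPairs Related ∘ map proj₁) eq relArr)))) ev
    ... | ps , ps≡ | qs , qs≡ = solve (just (single′ (o y₀) (j y₀) u (pair y₀ (stay Iu u) (inj₁ (c≢v y₀∈))))) (sq ∷ map toSquare qs ++ sqs S) (low S)
          (λ { refl → in″ (in′ y₀∈) , u∈ })
          ((inj₁ (in″ (in′ y₁∈)) , inj₁ u∈) ∷ Allₚ.++⁺ (pairs⊆ qs (subst (All _) (sym qs≡) (o∈c xs (λ q → subst (_ ∈_) (sym eq) (there (there q)))))) sqs-F)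
          toks″ lowers-F cost′ cost≥ bound′ (λ a∉ b∉ → local′ (a∉ ∘ in″) (b∉ ∘ in″))
      where
      y₀ = arrive x₀
      y₁ = arrive x₁
      y∈ : ∀ {x} → x ∈ arr → o (arrive x) ∈ verts c
      y∈ {x} x∈ = subst (_∈ verts c) (sym (arrive-o x)) (Valid.o∈ (validArr x∈))
      y₀∈ : o y₀ ∈ verts c
      y₀∈ = y∈ (subst (x₀ ∈_) (sym eq) (here refl))
      y₁∈ : o y₁ ∈ verts c
      y₁∈ = y∈ (subst (x₁ ∈_) (sym eq) (there (here refl)))
      open Finish [] ps [] ps≡ (λ _ _ → refl) refl (subst (All _) (sym ps≡) (o∈c arr id)) using (cost′; bound′; local′)
      sq : Square
      sq = square (o y₁) (j y₁) u v (pair y₁ (stay Iu v) (inj₁ (c≢v y₁∈)))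
      pairs⊆ : ∀ ps → All (λ x → o x ∈ verts c) (flat ps) → All (λ s → Near [] F (Square.o₁ s) × Near [] F (Square.o₂ s)) (map toSquare ps)
      pairs⊆ []       _            = []
      pairs⊆ (_ ∷ ps) (x ∷ y ∷ xs) = (inj₁ (in″ (in′ x)) , inj₁ (in″ (in′ y))) ∷ pairs⊆ ps xs
      toks″ : tokensIn F ↭ tok y₀ ∷ tok y₁ ∷ (u , v) ∷ concatMap Square.tokens (map toSquare qs ++ sqs S)
      toks″ = ↭-trans tokens-F (↭-trans (↭-reflexive (cong (λ l → (u , v) ∷ l ++ Q) (≡-trans (sym (arriveToks arr)) (cong (map tok ∘ map arrive) eq))))
        (↭-trans (↭-sym (shifts (tok y₀ ∷ tok y₁ ∷ []) ((u , v) ∷ [])))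
        (↭-reflexive (cong (λ l → tok y₀ ∷ tok y₁ ∷ (u , v) ∷ l) (≡-trans (cong (_++ Q) (≡-trans (cong (map tok) (sym qs≡)) (sym (toSquares-tokens qs)))) (sym (Listₚ.concatMap-++ Square.tokens (map toSquare qs) (sqs S))))))))
        where Q = concatMap Square.tokens (sqs S)
      cost≥ : ∀ a b → uses a b (Span.dir (pair y₀ (stay Iu u) (inj₁ (c≢v y₀∈)))) ℕ.+ (2 ℕ.* squaresUse a b (sq ∷ map toSquare qs ++ sqs S) ℕ.+ lowerUse a b (low S)) ℕ.≤ cost′ a b
      cost≥ a b = ℕₚ.≤-trans (ℕₚ.≤-reflexive (cong₂ (λ x y → x ℕ.+ (2 ℕ.* y ℕ.+ L)) (≡-trans (pair-uses y₀ (stay Iu u) (inj₁ (c≢v y₀∈)) a b) (ℕₚ.+-identityʳ _))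
            (cong₂ ℕ._+_ (≡-trans (pair-uses y₁ (stay Iu v) (inj₁ (c≢v y₁∈)) a b) (ℕₚ.+-identityʳ _)) (≡-trans (tot-++ _ (map toSquare qs) (sqs S)) (cong (ℕ._+ Q) (≡-trans (toSquares-uses qs a b) (cong (itemsUse a b) qs≡)))))))
          (ℕₚ.≤-trans (ℕₚ.m≤n+m _ U₀) (ℕₚ.≤-trans (ℕₚ.≤-reflexive (≡-trans (lemma U₀ U₁ X Q L) (cong (λ x → 2 ℕ.* x ℕ.+ L) squares≡))) (ℕₚ.m≤n+m _ (2 ℕ.* pendUse a b rest))))
        where
        U₀ = uses a b (dir y₀)
        U₁ = uses a b (dir y₁)
        X  = itemsUse a b (map arrive xs)
        Q  = squaresUse a b (sqs S)
        L  = lowerUse a b (low S)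
        squares≡ : (U₀ ℕ.+ (U₁ ℕ.+ X)) ℕ.+ Q ≡ squaresUse a b (map toSquare ps ++ sqs S)
        squares≡ = sym (≡-trans (tot-++ _ (map toSquare ps) (sqs S)) (cong (ℕ._+ Q) (≡-trans (toSquares-uses ps a b) (cong (itemsUse a b) (≡-trans ps≡ (cong (map arrive) eq))))))
        lemma : ∀ u w x q l → u ℕ.+ (u ℕ.+ (2 ℕ.* (w ℕ.+ (x ℕ.+ q)) ℕ.+ l)) ≡ 2 ℕ.* ((u ℕ.+ (w ℕ.+ x)) ℕ.+ q) ℕ.+ l
        lemma = solveℕ-∀

    -- Without pending items the invariant `quiet` at a child w of u leaves one free use on both
    -- edges of the walk u, w, i.
    idle : arr ≡ [] → ∀ {w} → w ∈ roots c → Solution F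
    idle eq {w} w∈ with quiet S w∈ Jw head Iu
      where
      Jw : inI w ≡ false
      Jw = kt (roots⊆ c w∈) (roots-attached c gc w∈)
    ... | inj₁ some = case subst (Any _) pend≡[] some of λ ()
      where
      pend≡[] : pend S ≡ []
      pend≡[] = ↭-empty-inv (↭-trans (↭-sym perm) (↭-reflexive (cong₂ (λ xs ys → map proj₁ xs ++ ys) eq rest≡[])))
    ... | inj₂ Q = solve (just (single′ u v i (pair (own Iu u~w) (own Ii i~d) (inj₁ (i≢z ∘ sym))))) (sqs S) (low S) (λ { refl → u∈ , i∈ }) sqs-F
          (↭-trans tokens-F (↭-reflexive (cong (λ xs → (u , v) ∷ map (tok ∘ item) (map proj₁ xs) ++ concatMap Square.tokens (sqs S)) eq))) lowers-F
          C C≥ bound″ local″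
      where
      open Quiet Q
      u~w : u ~ w
      u~w = roots-attached c gc w∈
      w∈F : w ∈ verts F
      w∈F = in″ (in′ (roots⊆ c w∈))
      i∈ : i ∈ verts F
      i∈ with closed (u ∷ v ∷ []) c gc (roots⊆ c w∈) (~-sym i~d)
      ... | inj₁ (here refl)         = u∈
      ... | inj₁ (there (here refl)) = v∈
      ... | inj₂ q                   = in″ (in′ q)
      C : Cost
      C a b = cost S a b ℕ.+ ((same a b (u , w) ℕ.+ 0) ℕ.+ (same a b (i , w) ℕ.+ 0))
      C≥ : ∀ a b → uses a b (Span.dir (pair (own Iu u~w) (own Ii i~d) (inj₁ (i≢z ∘ sym)))) ℕ.+ (2 ℕ.* squaresUse a b (sqs S) ℕ.+ lowerUse a b (low S)) ℕ.≤ C a b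
      C≥ a b = ℕₚ.≤-trans (ℕₚ.≤-reflexive (≡-trans (ℕₚ.+-comm _ (2 ℕ.* squaresUse a b (sqs S) ℕ.+ lowerUse a b (low S))) (cong ((2 ℕ.* squaresUse a b (sqs S) ℕ.+ lowerUse a b (low S)) ℕ.+_) (pair-uses (own Iu u~w) (own Ii i~d) (inj₁ (i≢z ∘ sym)) a b))))
        (ℕₚ.+-monoˡ-≤ ((same a b (u , w) ℕ.+ 0) ℕ.+ (same a b (i , w) ℕ.+ 0)) (ℕₚ.m≤n+m _ (2 ℕ.* pendUse a b (pend S))))
      ≤3 : ∀ {a b x} → cost S x w ℕ.≤ 3 → Same a b (x , w) → cost S a b ℕ.≤ 3
      ≤3 le (inj₁ (refl , refl)) = le
      ≤3 le (inj₂ (refl , refl)) = ℕₚ.≤-trans (ℕₚ.≤-reflexive (cost-sym S _ _)) le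
      not-both : ∀ {a b} → Same a b (u , w) → ¬ Same a b (i , w)
      not-both (inj₁ (refl , refl)) (inj₁ (eq , _))    = i≢z eq
      not-both (inj₁ (refl , refl)) (inj₂ (eq , _))    = ~-irrefl eq i~d
      not-both (inj₂ (refl , refl)) (inj₁ (eq , _))    = ~-irrefl eq i~d
      not-both (inj₂ (refl , refl)) (inj₂ (eq , _))    = i≢z eq
      bound″ : ∀ {a b} → a ~ b → C a b ℕ.≤ 4
      bound″ {a} {b} a~b = decide (same? a b (u , w)) (same? a b (i , w))
        where
        decide : (q : Dec (Same a b (u , w))) (q′ : Dec (Same a b (i , w))) → cost S a b ℕ.+ ((ι q ℕ.+ 0) ℕ.+ (ι q′ ℕ.+ 0)) ℕ.≤ 4
        decide (no _)  (no _)   = ℕₚ.≤-trans (ℕₚ.≤-reflexive (ℕₚ.+-identityʳ _)) (bound S a~b)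
        decide (yes q) (no _)   = ℕₚ.+-monoˡ-≤ 1 (≤3 (ℕₚ.≤-trans (ℕₚ.≤-reflexive (cost-sym S u w)) dz≤) q)
        decide (no _)  (yes q′) = ℕₚ.+-monoˡ-≤ 1 (≤3 id≤ q′)
        decide (yes q) (yes q′) = contradiction q′ (not-both q)
      local″ : ∀ {a b} → a ∉ verts F → b ∉ verts F → C a b ≡ 0
      local″ {a} {b} a∉ b∉ = cong₂ ℕ._+_ (local S (a∉ ∘ in″ ∘ in′) (b∉ ∘ in″ ∘ in′)) (cong₂ (λ x y → (x ℕ.+ 0) ℕ.+ (y ℕ.+ 0)) (outside u) (outside i))
        where
        outside : ∀ x → same a b (x , w) ≡ 0
        outside x = ι-no (same? a b (x , w)) (λ { (inj₁ (_ , refl)) → b∉ w∈F ; (inj₂ (_ , refl)) → a∉ w∈F })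

    solution : Solution F
    solution = go arr refl
      where
      go : ∀ xs → arr ≡ xs → Solution F
      go []            eq = rooted c refl
        where
        rooted : ∀ d → c ≡ d → Solution F
        rooted ∅            c≡ = contradiction c≡ c≢∅
        rooted (node w _ _) c≡ = idle eq (subst (λ d → w ∈ roots d) (sym c≡) (here refl))
      go (x ∷ [])      eq = case subst (Even ∘ length ∘ map arrive) eq even of λ ()
      go (x ∷ x′ ∷ xs) eq = busy eq (suc₂⁻¹ (subst (Even ∘ length ∘ map arrive) eq even))

  -- All trees together

  NoIsolated : Set
  NoIsolated = ∀ {a b} → a ~ b → (∀ {w} → a ~ w → w ≡ b) → (∀ {w} → b ~ w → w ≡ a) → ⊥

  rootSolution : NoIsolated → ∀ v c → Tree [] (node v c ∅) → Unique (verts (node v c ∅)) → Solution (node v c ∅)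
  rootSolution nice v c g@(_ , nb , kt , kf , dv , gc , _) u with I∨J v
  ... | inj₁ Iv = RootI.solution (process v [] c gc uc p∉c (extend dv rootPath)) nb v∉c Iv (kt Iv)
    where open Shape g u (λ ())
  ... | inj₂ Jv = byShape c g u
    where
    generic : ∀ c → Tree [] (node v c ∅) → Unique (verts (node v c ∅)) →
              (∀ α → (∀ {w} → inI w ≡ true → w ~ v → w ≡ α) → (∀ {d} → d ∈ roots c → inI d ≡ true) → ⊥) → Solution (node v c ∅)
    generic c g@(_ , nb , kt , kf , dv , gc , _) u imp =
      RootJ.solution (process v [] c gc uc p∉c (extend dv rootPath)) nb v∉c Jv (kf Jv) gc (λ _ α only all → ⊥-elim (imp α only all))
      where open Shape g u (λ ())
    byShape : ∀ c → Tree [] (node v c ∅) → Unique (verts (node v c ∅)) → Solution (node v c ∅)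
    byShape ∅ (_ , _ , _ , kf , _) _ = case kf Jv of λ { (_ , () , _) }
    byShape c@(node x c₁ (node y c₂ s)) g@(_ , _ , _ , _ , _ , gc@(v~x , _ , _ , _ , _ , _ , v~y , _) , _) u =
      -- Two children in I would both be the unique neighbour α.
      generic c g u (λ α only all → All.lookup (AllPairs.head (AllPairs-++ˡ (verts c) (AllPairs.tail u))) (∈-++⁺ʳ (verts c₁) (here refl))
        (≡-trans (only (all (here refl)) (~-sym v~x)) (sym (only (all (there (here refl))) (~-sym v~y)))))
    byShape c@(node x c₁ ∅) g@(_ , nb , kt , kf , dv , gc@(v~x , nbₓ , ktₓ , kfₓ , dx , gc₁ , _) , _) u with I∨J x
    ... | inj₂ Jx = generic c g u (λ α only all → case ≡-trans (sym (all (here refl))) Jx of λ ())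
    ... | inj₁ Ix = RootJ.solution (proj₁ step) nb v∉c Jv (kf Jv) gc
        (λ pend≡[] α only _ → let only′ = λ {w} (Iw : inI w ≡ true) (w~v : w ~ v) → ≡-trans (only Iw w~v) (sym (only Ix (~-sym v~x))) ; rest≡[] , even = proj₂ step pend≡[] in
          Pendant.solution S nbₓ X.v∉c X.p∉₁ Ix (ktₓ Ix) gc₁ Jv v~x only′ rest≡[] even c₁≢∅)
      where
      open Shape g u (λ ())
      module X = Shape gc uc p∉c
      S : State (x ∷ v ∷ []) c₁
      S = process x (v ∷ []) c₁ gc₁ X.uc X.p∉c (extend dx (extend dv rootPath))
      step = Node.IStep.stepI S nbₓ X.v∉c X.p∉₁ Ix (ktₓ Ix) (here refl) v~x
      c₁≢∅ : c₁ ≢ ∅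
      -- If nothing lay below x, the edge vx would be isolated.
      c₁≢∅ refl = nice v~x
        (λ v~w → case nb v~w of λ { (inj₂ (here eq)) → eq })
        (λ x~w → case nbₓ x~w of λ { (inj₁ (here eq)) → eq })

  solveForest : NoIsolated → ∀ f → Tree [] f → Unique (verts f) → Solution f
  solveForest nice ∅ _ _ = record { comps = [] ; lowers = [] ; tokens↭ = ↭-refl ; lowers↭ = ↭-refl ; inside = [] ; disjoint = [] ; bounded = λ _ → z≤n ; locally = λ _ _ → refl }
  solveForest nice (node v c s) g@(at , nb , kt , kf , dv , gc , gs) u =
    combine g u (rootSolution nice v c (at , nb , kt , kf , dv , gc , tt) (subst (λ l → Unique (v ∷ l)) (sym (Listₚ.++-identityʳ (verts c))) (AllPairs-++ˡ (v ∷ verts c) u)))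
      (solveForest nice s gs (AllPairs-++ʳ (v ∷ verts c) u))

  -- Every edge gives exactly one I-J or J-J form

  orient-< : ∀ {a b} → a < b → orient (a , b) ≡ (a , b)
  orient-< {a} {b} a<b with a Finₚ.<? b
  ... | yes _  = refl
  ... | no a≮b = contradiction a<b a≮b

  orient-> : ∀ {a b} → a < b → orient (b , a) ≡ (a , b)
  orient-> {a} {b} a<b with b Finₚ.<? a
  ... | yes b<a = contradiction a<b (Finₚ.<-asym b<a)
  ... | no _    = refl

  orient-∈ : ∀ {a b} → a ~ b → orient (a , b) ∈ edges
  orient-∈ {a} {b} a~b with Finₚ.<-cmp a b
  ... | tri< a<b _ _ = subst (_∈ edges) (sym (orient-< a<b)) (edge-∈ a<b a~b)
  ... | tri≈ _ a≡b _ = contradiction a~b (~-irrefl a≡b)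
  ... | tri> _ _ b<a = subst (_∈ edges) (sym (orient-> b<a)) (edge-∈ b<a (~-sym a~b))

  orient-≡ : ∀ {a b a′ b′} → orient (a , b) ≡ orient (a′ , b′) → (a , b) ≡ (a′ , b′) ⊎ (a , b) ≡ (b′ , a′)
  orient-≡ {a} {b} {a′} {b′} eq with a Finₚ.<? b | a′ Finₚ.<? b′
  ... | yes _ | yes _ = inj₁ eq
  ... | yes _ | no _  = inj₂ eq
  ... | no _  | yes _ = inj₂ (cong Product.swap eq)
  ... | no _  | no _  = inj₁ (cong Product.swap eq)

  Directed : V × V → Set
  Directed (a , d) = inI d ≡ false × (inI a ≡ true ⊎ inI a ≡ false × dep a ℕ.< dep d)

  -- Only one of the two orientations of an edge is `Directed`: the end in I, or else the end of
  -- smaller depth, comes first.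
  orient-injective : ∀ {s s′} → Directed s → Directed s′ → orient s ≡ orient s′ → s ≡ s′
  orient-injective {a , d} {a′ , d′} (Jd , x) (Jd′ , y) eq with orient-≡ {a} {d} {a′} {d′} eq
  ... | inj₁ q    = q
  ... | inj₂ refl = contradiction x λ where
    (inj₁ Ia)       → case ≡-trans (sym Ia) Jd′ of λ ()
    (inj₂ (_ , a<d)) → case y of λ where
      (inj₁ Ia′)        → case ≡-trans (sym Ia′) Jd of λ ()
      (inj₂ (_ , d<a)) → ℕₚ.<-asym a<d d<a

  private
    I?~ : ∀ v i → Dec (inI i ≡ true × i ~ v)
    I?~ v i = I? i ×-dec (i ~? v)
    J?~ : ∀ v i → Dec (inI i ≡ false × i ~ v)
    J?~ v i = J? i ×-dec (i ~? v)

  token⁻ : ∀ v {i k} → (i , k) ∈ tokensAt v → k ≡ v × inI k ≡ false × inI i ≡ true × i ~ k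
  token⁻ v q with I∨J v
  ... | inj₁ Iv = case subst (_ ∈_) (tokensAt-I Iv) q of λ ()
  ... | inj₂ Jv with ∈-map⁻ (_, v) (subst (_ ∈_) (tokensAt-J Jv) q)
  ... | _ , i∈ , refl = refl , Jv , proj₂ (∈-filter⁻ (I?~ v) {xs = allFin n} i∈)

  token⁺ : ∀ {i v} → inI i ≡ true → inI v ≡ false → i ~ v → (i , v) ∈ tokensAt v
  token⁺ {i} {v} Ii Jv i~v = subst (_ ∈_) (sym (tokensAt-J Jv)) (∈-map⁺ (_, v) (∈-filter⁺ (I?~ v) (∈-allFin i) (Ii , i~v)))

  tokens⁻ : ∀ vs {i k} → (i , k) ∈ concatMap tokensAt vs → k ∈ vs × inI k ≡ false × inI i ≡ true × i ~ k
  tokens⁻ (v ∷ vs) q with ∈-++⁻ (tokensAt v) q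
  ... | inj₁ r = let eq , facts = token⁻ v r in here eq , facts
  ... | inj₂ r = let k∈ , facts = tokens⁻ vs r in there k∈ , facts

  tokens⁺ : ∀ vs {i k} → k ∈ vs → inI i ≡ true → inI k ≡ false → i ~ k → (i , k) ∈ concatMap tokensAt vs
  tokens⁺ (v ∷ vs) (here refl) Ii Jk i~k = ∈-++⁺ˡ (token⁺ Ii Jk i~k)
  tokens⁺ (v ∷ vs) (there k∈)  Ii Jk i~k = ∈-++⁺ʳ (tokensAt v) (tokens⁺ vs k∈ Ii Jk i~k)

  tokens-unique : ∀ {vs} → Unique vs → Unique (concatMap tokensAt vs)
  tokens-unique []               = []
  tokens-unique {v ∷ vs} (v∉ ∷ u) = AllPairsₚ.++⁺ at-v (tokens-unique u)
      (All.tabulate (λ s∈ → All.tabulate (λ s′∈ → λ { refl → All.lookup v∉ (proj₁ (tokens⁻ vs s′∈)) (sym (proj₁ (token⁻ v s∈))) })))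
    where
    at-v : Unique (tokensAt v)
    at-v with I∨J v
    ... | inj₁ Iv = subst Unique (sym (tokensAt-I Iv)) []
    ... | inj₂ Jv = subst Unique (sym (tokensAt-J Jv)) (Uniqueₚ.map⁺ (cong proj₁) (Uniqueₚ.filter⁺ (I?~ v) (Uniqueₚ.allFin⁺ n)))

  lowerAt⁻ : ∀ v p {a d} → (a , d) ∈ lowerAt v p → d ≡ v × a ∈ p × inI v ≡ false × inI a ≡ false × a ~ v
  lowerAt⁻ v p q with I∨J v
  ... | inj₁ Iv = case subst (_ ∈_) (lowerAt-I p Iv) q of λ ()
  ... | inj₂ Jv with ∈-map⁻ (_, v) (subst (_ ∈_) (lowerAt-J p Jv) q)
  ... | _ , a∈ , refl = let a∈p , Ja , a~v = ∈-filter⁻ (J?~ v) {xs = p} a∈ in refl , a∈p , Jv , Ja , a~v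

  lowerAt⁺ : ∀ {v p a} → a ∈ p → inI v ≡ false → inI a ≡ false → a ~ v → (a , v) ∈ lowerAt v p
  lowerAt⁺ {v} {p} a∈ Jv Ja a~v = subst (_ ∈_) (sym (lowerAt-J p Jv)) (∈-map⁺ (_, v) (∈-filter⁺ (J?~ v) a∈ (Ja , a~v)))

  lower⁻ : ∀ p f → Tree p f → Path p → ∀ {a d} → (a , d) ∈ lowerIn p f →
           d ∈ verts f × inI d ≡ false × inI a ≡ false × a ~ d × dep a ℕ.< dep d
  lower⁻ p (node v c s) (_ , _ , _ , _ , dv , gc , gs) P q with ∈-++⁻ (lowerAt v p) q
  ... | inj₁ r with lowerAt⁻ v p r
  ... | refl , a∈ , Jv , Ja , a~v = here refl , Jv , Ja , a~v , All.lookup (above dv P) a∈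
  lower⁻ p (node v c s) (_ , _ , _ , _ , dv , gc , gs) P q | inj₂ r with ∈-++⁻ (lowerIn (v ∷ p) c) r
  ... | inj₁ x = let d∈ , facts = lower⁻ (v ∷ p) c gc (extend dv P) x in there (∈-++⁺ˡ d∈) , facts
  ... | inj₂ x = let d∈ , facts = lower⁻ p s gs P x in there (∈-++⁺ʳ (verts c) d∈) , facts

  lower-c : ∀ p v c s {x} → x ∈ lowerIn (v ∷ p) c → x ∈ lowerIn p (node v c s)
  lower-c p v c s = ∈-++⁺ʳ (lowerAt v p) ∘ ∈-++⁺ˡ

  lower-s : ∀ p v c s {x} → x ∈ lowerIn p s → x ∈ lowerIn p (node v c s)
  lower-s p v c s = ∈-++⁺ʳ (lowerAt v p) ∘ ∈-++⁺ʳ (lowerIn (v ∷ p) c)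

  lower⁺ : ∀ p f → Tree p f → ∀ {a d} → a ∈ verts f → inI a ≡ false → inI d ≡ false → a ~ d →
           (d , a) ∈ lowerIn p f ⊎ (a , d) ∈ lowerIn p f
  lower⁺ p (node v c s) (_ , nb , _ , _ , _ , gc , gs) (here refl) Ja Jd a~d with nb a~d
  ... | inj₁ d∈ = inj₁ (∈-++⁺ˡ (lowerAt⁺ d∈ Ja Jd (~-sym a~d)))
  ... | inj₂ d∈ = Sum.swap (Sum.map (lower-c p v c s) (lower-c p v c s) (lower⁺ (v ∷ p) c gc d∈ Jd Ja (~-sym a~d)))
  lower⁺ p (node v c s) (_ , nb , _ , _ , _ , gc , gs) (there a∈) Ja Jd a~d with ∈-++⁻ (verts c) a∈
  ... | inj₁ q = Sum.map (lower-c p v c s) (lower-c p v c s) (lower⁺ (v ∷ p) c gc q Ja Jd a~d)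
  ... | inj₂ q = Sum.map (lower-s p v c s) (lower-s p v c s) (lower⁺ p s gs q Ja Jd a~d)

  lower-unique : ∀ p f → Tree p f → Path p → Unique (verts f) → Unique (lowerIn p f)
  lower-unique p ∅ _ _ _ = []
  lower-unique p (node v c s) (_ , _ , _ , _ , dv , gc , gs) P (v∉ ∷ u) = AllPairsₚ.++⁺ at-v
      (AllPairsₚ.++⁺ (lower-unique (v ∷ p) c gc P′ (AllPairs-++ˡ (verts c) u)) (lower-unique p s gs P (AllPairs-++ʳ (verts c) u))
        (All.tabulate (λ x∈ → All.tabulate (λ y∈ → λ { refl → AllPairs-cross (verts c) u (proj₁ (lower⁻ (v ∷ p) c gc P′ x∈)) (proj₁ (lower⁻ p s gs P y∈)) refl }))))
      (All.tabulate (λ x∈ → All.tabulate (λ y∈ → λ { refl → All.lookup v∉ (below y∈) (sym (proj₁ (lowerAt⁻ v p x∈))) })))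
    where
    P′ = extend dv P
    below : ∀ {a d} → (a , d) ∈ lowerIn (v ∷ p) c ++ lowerIn p s → d ∈ verts c ++ verts s
    below q = [ (λ r → ∈-++⁺ˡ (proj₁ (lower⁻ (v ∷ p) c gc P′ r))) , (λ r → ∈-++⁺ʳ (verts c) (proj₁ (lower⁻ p s gs P r))) ]′ (∈-++⁻ (lowerIn (v ∷ p) c) q)
    p-unique : Unique p
    p-unique = AllPairs.map (λ { q refl → ℕₚ.<-irrefl refl q }) (Path.sorted P)
    at-v : Unique (lowerAt v p)
    at-v with I∨J v
    ... | inj₁ Iv = subst Unique (sym (lowerAt-I p Iv)) []
    ... | inj₂ Jv = subst Unique (sym (lowerAt-J p Jv)) (Uniqueₚ.map⁺ (cong proj₁) (Uniqueₚ.filter⁺ (J?~ v) p-unique))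

  -- At the empty path this is the independence of I; the induction has to admit neighbours on the
  -- path, which are ruled out one level at a time.
  independent : ∀ p f → Tree p f → ∀ {a b} → a ∈ verts f → inI a ≡ true → inI b ≡ true → a ~ b → b ∈ p
  independent p (node v c s) (_ , nb , kt , _) (here refl) Ia Ib a~b with nb a~b
  ... | inj₁ q = q
  ... | inj₂ q = case ≡-trans (sym Ib) (kt Ia q a~b) of λ ()
  independent p (node v c s) (_ , nb , kt , _ , _ , gc , gs) (there a∈) Ia Ib a~b with ∈-++⁻ (verts c) a∈
  ... | inj₂ q = independent p s gs q Ia Ib a~b
  ... | inj₁ q with independent (v ∷ p) c gc q Ia Ib a~b
  ... | here refl = case ≡-trans (sym Ia) (kt Ib q (~-sym a~b)) of λ ()
  ... | there r   = r

  module _ (f : Forest V) (g : Tree [] f) (full : verts f ↭ allFin n) where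

    unique : Unique (verts f)
    unique = AllPairs-↭ (_∘ sym) (↭-sym full) (Uniqueₚ.allFin⁺ n)

    ∈f : ∀ v → v ∈ verts f
    ∈f v = ∈-resp-↭ (↭-sym full) (∈-allFin v)

    pairs : List (V × V)
    pairs = tokensIn f ++ lowerIn [] f

    pairs⁻ : ∀ {s} → s ∈ pairs → proj₁ s ~ proj₂ s × Directed s
    pairs⁻ s∈ with ∈-++⁻ (tokensIn f) s∈
    ... | inj₁ q = let _ , Jk , Ii , i~k = tokens⁻ (verts f) q in i~k , Jk , inj₁ Ii
    ... | inj₂ q = let _ , Jd , Ja , a~d , a<d = lower⁻ [] f g rootPath q in a~d , Jd , inj₂ (Ja , a<d)

    pairs⁺ : ∀ {a b} → a ~ b → (a , b) ∈ pairs ⊎ (b , a) ∈ pairs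
    pairs⁺ {a} {b} a~b with I∨J a | I∨J b
    ... | inj₁ Ia | inj₁ Ib = case independent [] f g (∈f a) Ia Ib a~b of λ ()
    ... | inj₁ Ia | inj₂ Jb = inj₁ (∈-++⁺ˡ (tokens⁺ (verts f) (∈f b) Ia Jb a~b))
    ... | inj₂ Ja | inj₁ Ib = inj₂ (∈-++⁺ˡ (tokens⁺ (verts f) (∈f a) Ib Ja (~-sym a~b)))
    ... | inj₂ Ja | inj₂ Jb = Sum.swap (Sum.map (∈-++⁺ʳ (tokensIn f)) (∈-++⁺ʳ (tokensIn f)) (lower⁺ [] f g (∈f a) Ja Jb a~b))

    pairs-unique : Unique pairs
    pairs-unique = AllPairsₚ.++⁺ (tokens-unique unique) (lower-unique [] f g rootPath unique)
      (All.tabulate (λ x∈ → All.tabulate (λ y∈ → λ { refl → case ≡-trans (sym (proj₁ (proj₂ (proj₂ (tokens⁻ (verts f) x∈))))) (proj₁ (proj₂ (proj₂ (lower⁻ [] f g rootPath y∈)))) of λ () })))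

    oriented : map orient pairs ↭ edges
    oriented = unique-↭ (unique-map orient (λ x∈ y∈ → orient-injective (proj₂ (pairs⁻ x∈)) (proj₂ (pairs⁻ y∈))) pairs-unique) edges-unique
      (λ q → let s , s∈ , eq = ∈-map⁻ orient q in subst (_∈ edges) (sym eq) (orient-∈ (proj₁ (pairs⁻ s∈))))
      (λ { {a , b} q → let a<b , a~b = edges-adjacent q in
        [ (λ r → subst (_∈ map orient pairs) (orient-< a<b) (∈-map⁺ orient r)) , (λ r → subst (_∈ map orient pairs) (orient-> a<b) (∈-map⁺ orient r)) ]′ (pairs⁺ a~b) })

    choosable₅ : Nice → Algebraic⟨1, 5 ⟩-choosable
    choosable₅ nice = assemble comps lowers disjoint
        (All-resp-↭ tokens↭ (All.tabulate (λ q → proj₁ (proj₂ (tokens⁻ (verts f) q)))))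
        (↭-trans (map⁺ orient (++⁺ (↭-sym tokens↭) (↭-sym lowers↭))) oriented)
        (λ a b a~b → ℕₚ.≤-trans (ℕₚ.≤-reflexive (≡-trans (tot-++ _ (concatMap Component.allDirs comps) (map Lower.dir lowers))
          (cong (uses-all a b (concatMap Component.allDirs comps) ℕ.+_) (tot-map (uses a b) Lower.dir lowers)))) (bounded a~b))
      where open Solution (solveForest (no-isolated nice) f g unique)

theorem5p1 : (n : ℕ) (G : Graph n) → Graph.Nice G → Graph.Algebraic⟨1,_⟩-choosable G 5
theorem5p1 n G nice = let f , full , inI , dep , g = Search.searchForest G in Construction.choosable₅ G inI dep f g full nice
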